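{- There is no algorithm which, upon any input of a finite Abelian group $G_0$, a set $E\subset G_0$, and a finite set $F\subset \mathbb{Z}^2\times G_0$, computes in finite time whether $F$ tiles $\mathbb{Z}^2\times E$.
   Context: For an Abelian group $G$, a finite set $F\subset G$ and a set $E'\subset G$, we say $F$ tiles $E'$ (by translations) if there exists $A\subset G$ with $A\oplus F=E'$, meaning that the elements $a+f$ ($a\in A$, $f\in F$) are pairwise distinct (i.e. the translates of $F$ along $A$ cover each point exactly once) and $\{a+f: a\in A, f\in F\}=E'$. -}

module Defs where

open import Level using (Level; _⊔_; suc; zero)
open import Data.Nat using (ℕ; _+_; _*_; _^_; _<_) renaming (suc to sucℕ; zero to zeroℕ)
open import Data.Nat.DivMod using (_%_)
open import Data.Integer using (ℤ; +_; -[1+_]) renaming (_+_ to _+ℤ_)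
open import Data.Vec using (Vec; []; _∷_)
open import Data.List using (List; []; _∷_; map)
open import Data.List.Membership.Propositional using (_∈_)
open import Data.List.Relation.Unary.All using (All)
open import Data.Maybe using (Maybe; just; nothing)
open import Data.Product using (Σ; ∃; _×_; _,_; proj₁; proj₂)
open import Data.Unit using (⊤)
open import Relation.Nullary using (¬_)
open import Relation.Binary.PropositionalEquality using (_≡_)

-- Finite Abelian groups  G₀ = ℤ/(m₁+1) × … × ℤ/(mₖ+1)
-- (every finite Abelian group is isomorphic to one of these; this is the
-- standard finite presentation of G₀ as an algorithmic input).
-- Moduli are given as a vector ms of predecessors, so every modulus is ≥ 1.
-- Elements are vectors of canonical residues.

Canon : ∀ {k} → Vec ℕ k → Vec ℕ k → Set
Canon []       []       = ⊤
Canon (m ∷ ms) (x ∷ xs) = (x < sucℕ m) × Canon ms xs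

addG : ∀ {k} → Vec ℕ k → Vec ℕ k → Vec ℕ k → Vec ℕ k
addG []       []       []       = []
addG (m ∷ ms) (x ∷ xs) (y ∷ ys) = ((x + y) % sucℕ m) ∷ addG ms xs ys

Point : ℕ → Set
Point k = ℤ × ℤ × Vec ℕ k

InG : ∀ {k} → Vec ℕ k → Point k → Set
InG ms (_ , _ , g) = Canon ms g

addP : ∀ {k} → Vec ℕ k → Point k → Point k → Point k
addP ms (a₁ , a₂ , g) (b₁ , b₂ , h) = (a₁ +ℤ b₁) , (a₂ +ℤ b₂) , addG ms g h

record TilesVia {k} (ms : Vec ℕ k) (F : List (Point k))
                (E' : Point k → Set) (A : Point k → Set) : Set where
  field
    A⊆G      : ∀ a → A a → InG ms a
    distinct : ∀ {a a′ f f′} → A a → A a′ → f ∈ F → f′ ∈ F →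
               addP ms a f ≡ addP ms a′ f′ → (a ≡ a′) × (f ≡ f′)
    cover    : ∀ {a f} → A a → f ∈ F → E' (addP ms a f)
    onto     : ∀ x → E' x → Σ (Point k) λ a → Σ (Point k) λ f →
               A a × f ∈ F × addP ms a f ≡ x

Tiles : ∀ {k} → Vec ℕ k → List (Point k) → (Point k → Set) → Set₁
Tiles {k} ms F E' = Σ (Point k → Set) λ A → TilesVia ms F E' A

Z²× : ∀ {k} → List (Vec ℕ k) → Point k → Set
Z²× E (_ , _ , g) = g ∈ E

record Instance : Set where
  field
    k   : ℕ
    ms  : Vec ℕ k
    E   : List (Vec ℕ k)
    F   : List (Point k)
    E⊆G : All (Canon ms) E
    F⊆G : All (InG ms) F

TilingProblem : Instance → Set₁
TilingProblem I = Tiles (Instance.ms I) (Instance.F I) (Z²× (Instance.E I))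

-- Encoding of instances as natural numbers (primitive recursive, injective).

pair : ℕ → ℕ → ℕ
pair a b = (2 ^ a) * (sucℕ (2 * b))

encList : List ℕ → ℕ
encList []       = 0
encList (x ∷ xs) = pair x (encList xs)

vecToList : ∀ {n} → Vec ℕ n → List ℕ
vecToList []       = []
vecToList (x ∷ xs) = x ∷ vecToList xs

encℤ : ℤ → ℕ
encℤ (+ n)    = 2 * n
encℤ -[1+ n ] = sucℕ (2 * n)

encPoint : ∀ {k} → Point k → ℕ
encPoint (a , b , g) = encList (encℤ a ∷ encℤ b ∷ encList (vecToList g) ∷ [])

encInstance : Instance → ℕ
encInstance I = encList
  ( Instance.k I
  ∷ encList (vecToList (Instance.ms I))
  ∷ encList (map (λ g → encList (vecToList g)) (Instance.E I))
  ∷ encList (map encPoint (Instance.F I))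
  ∷ [])

-- Model of computation: register (Minsky) machines, a Turing-complete model.
-- Registers indexed by ℕ; the input is placed in register 0, all others 0;
-- the machine halts when the program counter leaves the program, and the
-- output is the content of register 0.

data Instr : Set where
  inc   : ℕ → Instr
  decjz : ℕ → ℕ → Instr

Program : Set
Program = List Instr

fetch : Program → ℕ → Maybe Instr
fetch []       _         = nothing
fetch (i ∷ _)  zeroℕ     = just i
fetch (_ ∷ is) (sucℕ n)  = fetch is n

Regs : Set
Regs = ℕ → ℕ

upd : Regs → ℕ → ℕ → Regs
upd R zeroℕ    v zeroℕ    = v
upd R zeroℕ    v (sucℕ j) = R (sucℕ j)
upd R (sucℕ r) v zeroℕ    = R zeroℕ
upd R (sucℕ r) v (sucℕ j) = upd (λ i → R (sucℕ i)) r v j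

run : Program → ℕ → ℕ × Regs → Maybe ℕ
run p n (pc , R) with fetch p pc
run p n        (pc , R) | nothing = just (R 0)
run p zeroℕ    (pc , R) | just _  = nothing
run p (sucℕ n) (pc , R) | just (inc r) = run p n (sucℕ pc , upd R r (sucℕ (R r)))
run p (sucℕ n) (pc , R) | just (decjz r j) with R r
... | zeroℕ  = run p n (j , R)
... | sucℕ v = run p n (sucℕ pc , upd R r v)

initial : ℕ → ℕ × Regs
initial x = 0 , λ { zeroℕ → x ; (sucℕ _) → 0 }

HaltsWith : Program → ℕ → ℕ → Set
HaltsWith p x y = ∃ λ n → run p n (initial x) ≡ just y

AlgorithmicallyDecidable : ∀ {a ℓ} {X : Set a} → (X → ℕ) → (X → Set ℓ) → Set (a ⊔ ℓ)
AlgorithmicallyDecidable {X = X} enc P =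
  Σ Program λ p → ∀ (x : X) →
    (P x → HaltsWith p (enc x) 1) × (¬ P x → HaltsWith p (enc x) 0)

{-# OPTIONS --safe #-}

-- A set A ⊕ F = ℤ² × E over G₀ = ℤ/(M+1) × ℤ/2 × (ℤ/N)^q is the graph of an unknown vector x(n,t) ∈ (ℤ/N)^q,
-- n ∈ ℤ², t ∈ ℤ/2, subject to M simultaneous tiling equations.  On t = 0 the equations force x(n,0) to be the
-- indicator of one symbol ω(n) of a finite alphabet (x(n,1) is the complementary indicator), and force chosen
-- functions of ω to be constant along chosen directions.  So one may impose an arbitrary local rule on finitely
-- many functions f_ℓ(ℓ(x,y)) of integral linear forms ℓ ("linear sampling", Aanderaa and Lewis).
--
-- For pairwise coprime bases b₀, …, b_k the functions include the last nonzero b_i-adic digit of the forms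
-- x, y, y + m x and x + m y (m = 1, 2, b_i).  The relations between these digits are local rules, and conversely
-- they force the functions to be digits, b_i-adically around some centre: if digits up to b^(K-1) are known, the
-- rule for y + b x makes all multiples of b^K point to a common next approximation of the centre.  Digits decide
-- whether v(y) = v(m x) for the valuations v, so flags on x and y can carry configurations of a counter machine:
-- the registers are the b_i-adic valuations, and an increment is a passage from x to y ≈ b_i x.  One more base
-- counts time, which makes the flags of the intended solution decidable.
--
-- Hence there are instances J(d) that tile iff a machine started on d never fails, and they depend on d only through
-- the single slope X = b₁^d.  Given a decider p, the machine first computes the encoding of J(d) from d, if d is the
-- description of the rest of that instance, then runs p on it and fails if p answers 1: a contradiction.
module Submission where

-- A symbol sees last digits, never a valuation. Proximity of `o` and `m u` is therefore recognised
-- by the ratio 1 : 1 : 2 of the digits of `o`, `m u` and `o + m u`: for unequal valuations the sum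
-- would inherit the digit of one summand. Conversely, the rules fix the digit of a sum only up to
-- three candidates; it becomes unique by writing the same number in two ways, 1 = -1 + 2 = -2 + 3
-- or 2 = 1 + 1 = -1 + 3. Wrong candidates differ by factors dividing 12, and this is why all bases
-- are 1 modulo 12. Bases need not be prime: digits are residues not divisible by the base, and
-- cancelling needs Bézout certificates.
--
-- The centre of a solution may be a proper b-adic integer, so no point of the plane need realise
-- it. A run up to a given time involves bounded valuations only, so a centre modulo high powers,
-- glued over all bases by Chinese remainders, is enough.
--
-- Circularity is avoided by the order of choices: the decider fixes the number of bases, this fixes
-- the multiplier in the encoder, both fix the machine, the machine fixes the family of instances,
-- and only then is the input chosen. The machine does not contain its own instance; it rebuilds
-- only the tile points that carry X.

-- Congruences, Bézout coprimality, Chinese remainders and the pointing lemma.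

module Arithmetic where

  open import Data.Nat as ℕ using (ℕ; zero; suc; z≤n; s≤s)
  import Data.Nat.Properties as ℕₚ
  import Data.Nat.Divisibility as ℕᵈ
  open import Data.Integer using (ℤ; +_; _+_; _-_; _*_; -_; _^_; ∣_∣; 0ℤ; 1ℤ)
  import Data.Integer.Properties as ℤₚ
  open import Data.Integer.Divisibility.Signed
  open import Data.Integer.Tactic.RingSolver using (solve-∀)
  open import Data.Fin using (Fin; toℕ)
  import Data.Fin as Fin
  import Data.Fin.Properties as Finₚ
  open import Data.List using (List; []; _∷_; length; map; _++_; lookup)
  open import Data.List.Properties using (length-++; length-map)
  open import Data.List.Relation.Unary.All as All using (All; []; _∷_; all?)
  open import Data.List.Relation.Unary.All.Properties using (¬All⇒Any¬; ++⁻ˡ; ++⁻ʳ; map⁻)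
  import Data.List.Relation.Unary.Any as Any
  open import Data.List.Relation.Unary.Any.Properties using (lookup-index)
  open import Data.Product using (Σ; ∃; _,_; proj₁; proj₂)
  open import Data.Sum using (_⊎_; inj₁; inj₂)
  open import Data.Empty using (⊥; ⊥-elim)
  open import Relation.Nullary using (¬_; Dec; yes; no)
  open import Relation.Nullary.Decidable using (¬?; decidable-stable; map′)
  open import Relation.Binary.PropositionalEquality

  recast : ∀ {b e e′} → b ∣ e → e ≡ e′ → b ∣ e′
  recast d refl = d

  -- Wrapped in a record so that unification recovers `u` and `v`, which the subtraction would hide.
  record Cg (b u v : ℤ) : Set where
    constructor cg
    field dvd : b ∣ u - v
  open Cg

  cg? : ∀ b u v → Dec (Cg b u v)
  cg? b u v = map′ cg dvd (b ∣? (u - v))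

  module _ {b : ℤ} where

    cg-refl : ∀ {u} → Cg b u u
    cg-refl {u} = cg (recast (divides 0ℤ refl) (sym (ℤₚ.+-inverseʳ u)))

    cg-reflexive : ∀ {u v} → u ≡ v → Cg b u v
    cg-reflexive refl = cg-refl

    cg-sym : ∀ {u v} → Cg b u v → Cg b v u
    cg-sym {u} {v} (cg d) = cg (recast (∣m⇒∣-m d) (eq u v))
      where eq : ∀ u v → - (u + - v) ≡ v + - u
            eq = solve-∀

    cg-trans : ∀ {u v w} → Cg b u v → Cg b v w → Cg b u w
    cg-trans {u} {v} {w} (cg d) (cg e) = cg (recast (∣m∣n⇒∣m+n d e) (eq u v w))
      where eq : ∀ u v w → u + - v + (v + - w) ≡ u + - w
            eq = solve-∀

    cg-+ : ∀ {u v u′ v′} → Cg b u v → Cg b u′ v′ → Cg b (u + u′) (v + v′)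
    cg-+ {u} {v} {u′} {v′} (cg d) (cg e) = cg (recast (∣m∣n⇒∣m+n d e) (eq u v u′ v′))
      where eq : ∀ u v u′ v′ → u + - v + (u′ + - v′) ≡ u + u′ + - (v + v′)
            eq = solve-∀

    cg-*ˡ : ∀ k {u v} → Cg b u v → Cg b (k * u) (k * v)
    cg-*ˡ k {u} {v} (cg d) = cg (recast (∣n⇒∣m*n k d) (eq k u v))
      where eq : ∀ k u v → k * (u + - v) ≡ k * u + - (k * v)
            eq = solve-∀

    cg-neg : ∀ {u v} → Cg b u v → Cg b (- u) (- v)
    cg-neg {u} {v} (cg d) = cg (recast (∣m⇒∣-m d) (eq u v))
      where eq : ∀ u v → - (u + - v) ≡ - u + - (- v)
            eq = solve-∀

    cg-∣ : ∀ {u v} → Cg b u v → b ∣ v → b ∣ u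
    cg-∣ {u} {v} (cg d) e = recast (∣m∣n⇒∣m+n d e) (eq u v)
      where eq : ∀ u v → u + - v + v ≡ u
            eq = solve-∀

    cg-^ : ∀ {u} n → Cg b u 1ℤ → Cg b (u ^ n) 1ℤ
    cg-^ zero    e = cg-refl
    cg-^ {u} (suc n) e = cg-trans (cg-*ˡ u (cg-^ n e)) (cg-trans (cg-reflexive (ℤₚ.*-identityʳ u)) e)

  pos-^ : ∀ m n → + (m ℕ.^ n) ≡ (+ m) ^ n
  pos-^ m zero    = refl
  pos-^ m (suc n) = trans (ℤₚ.pos-* m (m ℕ.^ n)) (cong (+ m *_) (pos-^ m n))

  -- A Bézout certificate: cancellation, products and powers become ring identities, without gcds or
  -- prime factors.
  Cop : ℤ → ℤ → Set
  Cop b c = Σ ℤ λ p → Σ ℤ λ q → p * b + q * c ≡ 1ℤ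

  cop-sym : ∀ {b c} → Cop b c → Cop c b
  cop-sym {b} {c} (p , q , e) = q , p , trans (ℤₚ.+-comm (q * c) (p * b)) e

  cop-cancel : ∀ {b c} → Cop b c → ∀ {u} → b ∣ c * u → b ∣ u
  cop-cancel {b} {c} (p , q , e) {u} d =
    recast (∣m∣n⇒∣m+n (∣n⇒∣m*n (p * u) (∣-refl {b})) (∣n⇒∣m*n q d))
           (trans (eq p q b c u) (trans (cong (_* u) e) (ℤₚ.*-identityˡ u)))
    where eq : ∀ p q b c u → p * u * b + q * (c * u) ≡ (p * b + q * c) * u
          eq = solve-∀

  cop-* : ∀ {b c d} → Cop b c → Cop b d → Cop b (c * d)
  cop-* {b} {c} {d} (p , q , e) (p′ , q′ , e′) =
    p * p′ * b + p * (q′ * d) + q * c * p′ , q * q′ ,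
    trans (eq p q p′ q′ b c d) (cong₂ _*_ e e′)
    where eq : ∀ p q p′ q′ b c d →
               (p * p′ * b + p * (q′ * d) + q * c * p′) * b + q * q′ * (c * d)
               ≡ (p * b + q * c) * (p′ * b + q′ * d)
          eq = solve-∀

  cop-1 : ∀ {b} → Cop b 1ℤ
  cop-1 {b} = 0ℤ , 1ℤ , eq b
    where eq : ∀ b → 0ℤ * b + 1ℤ * 1ℤ ≡ 1ℤ
          eq = solve-∀

  cop-^ : ∀ {b c} n → Cop b c → Cop b (c ^ n)
  cop-^ zero    h = cop-1
  cop-^ (suc n) h = cop-* h (cop-^ n h)

  cop-^^ : ∀ {b c} n m → Cop b c → Cop (b ^ n) (c ^ m)
  cop-^^ n m h = cop-sym (cop-^ n (cop-sym (cop-^ m h)))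

  cop-∣ : ∀ {b c d} → Cop b d → c ∣ d → Cop b c
  cop-∣ {b} {c} (p , q , e) (divides r refl) =
    p , q * r , trans (cong (λ z → p * b + z) (ℤₚ.*-assoc q r c)) e

  ∏ : (ℕ → ℤ) → ℕ → ℤ
  ∏ m zero    = 1ℤ
  ∏ m (suc k) = m k * ∏ m k

  ∣∏ : ∀ m k {i} → i ℕ.< k → m i ∣ ∏ m k
  ∣∏ m (suc k) {i} i<k with ℕₚ.m≤n⇒m<n∨m≡n (ℕₚ.≤-pred i<k)
  ... | inj₁ i<k′ = ∣n⇒∣m*n (m k) (∣∏ m k i<k′)
  ... | inj₂ refl = ∣m⇒∣m*n (∏ m k) ∣-refl

  cop-∏ : ∀ {b} m k → (∀ i → i ℕ.< k → Cop b (m i)) → Cop b (∏ m k)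
  cop-∏ m zero    h = cop-1
  cop-∏ m (suc k) h = cop-* (h k ℕₚ.≤-refl) (cop-∏ m k λ i i<k → h i (ℕₚ.m≤n⇒m≤1+n i<k))

  abstract
    chinese : ∀ (m : ℕ → ℤ) k → (∀ i j → i ℕ.< j → j ℕ.< k → Cop (m j) (m i)) →
              ∀ (r : ∀ i → i ℕ.< k → ℤ) → ∃ λ c → ∀ i (l : i ℕ.< k) → Cg (m i) c (r i l)
    chinese m zero    h r = 0ℤ , λ _ ()
    chinese m (suc k) h r
      with c , hc ← chinese m k (λ i j i<j j<k → h i j i<j (ℕₚ.m≤n⇒m≤1+n j<k)) (λ i l → r i (ℕₚ.m≤n⇒m≤1+n l))
         | p , q , e ← cop-∏ m k (λ i i<k → h i k i<k ℕₚ.≤-refl)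
      = c′ , good
      where
      P rₖ : ℤ
      rₖ = r k ℕₚ.≤-refl
      P = ∏ m k
      c′ : ℤ
      -- As `p * m k + q * P = 1`, the factor `P * q` is 1 modulo the new modulus and 0 modulo all
      -- the old ones.
      c′ = c + P * (q * (rₖ - c))
      eq₁ : ∀ c P q r → c + P * (q * (r + - c)) + - r ≡ (c + - r) * (1ℤ + - (q * P))
      eq₁ = solve-∀
      eq₂ : ∀ c r a x → (c + - r) * (a + x + - x) ≡ (c + - r) * a
      eq₂ = solve-∀
      eq₃ : ∀ c P q r i → c + - i + P * (q * (r + - c)) ≡ c + P * (q * (r + - c)) + - i
      eq₃ = solve-∀
      good : ∀ i (l : i ℕ.< suc k) → Cg (m i) c′ (r i l)
      good i i<k with ℕₚ.m≤n⇒m<n∨m≡n (ℕₚ.≤-pred i<k)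
      ... | inj₁ i<k′ rewrite ℕₚ.≤-irrelevant i<k (ℕₚ.m≤n⇒m≤1+n i<k′) =
        cg (recast (∣m∣n⇒∣m+n (dvd (hc i i<k′)) (∣m⇒∣m*n _ (∣∏ m k i<k′))) (eq₃ c P q rₖ (r i (ℕₚ.m≤n⇒m≤1+n i<k′))))
      ... | inj₂ refl rewrite ℕₚ.≤-irrelevant i<k ℕₚ.≤-refl =
        cg (recast (∣n⇒∣m*n (c - rₖ) (∣n⇒∣m*n p (∣-refl {m k})))
          (sym (trans (eq₁ c P q rₖ)
            (trans (cong (λ z → (c + - rₖ) * (z + - (q * P))) (sym e))
                   (eq₂ c rₖ (p * m k) (q * P))))))

  small-∤ : ∀ {b i j} → i ℕ.< j → j ℕ.< b → ¬ Cg (+ b) (+ j) (+ i)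
  small-∤ {b} {i} {j} i<j j<b (cg d) = ℕₚ.<⇒≱ (ℕₚ.≤-<-trans (ℕₚ.m∸n≤m j i) j<b) (ℕᵈ.∣⇒≤ {{nz}} d′)
    where
    nz : ℕ.NonZero (j ℕ.∸ i)
    nz = ℕ.>-nonZero (ℕₚ.m<n⇒0<n∸m i<j)
    d′ : b ℕᵈ.∣ j ℕ.∸ i
    d′ = subst (b ℕᵈ.∣_) (cong ∣_∣ (trans (ℤₚ.m-n≡m⊖n j i) (ℤₚ.⊖-≥ (ℕₚ.<⇒≤ i<j)))) (∣⇒∣ᵤ d)

  -- If no residue were free, each of the `b` residues would be congruent to some entry, two of them
  -- to the same entry, and hence to each other.
  avoid : ∀ b (xs : List ℤ) → length xs ℕ.< b → ∃ λ s → All (λ x → ¬ (Cg (+ b) s x)) xs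
  avoid b xs len
    with ℕₚ.anyUpTo? (λ s → all? (λ x → ¬? (cg? (+ b) (+ s) x)) xs) b
  ... | yes (s , _ , p) = + s , p
  ... | no none = ⊥-elim clash
    where
    hit : (i : Fin b) → Any.Any (λ x → ¬ ¬ (Cg (+ b) (+ toℕ i) x)) xs
    hit i = ¬All⇒Any¬ (λ x → ¬? (cg? (+ b) (+ toℕ i) x)) xs (λ p → none (toℕ i , Finₚ.toℕ<n i , p))
    at : ∀ i → Cg (+ b) (+ toℕ i) (lookup xs (Any.index (hit i)))
    at i = decidable-stable (cg? _ _ _) (lookup-index (hit i))
    clash : ⊥
    clash with i , j , i<j , e ← Finₚ.pigeonhole len (λ i → Any.index (hit i)) =
      small-∤ i<j (Finₚ.toℕ<n j)
        (cg-trans (subst (λ z → Cg (+ b) (+ toℕ j) (lookup xs z)) (sym e) (at j)) (cg-sym (at i)))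

  -- Read a(m) and c(s) as pointers: the hypothesis leaves no room for two different targets, except for pointers at the target itself.
  module Pointing (b : ℕ) (8<b : 8 ℕ.< b) (a c : ℤ → ℤ)
    (H : ∀ m s → ¬ (Cg (+ b) s m) → (Cg (+ b) (c s) m) ⊎ (Cg (+ b) (a m) s) ⊎ (Cg (+ b) (a m) (c s))) where

    Pts : ℤ → ℤ → Set
    Pts z m = (Cg (+ b) m z) ⊎ (Cg (+ b) (a m) z)

    -- For `s` outside both `ms` and its image under `a`, the middle alternative of `H` is
    -- impossible, so every `m` in `ms` points at `c s`. Four points and their four images have to
    -- be avoided: hence `b > 8`.
    common : ∀ ms → length ms ℕ.≤ 4 → ∃ λ z → All (Pts z) ms
    common ms len = c s , all ms (++⁻ˡ ms av) (map⁻ (++⁻ʳ ms av))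
      where
      bound : length (ms ++ map a ms) ℕ.< b
      bound = ℕₚ.≤-<-trans
        (subst (ℕ._≤ 8) (sym (trans (length-++ ms) (cong (length ms ℕ.+_) (length-map a ms))))
               (ℕₚ.+-mono-≤ len len)) 8<b
      s = proj₁ (avoid b (ms ++ map a ms) bound)
      av = proj₂ (avoid b (ms ++ map a ms) bound)
      all : ∀ xs → All (λ x → ¬ (Cg (+ b) s x)) xs → All (λ x → ¬ (Cg (+ b) s (a x))) xs → All (Pts (c s)) xs
      all [] [] [] = []
      all (x ∷ xs) (p ∷ ps) (q ∷ qs) with H x s p
      ... | inj₁ e        = inj₁ (cg-sym e) ∷ all xs ps qs
      ... | inj₂ (inj₁ e) = ⊥-elim (q (cg-sym e))
      ... | inj₂ (inj₂ e) = inj₂ e ∷ all xs ps qs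

    differ : ∀ {z i j} → i ℕ.< j → j ℕ.< 3 → Cg (+ b) (+ i) z → ¬ (Cg (+ b) (+ j) z)
    differ i<j j<3 p q = small-∤ i<j (ℕₚ.<-trans j<3 (ℕₚ.<-trans 3<8 8<b)) (cg-trans q (cg-sym p))
      where 3<8 : 3 ℕ.< 8
            3<8 = s≤s (s≤s (s≤s (s≤s z≤n)))

    0<1 = ℕₚ.n<1+n 0
    1<2 = ℕₚ.n<1+n 1
    0<2 = ℕₚ.<-trans 0<1 1<2
    1<3 = ℕₚ.<-trans 1<2 (ℕₚ.n<1+n 2)
    2<3 = ℕₚ.n<1+n 2

    -- Each target coincides with at most one of 0, 1, 2, so at least one of the three genuinely
    -- points at both `z` and `z′`.
    agree : ∀ {z z′} → Pts z (+ 0) → Pts z (+ 1) → Pts z (+ 2) →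
            Pts z′ (+ 0) → Pts z′ (+ 1) → Pts z′ (+ 2) → Cg (+ b) z z′
    agree (inj₂ p) _ _ (inj₂ q) _ _ = cg-trans (cg-sym p) q
    agree _ (inj₂ p) _ _ (inj₂ q) _ = cg-trans (cg-sym p) q
    agree _ _ (inj₂ p) _ _ (inj₂ q) = cg-trans (cg-sym p) q
    agree (inj₁ p) (inj₁ q) _ _ _ _ = ⊥-elim (differ 0<1 1<3 p q)
    agree (inj₁ p) _ (inj₁ q) _ _ _ = ⊥-elim (differ 0<2 2<3 p q)
    agree _ (inj₁ p) (inj₁ q) _ _ _ = ⊥-elim (differ 1<2 2<3 p q)
    agree _ _ _ (inj₁ p) (inj₁ q) _ = ⊥-elim (differ 0<1 1<3 p q)
    agree _ _ _ (inj₁ p) _ (inj₁ q) = ⊥-elim (differ 0<2 2<3 p q)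
    agree _ _ _ _ (inj₁ p) (inj₁ q) = ⊥-elim (differ 1<2 2<3 p q)

    abstract
      centre : ∃ λ z → ∀ m → Pts z m
      centre with common (+ 0 ∷ + 1 ∷ + 2 ∷ []) (s≤s (s≤s (s≤s z≤n)))
      ... | z , p₀ ∷ p₁ ∷ p₂ ∷ [] = z , pts
        where
        pts : ∀ m → Pts z m
        -- The extra points 0, 1, 2 identify the target found for `m` with the one already chosen.
        pts m with common (+ 0 ∷ + 1 ∷ + 2 ∷ m ∷ []) ℕₚ.≤-refl
        ... | z′ , q₀ ∷ q₁ ∷ q₂ ∷ q ∷ [] with agree p₀ p₁ p₂ q₀ q₁ q₂ | q
        ...   | e | inj₁ r = inj₁ (cg-trans r (cg-sym e))
        ...   | e | inj₂ r = inj₂ (cg-trans r (cg-sym e))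

-- Valuations and last nonzero digits of integers in a base that need not be prime.

module Digits where

  open Arithmetic
  open import Data.Nat as ℕ using (ℕ; zero; suc; z≤n; s≤s)
  import Data.Nat.Properties as ℕₚ
  open import Data.Nat.DivMod using (m<n⇒m%n≡m)
  open import Data.Integer using (ℤ; +_; _+_; _-_; _*_; -_; _^_; ∣_∣; 0ℤ; 1ℤ; _≟_)
  open import Data.Integer.Base using (_%ℕ_; _/ℕ_; NonZero)
  open import Data.Integer.DivMod using (a≡a%ℕn+[a/ℕn]*n; n%ℕd<d)
  import Data.Integer.Properties as ℤₚ
  open import Data.Integer.Divisibility.Signed
  open import Data.Integer.Tactic.RingSolver using (solve-∀)
  open import Data.Product using (_×_; _,_; proj₁; proj₂)
  open import Data.Sum using (_⊎_; inj₁; inj₂)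
  open import Data.Empty using (⊥-elim)
  open import Function using (_∘_)
  open import Relation.Nullary using (¬_; Dec; yes; no)
  open import Relation.Binary.Definitions using (tri<; tri≈; tri>)
  open import Relation.Binary.PropositionalEquality

  %-cg : ∀ n d .{{_ : ℕ.NonZero d}} → Cg (+ d) (+ (n %ℕ d)) n
  %-cg n d = cg (divides (- (n /ℕ d))
    (trans (cong (λ z → + (n %ℕ d) + - z) (a≡a%ℕn+[a/ℕn]*n n d)) (eq (+ (n %ℕ d)) (n /ℕ d) (+ d))))
    where eq : ∀ r q d → r + - (r + q * d) ≡ - q * d
          eq = solve-∀

  module Digit (b : ℕ) (1<b : 1 ℕ.< b) where

    B : ℤ
    B = + b

    instance
      nz-b : ℕ.NonZero b
      nz-b = ℕ.>-nonZero (ℕₚ.<-trans (s≤s z≤n) 1<b)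
      nz-B : NonZero B
      nz-B = nz-b

    nz-^ : ∀ a → NonZero (B ^ a)
    nz-^ zero    = _
    nz-^ (suc a) = ℤₚ.i*j≢0 B (B ^ a) {{nz-B}} {{nz-^ a}}

    -- `coprim` is mere non-divisibility. For composite `b` such `u` are not closed under products,
    -- which is why every statement about products carries a cancellation hypothesis for one factor.
    record V (w : ℤ) (a : ℕ) (u : ℤ) : Set where
      constructor mkV
      field
        split  : w ≡ B ^ a * u
        coprim : ¬ (B ∣ u)
    open V

    -- The first argument is fuel; the absolute value of `w` suffices, since each division by
    -- `b > 1` decreases it. For `w = 0` the result is `(0 , 0)`, so the digit 0 is reserved for 0.
    strip : ℕ → ℤ → ℕ × ℤ
    strip zero    w = 0 , w
    strip (suc n) w with B ∣? w
    ... | no _  = 0 , w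
    ... | yes d = suc (proj₁ (strip n (_∣_.quotient d))) , proj₂ (strip n (_∣_.quotient d))

    strip-V : ∀ n w → w ≢ 0ℤ → ∣ w ∣ ℕ.≤ n → V w (proj₁ (strip n w)) (proj₂ (strip n w))
    strip-V zero w w≢0 le = ⊥-elim (w≢0 (ℤₚ.∣i∣≡0⇒i≡0 (ℕₚ.n≤0⇒n≡0 le)))
    strip-V (suc n) w w≢0 le with B ∣? w
    ... | no ¬d = mkV (sym (ℤₚ.*-identityˡ w)) ¬d
    ... | yes (divides q e) = mkV (trans e (trans (cong (_* B) (split ih)) (eq _ B _))) (coprim ih)
      where
      eq : ∀ p b u → p * u * b ≡ b * p * u
      eq = solve-∀
      q≢0 : q ≢ 0ℤ
      q≢0 refl = w≢0 e
      instance
        nzq : ℕ.NonZero ∣ q ∣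
        nzq = ℕ.≢-nonZero (q≢0 ∘ ℤₚ.∣i∣≡0⇒i≡0)
      lt : ∣ q ∣ ℕ.< ∣ w ∣
      lt = subst (∣ q ∣ ℕ.<_) (trans (sym (ℤₚ.abs-* q B)) (sym (cong ∣_∣ e))) (ℕₚ.m<m*n ∣ q ∣ b {{nzq}} 1<b)
      ih = strip-V n q q≢0 (ℕₚ.≤-pred (ℕₚ.≤-trans lt le))

    val : ℤ → ℕ
    val w = proj₁ (strip ∣ w ∣ w)

    unit : ℤ → ℤ
    unit w = proj₂ (strip ∣ w ∣ w)

    dig : ℤ → ℕ
    dig w = unit w %ℕ b

    dig<b : ∀ w → dig w ℕ.< b
    dig<b w = n%ℕd<d (unit w) b

    V-unit : ∀ {w} → w ≢ 0ℤ → V w (val w) (unit w)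
    V-unit {w} w≢0 = strip-V ∣ w ∣ w w≢0 ℕₚ.≤-refl

    V-≢0 : ∀ {w a u} → V w a u → w ≢ 0ℤ
    V-≢0 {a = a} {u} (mkV e ¬d) refl
      with ℤₚ.i*j≡0⇒i≡0∨j≡0 (B ^ a) (sym e)
    ... | inj₁ p = ℕ.≢-nonZero⁻¹ ∣ B ^ a ∣ {{nz-^ a}} (cong ∣_∣ p)
    ... | inj₂ refl = ¬d (divides 0ℤ refl)

    V-lt : ∀ {w a u a′ u′} → V w a u → V w a′ u′ → ¬ (a ℕ.< a′)
    V-lt {w} {a} {u} {a′} {u′} (mkV e ¬d) (mkV e′ _) lt = ¬d (divides (B ^ d * u′) (ℤₚ.*-cancelˡ-≡ (B ^ a) _ _ {{nz-^ a}}
          (trans (sym e) (trans e′ (trans (cong (λ z → B ^ z * u′) (sym sp))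
            (trans (cong (_* u′) (ℤₚ.^-distribˡ-+-* B a (suc d))) (eq (B ^ a) B (B ^ d) u′)))))))
      where d = a′ ℕ.∸ suc a
            sp : a ℕ.+ suc d ≡ a′
            sp = trans (ℕₚ.+-suc a _) (ℕₚ.m+[n∸m]≡n lt)
            eq : ∀ p b q u → p * (b * q) * u ≡ p * (q * u * b)
            eq = solve-∀

    V-val : ∀ {w a u} → V w a u → val w ≡ a
    V-val {w} {a} v with ℕₚ.<-cmp (val w) a
    ... | tri< lt _ _ = ⊥-elim (V-lt (V-unit (V-≢0 v)) v lt)
    ... | tri≈ _ eq _ = eq
    ... | tri> _ _ gt = ⊥-elim (V-lt v (V-unit (V-≢0 v)) gt)

    V-dig : ∀ {w a u} → V w a u → Cg B (+ dig w) u
    V-dig {w} {a} {u} v = subst (Cg B (+ dig w)) unit≡u (%-cg (unit w) b)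
      where
      unit≡u : unit w ≡ u
      unit≡u = ℤₚ.*-cancelˡ-≡ (B ^ a) _ _ {{nz-^ a}}
        (trans (sym (subst (λ z → w ≡ B ^ z * unit w) (V-val v) (split (V-unit (V-≢0 v))))) (split v))

    dig-0 : dig 0ℤ ≡ 0
    dig-0 = m<n⇒m%n≡m (ℕₚ.<-trans (s≤s z≤n) 1<b)

    dig-∤ : ∀ {w} → w ≢ 0ℤ → ¬ (B ∣ + dig w)
    dig-∤ {w} w≢0 d = coprim (V-unit w≢0) (cg-∣ (cg-sym (%-cg (unit w) b)) d)

    V-sum-< : ∀ {p q a u a′ v} → V p a u → V q a′ v → a ℕ.< a′ → V (p + q) a (u + B * (B ^ (a′ ℕ.∸ suc a) * v))
    V-sum-< {p} {q} {a} {u} {a′} {v} (mkV e ¬d) (mkV e′ _) lt =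
      mkV (trans (cong₂ _+_ e (trans e′ (trans (cong (λ z → B ^ z * v) (sym sp)) (cong (_* v) (ℤₚ.^-distribˡ-+-* B a _)))))
            (eq (B ^ a) u B (B ^ (a′ ℕ.∸ suc a)) v))
      (λ d → ¬d (∣m+n∣n⇒∣m {m = u} d (∣m⇒∣m*n _ ∣-refl)))
      where
      sp : a ℕ.+ suc (a′ ℕ.∸ suc a) ≡ a′
      sp = trans (ℕₚ.+-suc a _) (ℕₚ.m+[n∸m]≡n lt)
      eq : ∀ p u b q v → p * u + p * (b * q) * v ≡ p * (u + b * (q * v))
      eq = solve-∀

    V-sum-≈ : ∀ {p q a u v} → V p a u → V q a v → ¬ (B ∣ u + v) → V (p + q) a (u + v)
    V-sum-≈ {a = a} {u} {v} (mkV e _) (mkV e′ _) ¬d = mkV (trans (cong₂ _+_ e e′) (sym (ℤₚ.*-distribˡ-+ (B ^ a) u v))) ¬d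

    dig-sum-< : ∀ {p q} → p ≢ 0ℤ → q ≢ 0ℤ → val p ℕ.< val q → Cg B (+ dig (p + q)) (+ dig p)
    dig-sum-< {p} {q} p≢0 q≢0 lt =
      cg-trans (V-dig (V-sum-< vp (V-unit q≢0) lt))
               (cg-trans (cg (recast (∣m⇒∣m*n _ (∣-refl {B})) (eq (unit p) _))) (cg-sym (V-dig vp)))
      where
      vp = V-unit p≢0
      eq : ∀ u x → x ≡ u + x + - u
      eq = solve-∀

    dig-sum-> : ∀ {p q} → p ≢ 0ℤ → q ≢ 0ℤ → val q ℕ.< val p → Cg B (+ dig (p + q)) (+ dig q)
    dig-sum-> {p} {q} p≢0 q≢0 lt = subst (λ z → Cg B (+ dig z) (+ dig q)) (ℤₚ.+-comm q p) (dig-sum-< q≢0 p≢0 lt)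

    dig-sum-≈ : ∀ {p q} → p ≢ 0ℤ → q ≢ 0ℤ → val p ≡ val q → ¬ (B ∣ + dig p + + dig q) →
                Cg B (+ dig (p + q)) (+ dig p + + dig q)
    dig-sum-≈ {p} {q} p≢0 q≢0 e ¬d =
      cg-trans (V-dig (V-sum-≈ vp vq λ d → ¬d (cg-∣ (cg-+ (V-dig vp) (V-dig vq)) d))) (cg-sym (cg-+ (V-dig vp) (V-dig vq)))
      where
      vp = V-unit p≢0
      vq : V q (val p) (unit q)
      vq = subst (λ z → V q z (unit q)) (sym e) (V-unit q≢0)

    V-* : ∀ {c e δ w a u} → V c e δ → (∀ {x} → B ∣ δ * x → B ∣ x) → V w a u → V (c * w) (e ℕ.+ a) (δ * u)
    V-* {c} {e} {δ} {w} {a} {u} (mkV h _) can (mkV h′ ¬d) =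
      mkV (trans (cong₂ _*_ h h′) (trans (eq (B ^ e) δ (B ^ a) u) (cong (_* (δ * u)) (sym (ℤₚ.^-distribˡ-+-* B e a)))))
      (¬d ∘ can)
      where eq : ∀ p d q u → p * d * (q * u) ≡ p * q * (d * u)
            eq = solve-∀

    dig-* : ∀ {c e δ} w → V c e δ → (∀ {x} → B ∣ δ * x → B ∣ x) → Cg B (+ dig (c * w)) (δ * + dig w)
    dig-* {c} {e} {δ} w vc can with w ≟ 0ℤ
    ... | yes refl = cg-reflexive (trans (cong (λ z → + dig z) (ℤₚ.*-zeroʳ c))
                      (trans (cong +_ dig-0) (sym (trans (cong (λ z → δ * + z) dig-0) (ℤₚ.*-zeroʳ δ)))))
    ... | no w≢0 = cg-trans (V-dig (V-* vc can (V-unit w≢0))) (cg-*ˡ δ (cg-sym (V-dig (V-unit w≢0))))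

    val-* : ∀ {c e δ w} → V c e δ → (∀ {x} → B ∣ δ * x → B ∣ x) → w ≢ 0ℤ → val (c * w) ≡ e ℕ.+ val w
    val-* vc can w≢0 = V-val (V-* vc can (V-unit w≢0))

    private
      0+ : ∀ {p q} → p ≡ 0ℤ → Cg B (+ dig (p + q)) (+ dig q)
      0+ {q = q} refl = cg-reflexive (cong (λ z → + dig z) (ℤₚ.+-identityˡ q))
      +0 : ∀ {p q} → q ≡ 0ℤ → Cg B (+ dig (p + q)) (+ dig p)
      +0 {p = p} refl = cg-reflexive (cong (λ z → + dig z) (ℤₚ.+-identityʳ p))

    -- The summand of lower valuation decides the digit; at equal valuations the digits add, unless
    -- they cancel, which the hypothesis excludes. This is the truth behind the rule `Tri`.
    digit-of-sum : ∀ p q → ¬ (B ∣ + dig p + + dig q) →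
      Cg B (+ dig (p + q)) (+ dig p) ⊎ Cg B (+ dig (p + q)) (+ dig q) ⊎ Cg B (+ dig (p + q)) (+ dig p + + dig q)
    digit-of-sum p q ¬d with p ≟ 0ℤ | q ≟ 0ℤ
    ... | yes p0 | _      = inj₂ (inj₁ (0+ {q = q} p0))
    ... | no  p0 | yes q0 = inj₁ (+0 {p = p} q0)
    ... | no  p0 | no  q0 with ℕₚ.<-cmp (val p) (val q)
    ...   | tri< lt _ _ = inj₁ (dig-sum-< p0 q0 lt)
    ...   | tri≈ _ e _  = inj₂ (inj₂ (dig-sum-≈ p0 q0 e ¬d))
    ...   | tri> _ _ gt = inj₂ (inj₁ (dig-sum-> p0 q0 gt))

    private
      double : ∀ {d e} → Cg B d e → Cg B d (+ 2 * e) → B ∣ e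
      double {d} {e} (cg h) (cg h′) = recast (∣m∣n⇒∣m-n h h′) (eq d e)
        where eq : ∀ d e → d + - e + - (d + - (+ 2 * e)) ≡ e
              eq = solve-∀

    -- At unequal valuations `p + q` takes its digit from one summand, and both digits are congruent
    -- to that of `q`; being also twice that digit would make it divisible by `b`.
    near-val : ∀ {p q} → q ≢ 0ℤ → Cg B (+ dig p) (+ dig q) → Cg B (+ dig (p + q)) (+ 2 * + dig q) →
               p ≢ 0ℤ × val p ≡ val q
    near-val {p} {q} q0 e₁ e₂ with p ≟ 0ℤ
    ... | yes p0 = ⊥-elim (dig-∤ q0 (double (0+ p0) e₂))
    ... | no p0 with ℕₚ.<-cmp (val p) (val q)
    ...   | tri< lt _ _ = ⊥-elim (dig-∤ q0 (double (cg-trans (dig-sum-< p0 q0 lt) e₁) e₂))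
    ...   | tri≈ _ e _  = p0 , e
    ...   | tri> _ _ gt = ⊥-elim (dig-∤ q0 (double (dig-sum-> p0 q0 gt) e₂))

    module _ (can₂ : ∀ {x} → B ∣ + 2 * x → B ∣ x) where

      private
        ¬b∣1 : ¬ (B ∣ 1ℤ)
        ¬b∣1 d with small-∤ {b} {0} {1} (s≤s z≤n) 1<b
        ... | k = k (cg d)
        ¬b∣2 : ¬ (B ∣ + 2)
        ¬b∣2 = ¬b∣1 ∘ can₂

      V-2 : V (+ 2) 0 (+ 2)
      V-2 = mkV refl ¬b∣2

      V-b : V B 1 1ℤ
      V-b = mkV (eq B) ¬b∣1
        where eq : ∀ b → b ≡ b * 1ℤ * 1ℤ
              eq = solve-∀

      -- If `y` had the lower valuation, both sums would have the digit of `y`, so `dig x` would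
      -- equal its double. At equal valuations the first sum gives `dig y = 0`, or there is a carry,
      -- `dig y = - dig x`, and then `y + 2 x` has digit `dig x` instead of its double.
      deeper : ∀ {x y} → x ≢ 0ℤ → y ≢ 0ℤ → Cg B (+ dig (y + x)) (+ dig x) →
               Cg B (+ dig (y + + 2 * x)) (+ 2 * + dig x) → val x ℕ.< val y
      deeper {x} {y} x0 y0 e₁ e₂ with ℕₚ.<-cmp (val x) (val y)
      ... | tri< lt _ _ = lt
      ... | tri> _ _ gt = ⊥-elim (dig-∤ x0 (double (cg-trans (cg-trans (dig-sum-< y0 2x0 gt′) (cg-sym (dig-sum-< y0 x0 gt))) e₁) e₂))
        where
        2x0 : + 2 * x ≢ 0ℤ
        2x0 = V-≢0 (V-* V-2 can₂ (V-unit x0))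
        gt′ : val y ℕ.< val (+ 2 * x)
        gt′ = subst (val y ℕ.<_) (sym (val-* V-2 can₂ x0)) gt
      ... | tri≈ _ e _ with B ∣? (+ dig y + + dig x)
      ...   | no ¬d = ⊥-elim (dig-∤ y0 (recast (Cg.dvd (cg-trans (cg-sym (dig-sum-≈ y0 x0 (sym e) ¬d)) e₁)) (eq (+ dig y) (+ dig x))))
        where eq : ∀ y x → y + x + - x ≡ y
              eq = solve-∀
      ...   | yes d = ⊥-elim (dig-∤ x0 (double (cg-trans sum′ (cg (recast d (eq′ (+ dig y) (+ dig x))))) e₂))
        where
        2x0 : + 2 * x ≢ 0ℤ
        2x0 = V-≢0 (V-* V-2 can₂ (V-unit x0))
        c2 : Cg B (+ dig (+ 2 * x)) (+ 2 * + dig x)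
        c2 = dig-* x V-2 can₂
        eq′ : ∀ y x → y + x ≡ y + + 2 * x + - x
        eq′ = solve-∀
        eq : ∀ y x → y + + 2 * x + - (y + x) ≡ x
        eq = solve-∀
        sum′ : Cg B (+ dig (y + + 2 * x)) (+ dig y + + 2 * + dig x)
        sum′ = cg-trans (dig-sum-≈ y0 2x0 (trans (sym e) (sym (val-* V-2 can₂ x0)))
                 (λ h → dig-∤ x0 (recast (∣m∣n⇒∣m-n (cg-∣ (cg-+ (cg-refl {u = + dig y}) (cg-sym c2)) h) d) (eq (+ dig y) (+ dig x)))))
                 (cg-+ (cg-refl {u = + dig y}) c2)

      private
        1-cancel : ∀ {z} → B ∣ 1ℤ * z → B ∣ z
        1-cancel {z} d = recast d (ℤₚ.*-identityˡ z)

        dig-B* : ∀ x → Cg B (+ dig (B * x)) (+ dig x)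
        dig-B* x = cg-trans (dig-* x V-b 1-cancel) (cg-reflexive (ℤₚ.*-identityˡ _))

      -- By `deeper`, `val y` is at least `val x + 1 = val (B * x)`. If it is larger, `B * x`
      -- decides the digit; if equal, the digits cancel or add. The cases `x = 0` and `y = 0` fit
      -- the third and first alternative because 0 has digit 0.
      scale-rule : ∀ x y → Cg B (+ dig (y + x)) (+ dig x) → Cg B (+ dig (y + + 2 * x)) (+ 2 * + dig x) →
        Cg B (+ dig (y + B * x)) (+ dig x) ⊎ Cg B (+ dig y) (- (+ dig x)) ⊎ Cg B (+ dig (y + B * x)) (+ dig y + + dig x)
      scale-rule x y e₁ e₂ with x ≟ 0ℤ | y ≟ 0ℤ
      ... | yes refl | _ = inj₂ (inj₂ (cg-trans (+0 {p = y} (ℤₚ.*-zeroʳ B)) (cg-reflexive (sym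
                              (trans (cong (λ z → + dig y + + z) dig-0) (ℤₚ.+-identityʳ _))))))
      ... | no x0 | yes refl = inj₁ (cg-trans (0+ {q = B * x} refl) (dig-B* x))
      ... | no x0 | no y0 = compare (ℕₚ.m≤n⇒m<n∨m≡n (deeper x0 y0 e₁ e₂)) (B ∣? (+ dig y + + dig x))
        where
        bx0 : B * x ≢ 0ℤ
        bx0 = V-≢0 (V-* V-b 1-cancel (V-unit x0))
        vb : val (B * x) ≡ suc (val x)
        vb = val-* V-b 1-cancel x0
        compare : suc (val x) ℕ.< val y ⊎ suc (val x) ≡ val y → Dec (B ∣ + dig y + + dig x) →
          Cg B (+ dig (y + B * x)) (+ dig x) ⊎ Cg B (+ dig y) (- (+ dig x)) ⊎ Cg B (+ dig (y + B * x)) (+ dig y + + dig x)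
        compare (inj₁ lt) _ = inj₁ (cg-trans (dig-sum-> y0 bx0 (subst (ℕ._< val y) (sym vb) lt)) (dig-B* x))
        compare (inj₂ e) (yes d) = inj₂ (inj₁ (cg (recast d (cong (λ z → + dig y + z) (sym (ℤₚ.neg-involutive (+ dig x)))))))
        compare (inj₂ e) (no ¬d) = inj₂ (inj₂ (cg-trans
          (dig-sum-≈ y0 bx0 (trans (sym e) (sym vb)) (λ h → ¬d (cg-∣ (cg-+ (cg-refl {u = + dig y}) (cg-sym (dig-B* x))) h)))
          (cg-+ (cg-refl {u = + dig y}) (dig-B* x))))

-- Translation between tilings and systems of equations for a vector-valued unknown on the plane.

module Tilings where

  open import Defs
  open Arithmetic using (Cg; cg; cg-refl; cg-sym; cg-trans; cg-+; cg-reflexive; small-∤; recast)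
  open Digits using (%-cg)
  open import Data.Nat using (ℕ; zero; suc; _+_; _*_; _∸_; _<_; _≤_; z≤n; s≤s; NonZero)
  import Data.Nat.Properties as ℕₚ
  open import Data.Nat.DivMod using (_%_; m%n<n; m<n⇒m%n≡m; %-distribˡ-+)
  open import Data.Nat.Tactic.RingSolver using (solve-∀)
  open import Data.Integer using (ℤ; +_) renaming (_+_ to _+ℤ_; -_ to -ℤ_; _-_ to _-ℤ_)
  import Data.Integer.Properties as ℤₚ
  open import Data.Integer.Divisibility.Signed using (∣-refl)
  open import Data.Integer.Tactic.RingSolver renaming (solve-∀ to solveℤ)
  open import Data.Bool using (Bool; T)
  open import Data.Bool.Properties using (T?)
  open import Data.Vec using (Vec; []; _∷_; replicate)
  open import Data.Vec.Properties using (∷-injective)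
  open import Data.List using (List; []; _∷_; _++_; map; filter; concatMap; cartesianProductWith; upTo; length)
  open import Data.List.Membership.Propositional using (_∈_; find; lose)
  open import Data.List.Membership.Propositional.Properties
  open import Data.List.Relation.Unary.Any using (here; there)
  open import Data.List.Relation.Unary.All as All using (All)
  open import Data.Product using (Σ; ∃; _×_; _,_; proj₁; proj₂)
  open import Data.Product.Properties using (,-injective)
  open import Data.Sum using (inj₁; inj₂)
  open import Data.Unit using (tt)
  open import Data.Empty using (⊥; ⊥-elim)
  open import Relation.Binary.Definitions using (tri<; tri≈; tri>)
  open import Relation.Binary.PropositionalEquality

  cg-mod : ∀ m n .{{_ : NonZero n}} → Cg (+ n) (+ (m % n)) (+ m)
  cg-mod m n = %-cg (+ m) n

  cg⇒≡ : ∀ {n x y} → x < n → y < n → Cg (+ n) (+ x) (+ y) → x ≡ y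
  cg⇒≡ {n} {x} {y} x<n y<n e with ℕₚ.<-cmp x y
  ... | tri< lt _ _ = ⊥-elim (small-∤ lt y<n (cg-sym e))
  ... | tri≈ _ eq _ = eq
  ... | tri> _ _ gt = ⊥-elim (small-∤ gt x<n e)

  cg⇒% : ∀ {n x y} .{{_ : NonZero n}} → Cg (+ n) (+ x) (+ y) → x % n ≡ y % n
  cg⇒% {n} {x} {y} e =
    cg⇒≡ (m%n<n x n) (m%n<n y n) (cg-trans (cg-mod x n) (cg-trans e (cg-sym (cg-mod y n))))

  %⇒cg : ∀ {n x y} .{{_ : NonZero n}} → x % n ≡ y % n → Cg (+ n) (+ x) (+ y)
  %⇒cg {n} {x} {y} e = cg-trans (cg-sym (cg-mod x n)) (cg-trans (cg-reflexive (cong +_ e)) (cg-mod y n))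

  cg-cancelˡ : ∀ {b u v} c → Cg b (c +ℤ u) (c +ℤ v) → Cg b u v
  cg-cancelˡ {b} {u} {v} c (cg d) = cg (recast d (eq c u v))
    where eq : ∀ c u v → c +ℤ u +ℤ -ℤ (c +ℤ v) ≡ u +ℤ -ℤ v
          eq = solveℤ

  +%-cancelˡ : ∀ {n} c {x y} .{{_ : NonZero n}} → x < n → y < n → (c + x) % n ≡ (c + y) % n → x ≡ y
  +%-cancelˡ c x<n y<n e = cg⇒≡ x<n y<n (cg-cancelˡ (+ c) (%⇒cg {x = c + _} {y = c + _} e))

  +ℤ-cancelʳ : ∀ c x y → x +ℤ c ≡ y +ℤ c → x ≡ y
  +ℤ-cancelʳ c x y e = trans (sym (eq x c)) (trans (cong (_-ℤ c) e) (eq y c))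
    where eq : ∀ x c → x +ℤ c +ℤ -ℤ c ≡ x
          eq = solveℤ

  allVec : ∀ {A : Set} → List A → ∀ n → List (Vec A n)
  allVec xs zero    = [] ∷ []
  allVec xs (suc n) = cartesianProductWith _∷_ xs (allVec xs n)

  dot : ∀ {q} → Vec ℕ q → Vec ℕ q → ℕ
  dot []       []       = 0
  dot (w ∷ ws) (x ∷ xs) = w * x + dot ws xs

  zeros : ∀ q → Vec ℕ q
  zeros q = replicate q 0

  dot-zeros : ∀ {q} (w : Vec ℕ q) → dot w (zeros q) ≡ 0
  dot-zeros []       = refl
  dot-zeros (w ∷ ws) = trans (cong (_+ dot ws (zeros _)) (ℕₚ.*-zeroʳ w)) (dot-zeros ws)

  data At {A : Set} : List A → ℕ → A → Set where
    here  : ∀ {x xs} → At (x ∷ xs) 0 x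
    there : ∀ {x y xs n} → At xs n y → At (x ∷ xs) (suc n) y

  At-functional : ∀ {A : Set} {xs : List A} {n x y} → At xs n x → At xs n y → x ≡ y
  At-functional here      here      = refl
  At-functional (there p) (there q) = At-functional p q

  At-< : ∀ {A : Set} {xs : List A} {n x} → At xs n x → n < length xs
  At-< here      = s≤s z≤n
  At-< (there p) = s≤s (At-< p)

  <-At : ∀ {A : Set} (xs : List A) {n} → n < length xs → ∃ λ x → At xs n x
  <-At (x ∷ xs) {zero}  _       = x , here
  <-At (x ∷ xs) {suc n} (s≤s h) with y , p ← <-At xs h = y , there p

  At-∈ : ∀ {A : Set} {xs : List A} {n x} → At xs n x → x ∈ xs
  At-∈ here      = here refl
  At-∈ (there p) = there (At-∈ p)

  ∈-At : ∀ {A : Set} {xs : List A} {x} → x ∈ xs → ∃ λ n → At xs n x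
  ∈-At (here refl) = 0 , here
  ∈-At (there p) with n , q ← ∈-At p = suc n , there q

  record Part : Set where
    constructor mkPart
    field
      shift : ℤ × ℤ
      flip  : ℕ
      sel   : ℕ → Bool
  open Part public

  record Eqn (q : ℕ) : Set where
    constructor mkEqn
    field
      weights : Vec ℕ q
      parts   : List Part
      target  : ℕ → ℕ → Bool
  open Eqn public

  -- The summand ℤ/(M+1) of the group numbers the equations, ℤ/2 carries a sign, and (ℤ/N)^q the unknown:
  -- the tile consists of the points (shift, m, flip, x) with sel (weights · x).
  module System (N′ q : ℕ) where

    N : ℕ
    N = suc N′

    rep : Vec ℕ q
    rep = replicate q N′

    vecs : List (Vec ℕ q)
    vecs = allVec (upTo N) q

    Can : ∀ {n} → Vec ℕ n → Set
    Can {n} = Canon (replicate n N′)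

    can⇒∈ : ∀ {n} (v : Vec ℕ n) → Can v → v ∈ allVec (upTo N) n
    can⇒∈ []       _       = here refl
    can⇒∈ (x ∷ xs) (l , c) = ∈-cartesianProductWith⁺ _∷_ (∈-upTo⁺ l) (can⇒∈ xs c)

    ∈⇒can : ∀ {n} (v : Vec ℕ n) → v ∈ allVec (upTo N) n → Can v
    ∈⇒can {zero}  []  _ = tt
    ∈⇒can {suc n} v   m with ∈-cartesianProductWith⁻ _∷_ (upTo N) (allVec (upTo N) n) m
    ... | x , xs , x∈ , xs∈ , refl = ∈-upTo⁻ x∈ , ∈⇒can xs xs∈

    _⊕_ : ∀ {n} → Vec ℕ n → Vec ℕ n → Vec ℕ n
    _⊕_ {n} = addG (replicate n N′)

    _⊖_ : ∀ {n} → Vec ℕ n → Vec ℕ n → Vec ℕ n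
    []       ⊖ []       = []
    (x ∷ xs) ⊖ (y ∷ ys) = ((x + (N ∸ y)) % N) ∷ (xs ⊖ ys)

    can-⊕ : ∀ {n} (x y : Vec ℕ n) → Can (x ⊕ y)
    can-⊕ []       []       = tt
    can-⊕ (x ∷ xs) (y ∷ ys) = m%n<n (x + y) N , can-⊕ xs ys

    can-⊖ : ∀ {n} (x y : Vec ℕ n) → Can (x ⊖ y)
    can-⊖ []       []       = tt
    can-⊖ (x ∷ xs) (y ∷ ys) = m%n<n (x + (N ∸ y)) N , can-⊖ xs ys

    can-zeros : ∀ n → Can (zeros n)
    can-zeros zero    = tt
    can-zeros (suc n) = s≤s z≤n , can-zeros n

    ⊕-zeros : ∀ {n} (x : Vec ℕ n) → Can x → x ⊕ zeros n ≡ x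
    ⊕-zeros []       _       = refl
    ⊕-zeros (x ∷ xs) (l , c) =
      cong₂ _∷_ (trans (cong (_% N) (ℕₚ.+-identityʳ x)) (m<n⇒m%n≡m l)) (⊕-zeros xs c)

    ⊕-⊖ : ∀ {n} (x y : Vec ℕ n) → Can x → Can y → y ⊕ (x ⊖ y) ≡ x
    ⊕-⊖ []       []       _ _ = refl
    ⊕-⊖ (x ∷ xs) (y ∷ ys) (l , c) (l′ , c′) =
      cong₂ _∷_ (cg⇒≡ (m%n<n (y + z % N) N) l head) (⊕-⊖ xs ys c c′)
      where
      z = x + (N ∸ y)
      head : Cg (+ N) (+ ((y + z % N) % N)) (+ x)
      head = cg-trans (cg-mod (y + z % N) N) (cg-trans (cg-+ (cg-refl {u = + y}) (cg-mod z N))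
        (cg-trans (cg-reflexive (cong +_ (trans (comm y x (N ∸ y)) (cong (_+ x) (ℕₚ.m+[n∸m]≡n (ℕₚ.<⇒≤ l′))))))
          (cg (recast (∣-refl {+ N}) (eq (+ N) (+ x))))))
        where
        comm : ∀ y x d → y + (x + d) ≡ y + d + x
        comm = solve-∀
        eq : ∀ n x → n ≡ n +ℤ x +ℤ -ℤ x
        eq = solveℤ

    ⊕-cancelˡ : ∀ {n} (a x y : Vec ℕ n) → Can x → Can y → a ⊕ x ≡ a ⊕ y → x ≡ y
    ⊕-cancelˡ []       []       []       _ _ _ = refl
    ⊕-cancelˡ (a ∷ as) (x ∷ xs) (y ∷ ys) (l , c) (l′ , c′) e =
      cong₂ _∷_ (+%-cancelˡ a l l′ (proj₁ (∷-injective e))) (⊕-cancelˡ as xs ys c c′ (proj₂ (∷-injective e)))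

    value : Vec ℕ q → Vec ℕ q → ℕ
    value w x = dot w x % N

    dot-⊕ : ∀ {n} (w x y : Vec ℕ n) → Cg (+ N) (+ dot w (x ⊕ y)) (+ (dot w x + dot w y))
    dot-⊕ []       []       []       = cg-refl
    dot-⊕ (w ∷ ws) (x ∷ xs) (y ∷ ys) =
      cg-trans (cg-+ {u = + (w * ((x + y) % N))} {v = + (w * (x + y))} head (dot-⊕ ws xs ys))
               (cg-reflexive (cong +_ (eq w x y (dot ws xs) (dot ws ys))))
      where
      eq : ∀ w x y a b → w * (x + y) + (a + b) ≡ w * x + a + (w * y + b)
      eq = solve-∀
      head : Cg (+ N) (+ (w * ((x + y) % N))) (+ (w * (x + y)))
      head = subst₂ (Cg (+ N)) (sym (ℤₚ.pos-* w _)) (sym (ℤₚ.pos-* w _)) (Arithmetic.cg-*ˡ (+ w) (cg-mod (x + y) N))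

    value-⊕ : ∀ w x y → value w (x ⊕ y) ≡ (value w x + value w y) % N
    value-⊕ w x y = trans (cg⇒% (dot-⊕ w x y)) (%-distribˡ-+ (dot w x) (dot w y) N)

    value-zeros : ∀ w → value w (zeros q) ≡ 0
    value-zeros w = cong (_% N) (dot-zeros w)

    point : ℕ → Part → Vec ℕ q → Point (suc (suc q))
    point m p x = proj₁ (shift p) , proj₂ (shift p) , m ∷ flip p ∷ x

    partF : ℕ → Eqn q → Part → List (Point (suc (suc q)))
    partF m e p = map (point m p) (filter (λ x → T? (sel p (value (weights e) x))) vecs)

    allF : ℕ → List (Eqn q) → List (Point (suc (suc q)))
    allF m []       = []
    allF m (e ∷ es) = concatMap (partF m e) (parts e) ++ allF (suc m) es

    eqnE : ℕ → Eqn q → ℕ → List (Vec ℕ (suc (suc q)))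
    eqnE m e t = map (λ x → m ∷ t ∷ x) (filter (λ x → T? (target e t (value (weights e) x))) vecs)

    allE : ℕ → List (Eqn q) → List (Vec ℕ (suc (suc q)))
    allE m []       = []
    allE m (e ∷ es) = concatMap (eqnE m e) (upTo 2) ++ allE (suc m) es

    record InF (m₀ : ℕ) (eqs : List (Eqn q)) (f : Point (suc (suc q))) : Set where
      constructor mkInF
      field
        {m}    : ℕ
        {e}    : Eqn q
        {p}    : Part
        {x}    : Vec ℕ q
        at     : At eqs m e
        p∈     : p ∈ parts e
        can    : Can x
        chosen : T (sel p (value (weights e) x))
        shape  : f ≡ point (m₀ + m) p x

    record InE (m₀ : ℕ) (eqs : List (Eqn q)) (g : Vec ℕ (suc (suc q))) : Set where
      constructor mkInE
      field
        {m}    : ℕ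
        {e}    : Eqn q
        {t}    : ℕ
        {x}    : Vec ℕ q
        at     : At eqs m e
        t<2    : t < 2
        can    : Can x
        chosen : T (target e t (value (weights e) x))
        shape  : g ≡ (m₀ + m) ∷ t ∷ x

    ∈F⁻ : ∀ m₀ eqs {f} → f ∈ allF m₀ eqs → InF m₀ eqs f
    ∈F⁻ m₀ (e ∷ es) f∈ with ∈-++⁻ (concatMap (partF m₀ e) (parts e)) f∈
    ... | inj₁ h with find (∈-concatMap⁻ (partF m₀ e) {xs = parts e} h)
    ...   | p , p∈ , h′ with ∈-map⁻ (point m₀ p) h′
    ...     | x , x∈ , refl with ∈-filter⁻ (λ x → T? (sel p (value (weights e) x))) x∈
    ...       | x∈′ , c = mkInF here p∈ (∈⇒can x x∈′) c (cong (λ z → point z p x) (sym (ℕₚ.+-identityʳ m₀)))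
    ∈F⁻ m₀ (e ∷ es) f∈ | inj₂ h with ∈F⁻ (suc m₀) es h
    ...   | mkInF {m} {p = p} {x} at p∈ can c refl = mkInF (there at) p∈ can c (cong (λ z → point z p x) (sym (ℕₚ.+-suc m₀ m)))

    ∈F⁺ : ∀ m₀ eqs {m e p x} → At eqs m e → p ∈ parts e → Can x → T (sel p (value (weights e) x)) →
          point (m₀ + m) p x ∈ allF m₀ eqs
    ∈F⁺ m₀ (e ∷ es) {p = p} {x} here p∈ c s rewrite ℕₚ.+-identityʳ m₀ =
      ∈-++⁺ˡ (∈-concatMap⁺ (partF m₀ e) (lose p∈ (∈-map⁺ (point m₀ p) (∈-filter⁺ _ (can⇒∈ x c) s))))
    ∈F⁺ m₀ (e ∷ es) {m = suc m} (there at) p∈ c s rewrite ℕₚ.+-suc m₀ m =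
      ∈-++⁺ʳ (concatMap (partF m₀ e) (parts e)) (∈F⁺ (suc m₀) es at p∈ c s)

    ∈E⁻ : ∀ m₀ eqs {g} → g ∈ allE m₀ eqs → InE m₀ eqs g
    ∈E⁻ m₀ (e ∷ es) f∈ with ∈-++⁻ (concatMap (eqnE m₀ e) (upTo 2)) f∈
    ... | inj₁ h with find (∈-concatMap⁻ (eqnE m₀ e) {xs = upTo 2} h)
    ...   | t , t∈ , h′ with ∈-map⁻ (λ x → m₀ ∷ t ∷ x) h′
    ...     | x , x∈ , refl with ∈-filter⁻ (λ x → T? (target e t (value (weights e) x))) x∈
    ...       | x∈′ , c = mkInE here (∈-upTo⁻ t∈) (∈⇒can x x∈′) c (cong (λ z → z ∷ t ∷ x) (sym (ℕₚ.+-identityʳ m₀)))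
    ∈E⁻ m₀ (e ∷ es) f∈ | inj₂ h with ∈E⁻ (suc m₀) es h
    ...   | mkInE {m} {t = t} {x} at p∈ can c refl = mkInE (there at) p∈ can c (cong (λ z → z ∷ t ∷ x) (sym (ℕₚ.+-suc m₀ m)))

    ∈E⁺ : ∀ m₀ eqs {m e t x} → At eqs m e → t < 2 → Can x → T (target e t (value (weights e) x)) →
          (m₀ + m) ∷ t ∷ x ∈ allE m₀ eqs
    ∈E⁺ m₀ (e ∷ es) {t = t} {x} here t<2 c s rewrite ℕₚ.+-identityʳ m₀ =
      ∈-++⁺ˡ (∈-concatMap⁺ (eqnE m₀ e) (lose (∈-upTo⁺ t<2) (∈-map⁺ (λ x → m₀ ∷ t ∷ x) (∈-filter⁺ _ (can⇒∈ x c) s))))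
    ∈E⁺ m₀ (e ∷ es) {m = suc m} (there at) t<2 c s rewrite ℕₚ.+-suc m₀ m =
      ∈-++⁺ʳ (concatMap (eqnE m₀ e) (upTo 2)) (∈E⁺ (suc m₀) es at t<2 c s)

    module Tile (eqs : List (Eqn q)) where

      M : ℕ
      M = length eqs

      ms : Vec ℕ (suc (suc q))
      ms = M ∷ 1 ∷ rep

      F : List (Point (suc (suc q)))
      F = allF 0 eqs

      E : List (Vec ℕ (suc (suc q)))
      E = allE 0 eqs

      E⊆ : All (Canon ms) E
      E⊆ = All.tabulate λ g∈ → inE (∈E⁻ 0 eqs g∈)
        where
        inE : ∀ {g} → InE 0 eqs g → Canon ms g
        inE (mkInE at t<2 can c refl) = ℕₚ.m≤n⇒m≤1+n (At-< at) , t<2 , can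

      F⊆ : (∀ {e} → e ∈ eqs → ∀ {p} → p ∈ parts e → flip p < 2) → All (InG ms) F
      F⊆ fl = All.tabulate λ f∈ → inF (∈F⁻ 0 eqs f∈)
        where
        inF : ∀ {f} → InF 0 eqs f → InG ms f
        inF (mkInF at p∈ can c refl) = ℕₚ.m≤n⇒m≤1+n (At-< at) , fl (At-∈ at) p∈ , can

      module FromTiling {A : Point (suc (suc q)) → Set} (tv : TilesVia ms F (Z²× E) A)
        (pivot : ∀ {e} → e ∈ eqs → ∃ λ p → p ∈ parts e × T (sel p 0))
        {e₀} (e₀∈ : e₀ ∈ eqs)
        (trivial : ∀ {p} → p ∈ parts e₀ → shift p ≡ (+ 0 , + 0) × flip p ≡ 0)
        (full : ∀ z → T (target e₀ 0 z)) where

        open TilesVia tv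

        sel-zeros : ∀ p w → T (sel p 0) → T (sel p (value w (zeros q)))
        sel-zeros p w = subst (λ z → T (sel p z)) (sym (value-zeros w))

        -- The summand ℤ/(M+1) has one residue more than there are equations, and `E` has no point
        -- above the residue M. A translate with address `c` different from 0 would move the tile
        -- points of equation `M - c` there, and `pivot` makes sure that such points exist.
        address : ∀ {x y c g} → A (x , y , c ∷ g) → c ≡ 0
        address {c = zero}  a = refl
        address {x} {y} {suc c} {t ∷ v} a = ⊥-elim contra
          where
          c≤M : suc c ≤ M
          c≤M = ℕₚ.≤-pred (proj₁ (A⊆G _ a))
          m = M ∸ suc c
          m<M : m < M
          m<M = ℕₚ.∸-monoʳ-< {M} {suc c} {0} (s≤s z≤n) c≤M
          contra : ⊥
          contra with e , at ← <-At eqs m<M | p , p∈ , s ← pivot (At-∈ (proj₂ (<-At eqs m<M)))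
            with ∈E⁻ 0 eqs (cover a (∈F⁺ 0 eqs at p∈ (can-zeros q) (sel-zeros p (weights e) s)))
          ... | mkInE at′ _ _ _ sh = ℕₚ.<-irrefl (sym (trans (sym full-address) (proj₁ (∷-injective sh)))) (At-< at′)
            where
            full-address : (suc c + m) % suc M ≡ M
            full-address = trans (cong (_% suc M) (ℕₚ.m+[n∸m]≡n c≤M)) (m<n⇒m%n≡m (ℕₚ.n<1+n M))

        record Cell (x y : ℤ) : Set where
          constructor cell
          field
            vec : Vec ℕ q
            can : Can vec
            mem : A (x , y , 0 ∷ 0 ∷ vec)

        -- The point over `(x , y)` with sign 0 in the row of `e₀` must be covered. As the parts of
        -- `e₀` neither shift nor flip, the translate covering it lies itself over `(x , y)` with
        -- sign 0.
        cells : ∀ x y → Cell x y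
        cells x y with m₀ , at₀ ← ∈-At e₀∈
          with onto (x , y , m₀ ∷ 0 ∷ zeros q) (∈E⁺ 0 eqs at₀ (s≤s z≤n) (can-zeros q) (full _))
        ... | (a₁ , a₂ , c ∷ t ∷ v) , f , a , f∈ , eq with address a
        ...   | refl with ∈F⁻ 0 eqs f∈
        ...     | mkInF {m} at p∈ _ _ refl with ,-injective eq
        ...       | e₁ , eq′ with ,-injective eq′
        ...         | e₂ , e₃ with trans (sym (m<n⇒m%n≡m (ℕₚ.m≤n⇒m≤1+n (At-< at)))) (proj₁ (∷-injective e₃))
        ...           | refl with At-functional at at₀
        ...             | refl with trivial p∈
        ...               | refl , refl = cell v (proj₂ (proj₂ (A⊆G _ a))) (subst A pos a)
          where
          t≡0 : t ≡ 0
          t≡0 = trans (sym (m<n⇒m%n≡m (proj₁ (proj₂ (A⊆G _ a)))))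
                      (trans (cong (_% 2) (sym (ℕₚ.+-identityʳ t))) (proj₁ (∷-injective (proj₂ (∷-injective e₃)))))
          pos : (a₁ , a₂ , 0 ∷ t ∷ v) ≡ (x , y , 0 ∷ 0 ∷ v)
          pos = cong₂ _,_ (trans (sym (ℤₚ.+-identityʳ a₁)) e₁)
                  (cong₂ _,_ (trans (sym (ℤₚ.+-identityʳ a₂)) e₂) (cong (λ z → 0 ∷ z ∷ v) t≡0))

        α : ℤ → ℤ → Vec ℕ q
        α x y = Cell.vec (cells x y)

        α-can : ∀ x y → Can (α x y)
        α-can x y = Cell.can (cells x y)

        -- Adding the tile point with zero vector leaves `α x y` unchanged, so the value of `α x y`
        -- itself lies in the target.
        in-target : ∀ {e p} → e ∈ eqs → p ∈ parts e → flip p ≡ 0 → T (sel p 0) → ∀ x y →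
                    T (target e 0 (value (weights e) (α x y)))
        in-target {e} {p} e∈ p∈ refl s x y with m , at ← ∈-At e∈
          with ∈E⁻ 0 eqs (cover (Cell.mem (cells x y)) (∈F⁺ 0 eqs at p∈ (can-zeros q) (sel-zeros p (weights e) s)))
        ... | mkInE at′ _ _ ch sh with ∷-injective sh
        ...   | e₁ , sh′ with trans (sym (m<n⇒m%n≡m (ℕₚ.m≤n⇒m≤1+n (At-< at)))) e₁ | ∷-injective sh′
        ...     | refl | refl , refl with At-functional at at′
        ...       | refl = subst (λ v → T (target e 0 (value (weights e) v))) (⊕-zeros _ (α-can x y)) ch

        -- The point obtained from the first cell with the zero vector is also obtained from the
        -- second cell with the difference of the two unknowns. If `p′` admits that difference,
        -- distinctness identifies the two tile points.
        no-overlap : ∀ {e p p′} → e ∈ eqs → p ∈ parts e → p′ ∈ parts e → flip p ≡ 0 → flip p′ ≡ 0 → T (sel p 0) →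
          ∀ {x y x′ y′} → x +ℤ proj₁ (shift p) ≡ x′ +ℤ proj₁ (shift p′) → y +ℤ proj₂ (shift p) ≡ y′ +ℤ proj₂ (shift p′) →
          T (sel p′ (value (weights e) (α x y ⊖ α x′ y′))) →
          shift p ≡ shift p′ × value (weights e) (α x y ⊖ α x′ y′) ≡ 0
        no-overlap {e} {p} {p′} e∈ p∈ p′∈ fl fl′ s {x} {y} {x′} {y′} ex ey s′ with m , at ← ∈-At e∈
          with distinct (Cell.mem (cells x y)) (Cell.mem (cells x′ y′))
                 (∈F⁺ 0 eqs at p∈ (can-zeros q) (sel-zeros p (weights e) s))
                 (∈F⁺ 0 eqs at p′∈ (can-⊖ (α x y) (α x′ y′)) s′)
                 (cong₂ _,_ ex (cong₂ _,_ ey (cong ((m % suc M) ∷_)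
                   (cong₂ _∷_ (cong (_% 2) (trans fl (sym fl′)))
                     (trans (⊕-zeros _ (α-can x y)) (sym (⊕-⊖ _ _ (α-can x y) (α-can x′ y′))))))))
        ... | _ , f≡ with ,-injective f≡
        ...   | e₁ , f≡′ with ,-injective f≡′
        ...     | e₂ , e₃ = cong₂ _,_ e₁ e₂ ,
          trans (cong (value (weights e)) (sym (proj₂ (∷-injective (proj₂ (∷-injective e₃)))))) (value-zeros (weights e))

        difference : ∀ w x y x′ y′ → (value w (α x′ y′) + value w (α x y ⊖ α x′ y′)) % N ≡ value w (α x y)
        difference w x y x′ y′ =
          trans (sym (value-⊕ w (α x′ y′) _)) (cong (value w) (⊕-⊖ _ _ (α-can x y) (α-can x′ y′)))

      module ToTiling (α : ℤ → ℤ → ℕ → Vec ℕ q) (α-can : ∀ x y t → Can (α x y t)) where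

        valueAt : Eqn q → ℤ → ℤ → ℕ → ℕ
        valueAt e x y t = value (weights e) (α x y t)

        -- Covering inside the target, disjointness and surjectivity, reduced to arithmetic of
        -- residues: a tile selects vectors only through their weighted value.
        Inside Apart Reached : Eqn q → Set
        Inside e = ∀ {p} x y t z → p ∈ parts e → t < 2 → z < N → T (sel p z) →
          T (target e ((t + flip p) % 2) ((valueAt e x y t + z) % N))
        Apart e = ∀ {p p′ x y t x′ y′ t′ z z′} → p ∈ parts e → p′ ∈ parts e → t < 2 → t′ < 2 → z < N → z′ < N →
          T (sel p z) → T (sel p′ z′) →
          x +ℤ proj₁ (shift p) ≡ x′ +ℤ proj₁ (shift p′) → y +ℤ proj₂ (shift p) ≡ y′ +ℤ proj₂ (shift p′) →
          (t + flip p) % 2 ≡ (t′ + flip p′) % 2 → (valueAt e x y t + z) % N ≡ (valueAt e x′ y′ t′ + z′) % N →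
          shift p ≡ shift p′ × flip p ≡ flip p′
        Reached e = ∀ x y t z → t < 2 → z < N → T (target e t z) → ∃ λ p → ∃ λ x′ → ∃ λ y′ → ∃ λ t′ →
          p ∈ parts e × t′ < 2 × x′ +ℤ proj₁ (shift p) ≡ x × y′ +ℤ proj₂ (shift p) ≡ y ×
          (t′ + flip p) % 2 ≡ t × (∀ d → d < N → (valueAt e x′ y′ t′ + d) % N ≡ z → T (sel p d))

        record Solves (e : Eqn q) : Set where
          field
            inside  : Inside e
            apart   : Apart e
            reached : Reached e

        module _ (sols : ∀ {e} → e ∈ eqs → Solves e) where

          data A : Point (suc (suc q)) → Set where
            mem : ∀ x y t → t < 2 → A (x , y , 0 ∷ t ∷ α x y t)

          tiling : TilesVia ms F (Z²× E) A
          tiling = record { A⊆G = sub ; distinct = λ a a′ f f′ → dis a a′ (∈F⁻ 0 eqs f) (∈F⁻ 0 eqs f′)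
                          ; cover = λ a f → cov a (∈F⁻ 0 eqs f) ; onto = λ x x∈ → ont x (∈E⁻ 0 eqs x∈) }
            where
            sub : ∀ a → A a → InG ms a
            sub _ (mem x y t t<2) = s≤s z≤n , t<2 , α-can x y t

            cov : ∀ {a f} → A a → InF 0 eqs f → Z²× E (addP ms a f)
            cov (mem x y t t<2) (mkInF {m} {e} {p} {u} at p∈ can ch refl)
              rewrite m<n⇒m%n≡m (ℕₚ.m≤n⇒m≤1+n (At-< at)) =
              ∈E⁺ 0 eqs at (m%n<n (t + flip p) 2) (can-⊕ (α x y t) u)
                (subst (λ z → T (target e ((t + flip p) % 2) z)) (sym (value-⊕ (weights e) (α x y t) u))
                  (Solves.inside (sols (At-∈ at)) x y t (value (weights e) u) p∈ t<2 (m%n<n (dot (weights e) u) N) ch))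

            dis : ∀ {a a′ f f′} → A a → A a′ → InF 0 eqs f → InF 0 eqs f′ → addP ms a f ≡ addP ms a′ f′ → (a ≡ a′) × (f ≡ f′)
            dis (mem x y t t<2) (mem x′ y′ t′ t′<2) (mkInF {m} {e} {p} {u} at p∈ can ch refl)
                (mkInF {m′} {p = p′} {x = u′} at′ p′∈ can′ ch′ refl) eq
              with ,-injective eq
            ... | e₁ , eq′ with ,-injective eq′
            ...   | e₂ , e₃ with ∷-injective e₃
            ...     | em , e₃′ with ∷-injective e₃′
            ...       | et , ev with trans (sym (m<n⇒m%n≡m (ℕₚ.m≤n⇒m≤1+n (At-< at))))
                                          (trans em (m<n⇒m%n≡m (ℕₚ.m≤n⇒m≤1+n (At-< at′))))
            ...         | refl with At-functional at at′
            ...           | refl with Solves.apart (sols (At-∈ at)) {p} {p′} {x} {y} {t} {x′} {y′} {t′} p∈ p′∈ t<2 t′<2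
                                        (m%n<n (dot (weights e) u) N) (m%n<n (dot (weights e) u′) N) ch ch′ e₁ e₂ et
                                        (trans (sym (value-⊕ (weights e) _ u))
                                               (trans (cong (value (weights e)) ev) (value-⊕ (weights e) _ u′)))
            ...             | es , ef with +ℤ-cancelʳ (proj₁ (shift p)) x x′ (trans e₁ (cong (λ s → x′ +ℤ proj₁ s) (sym es)))
                                         | +ℤ-cancelʳ (proj₂ (shift p)) y y′ (trans e₂ (cong (λ s → y′ +ℤ proj₂ s) (sym es)))
                                         | +%-cancelˡ (flip p) t<2 t′<2 (trans (cong (_% 2) (ℕₚ.+-comm (flip p) t))
                                             (trans et (cong (_% 2) (trans (ℕₚ.+-comm t′ (flip p′)) (cong (_+ t′) (sym ef))))))
            ...               | refl | refl | refl with ⊕-cancelˡ (α x y t) u u′ can can′ ev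
            ...                 | refl = refl , cong₂ _,_ (cong proj₁ es) (cong₂ _,_ (cong proj₂ es) (cong (λ z → m ∷ z ∷ u) ef))

            ont : ∀ x → InE 0 eqs (proj₂ (proj₂ x)) → Σ (Point (suc (suc q))) λ a → Σ (Point (suc (suc q))) λ f →
                  A a × f ∈ F × addP ms a f ≡ x
            ont (x , y , _) (mkInE {m} {e} {t} {u} at t<2 can ch refl)
              with Solves.reached (sols (At-∈ at)) x y t (value (weights e) u) t<2 (m%n<n (dot (weights e) u) N) ch
            ... | p , x′ , y′ , t′ , p∈ , t′<2 , ex , ey , et , s =
              _ , _ , mem x′ y′ t′ t′<2 ,
              ∈F⁺ 0 eqs at p∈ (can-⊖ u (α x′ y′ t′))
                (s _ (m%n<n (dot (weights e) (u ⊖ α x′ y′ t′)) N)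
                   (trans (sym (value-⊕ (weights e) (α x′ y′ t′) _)) (cong (value (weights e)) back))) ,
              cong₂ _,_ ex (cong₂ _,_ ey (cong₂ _∷_ (m<n⇒m%n≡m (ℕₚ.m≤n⇒m≤1+n (At-< at))) (cong₂ _∷_ et back)))
              where
              back : α x′ y′ t′ ⊕ (u ⊖ α x′ y′ t′) ≡ u
              back = ⊕-⊖ u (α x′ y′ t′) can (α-can x′ y′ t′)

-- Local rules on periodic projections of a symbol field, expressed as such equations.

module Sampling where

  open import Defs
  open Arithmetic using (Cg; cg; cg-refl; cg-sym; cg-trans; cg-+; cg-reflexive; recast; cg-neg)
  open Digits using (%-cg)
  open Tilings
  open import Data.Nat using (ℕ; zero; suc; _+_; _*_; _∸_; _<_; _≤_; z≤n; s≤s; _≡ᵇ_; _≟_)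
  import Data.Nat.Properties as ℕₚ
  open import Data.Nat.DivMod using (_%_; m%n<n; m<n⇒m%n≡m)
  open import Data.Nat.Tactic.RingSolver using (solve-∀)
  open import Data.Integer using (ℤ; +_) renaming (_+_ to _+ℤ_; -_ to -ℤ_; _-_ to _-ℤ_)
  open import Data.Integer.Base using (_%ℕ_)
  open import Data.Integer.DivMod using (n%ℕd<d)
  import Data.Integer.Properties as ℤₚ
  open import Data.Integer.Divisibility.Signed using (_∣_; divides; ∣-trans)
  open import Data.Integer.Tactic.RingSolver renaming (solve-∀ to solveℤ)
  open import Data.Bool using (Bool; true; false; T)
  open import Data.Fin using (Fin; zero; suc)
  open import Data.Vec using (Vec; []; _∷_; replicate; lookup)
  open import Data.Vec.Properties using (lookup-replicate)
  import Data.List as List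
  open import Data.List using (List; []; _∷_; _++_; map; upTo; length; allFin)
  open import Data.List.Membership.Propositional using (_∈_)
  open import Data.List.Membership.Propositional.Properties
  open import Data.List.Relation.Unary.Any as Any using (here; there)
  open import Data.List.Relation.Unary.Any.Properties using (lookup-index)
  open import Data.Product using (∃; _×_; _,_; proj₁; proj₂)
  open import Data.Sum using (_⊎_; inj₁; inj₂)
  open import Data.Unit using (tt)
  open import Data.Empty using (⊥; ⊥-elim)
  open import Function using (_∘_)
  open import Relation.Nullary using (¬_; yes; no)
  open import Relation.Binary.PropositionalEquality

  isZero nonZero atMost1 : ℕ → Bool
  isZero zero    = true
  isZero (suc _) = false
  nonZero zero    = false
  nonZero (suc _) = true
  atMost1 zero          = true
  atMost1 (suc zero)    = true
  atMost1 (suc (suc _)) = false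

  isZero⁻ : ∀ {z} → T (isZero z) → z ≡ 0
  isZero⁻ {zero} _ = refl

  unit compl : ∀ {q} → Fin q → Vec ℕ q
  unit {suc q} zero    = 1 ∷ zeros q
  unit {suc q} (suc i) = 0 ∷ unit i
  compl {suc q} zero    = 0 ∷ replicate q 1
  compl {suc q} (suc i) = 1 ∷ compl i

  ones : ∀ q → Vec ℕ q
  ones q = replicate q 1

  dot-unitʳ : ∀ {q} (w : Vec ℕ q) i → dot w (unit i) ≡ lookup w i
  dot-unitʳ (w ∷ ws) zero    = trans (cong₂ _+_ (ℕₚ.*-identityʳ w) (dot-zeros ws)) (ℕₚ.+-identityʳ w)
  dot-unitʳ (w ∷ ws) (suc i) = trans (cong (_+ dot ws (unit i)) (ℕₚ.*-zeroʳ w)) (dot-unitʳ ws i)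

  dot-comm : ∀ {q} (v w : Vec ℕ q) → dot v w ≡ dot w v
  dot-comm []       []       = refl
  dot-comm (v ∷ vs) (w ∷ ws) = cong₂ _+_ (ℕₚ.*-comm v w) (dot-comm vs ws)

  dot-unitˡ : ∀ {q} i (w : Vec ℕ q) → dot (unit i) w ≡ lookup w i
  dot-unitˡ i w = trans (dot-comm (unit i) w) (dot-unitʳ w i)

  dot-compl : ∀ {q} (w : Vec ℕ q) i → dot w (compl i) + lookup w i ≡ dot w (ones q)
  dot-compl (w ∷ ws) zero    = eq w (dot ws (ones _))
    where eq : ∀ w s → w * 0 + s + w ≡ w * 1 + s
          eq = solve-∀
  dot-compl (w ∷ ws) (suc i) =
    trans (ℕₚ.+-assoc (w * 1) (dot ws (compl i)) (lookup ws i)) (cong (_+_ (w * 1)) (dot-compl ws i))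

  dot-ones-ones : ∀ q → dot (ones q) (ones q) ≡ q
  dot-ones-ones zero    = refl
  dot-ones-ones (suc q) = cong suc (dot-ones-ones q)

  dot-ones-≤ : ∀ {q} (v : Vec ℕ q) → (∀ i → lookup v i ≤ 1) → dot (ones q) v ≤ q
  dot-ones-≤ []       h = z≤n
  dot-ones-≤ (x ∷ xs) h =
    ℕₚ.+-mono-≤ (subst (_≤ 1) (sym (ℕₚ.+-identityʳ x)) (h zero)) (dot-ones-≤ xs (h ∘ suc))

  all-zero : ∀ {q} (v : Vec ℕ q) → dot (ones q) v ≡ 0 → ∀ w → dot w v ≡ 0
  all-zero []           e []       = refl
  all-zero (zero ∷ xs)  e (w ∷ ws) = trans (cong (_+ dot ws xs) (ℕₚ.*-zeroʳ w)) (all-zero xs e ws)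

  one-hot : ∀ {q} (v : Vec ℕ q) → (∀ i → lookup v i ≤ 1) → dot (ones q) v ≡ 1 → ∃ λ i → ∀ w → dot w v ≡ lookup w i
  one-hot (zero ∷ xs) h e with i , p ← one-hot xs (h ∘ suc) e =
    suc i , λ { (w ∷ ws) → trans (cong (_+ dot ws xs) (ℕₚ.*-zeroʳ w)) (p ws) }
  one-hot (suc zero ∷ xs) h e = zero , λ { (w ∷ ws) →
    trans (cong₂ _+_ (ℕₚ.*-identityʳ w) (all-zero xs (ℕₚ.suc-injective e) ws)) (ℕₚ.+-identityʳ w) }
  one-hot (suc (suc x) ∷ xs) h e with s≤s () ← h zero

  lookup-unit-≤ : ∀ {q} (i j : Fin q) → lookup (unit i) j ≤ 1
  lookup-unit-≤ zero    zero    = s≤s z≤n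
  lookup-unit-≤ {suc q} zero (suc j) = subst (_≤ 1) (sym (lookup-replicate j 0)) z≤n
  lookup-unit-≤ (suc i) zero    = z≤n
  lookup-unit-≤ (suc i) (suc j) = lookup-unit-≤ i j

  lookup-unit-compl : ∀ {q} (i j : Fin q) → lookup (unit i) j + lookup (compl i) j ≡ 1
  lookup-unit-compl zero    zero    = refl
  lookup-unit-compl zero    (suc j) = cong₂ _+_ (lookup-replicate j 0) (lookup-replicate j 1)
  lookup-unit-compl (suc i) zero    = refl
  lookup-unit-compl (suc i) (suc j) = lookup-unit-compl i j

  -- A symbol ω(n) ∈ ωs is to be chosen at each n ∈ ℤ² such that the projections in pers are periodic,
  -- and any B horizontally consecutive values of clock are pairwise incongruent modulo B.
  module Problem {W : Set} (ωs : List W) (B′ : ℕ) (clock : W → ℕ) (bound : ℕ) where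

    -- `N = (K + 1) * B`: a multiple of `B`, so that values modulo `N` determine clocks modulo `B`,
    -- and larger than `q` and `bound`, so that neither sums of bits nor projections wrap around.
    B q K N′ : ℕ
    B = suc B′
    q = length ωs
    K = q + suc bound
    N′ = K + B′ * suc K

    open System N′ q

    q<N : q < N
    q<N = s≤s (ℕₚ.≤-trans (ℕₚ.m≤m+n q (suc bound)) (ℕₚ.m≤m+n K _))

    bound<N : bound < N
    bound<N = s≤s (ℕₚ.≤-trans (ℕₚ.≤-trans (ℕₚ.n≤1+n bound) (ℕₚ.m≤n+m (suc bound) q)) (ℕₚ.m≤m+n K _))

    1<N : 1 < N
    1<N = s≤s (ℕₚ.≤-trans (ℕₚ.≤-trans (s≤s z≤n) (ℕₚ.m≤n+m (suc bound) q)) (ℕₚ.m≤m+n K _))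

    B∣N : + B ∣ + N
    B∣N = divides (+ suc K) (trans (cong +_ (ℕₚ.*-comm B (suc K))) (ℤₚ.pos-* (suc K) B))

    N⇒B : ∀ {u v} → Cg (+ N) u v → Cg (+ B) u v
    N⇒B (cg d) = cg (∣-trans B∣N d)

    %-stable : ∀ c → (c % N + 0) % N ≡ c % N
    %-stable c = trans (cong (_% N) (ℕₚ.+-identityʳ (c % N))) (m<n⇒m%n≡m (m%n<n c N))

    wt : (W → ℕ) → ∀ (xs : List W) → Vec ℕ (length xs)
    wt c []       = []
    wt c (x ∷ xs) = c x ∷ wt c xs

    lookup-wt : ∀ c xs i → lookup (wt c xs) i ≡ c (List.lookup xs i)
    lookup-wt c (x ∷ xs) zero    = refl
    lookup-wt c (x ∷ xs) (suc i) = lookup-wt c xs i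

    anything : ℕ → ℕ → Bool
    anything _ _ = true

    origin : ℤ × ℤ
    origin = + 0 , + 0

    -- In the intended solution the unknown is the indicator of ω(n) on t = 0 and its complement on t = 1, so that
    -- boolEqn can state "0 or 1" as a partition of {0 , 1}; perEqn w v states that w · x has period v.
    perEqn : Vec ℕ q → ℤ × ℤ → Eqn q
    perEqn w v = mkEqn w (mkPart v 0 nonZero ∷ mkPart origin 0 isZero ∷ []) anything

    -- An indicator has one 1; its complement, carried by the other sign, has `q - 1`.
    sumTarget : ℕ → ℕ → Bool
    sumTarget zero    z = z ≡ᵇ 1
    sumTarget (suc _) z = suc z ≡ᵇ q

    rainbowPart : ℕ → Part
    rainbowPart j = mkPart (+ j , + 0) 0 (λ z → isZero (z % B))

    -- With zero weights the tile of `graphEqn` is a whole unshifted fibre, so it says that the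
    -- tiling set is the graph of a function. In `rainbowEqn`, the part shifted by `j` adds all
    -- multiples of `B`, so it says that `B` consecutive clocks represent each residue once.
    sumEqn graphEqn rainbowEqn : Eqn q
    sumEqn = mkEqn (ones q) (mkPart origin 0 isZero ∷ []) sumTarget
    graphEqn = perEqn (zeros q) origin
    rainbowEqn = mkEqn (wt clock ωs) (map rainbowPart (upTo B)) anything

    boolEqn : Fin q → Eqn q
    boolEqn i = mkEqn (unit i) (mkPart origin 0 isZero ∷ mkPart origin 1 isZero ∷ []) (λ _ → atMost1)

    perEqn′ : (W → ℕ) × (ℤ × ℤ) → Eqn q
    perEqn′ (c , v) = perEqn (wt c ωs) v

    fixedEqns : List (Eqn q)
    fixedEqns = graphEqn ∷ sumEqn ∷ rainbowEqn ∷ map boolEqn (allFin q)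

    module Periodic (pers : List ((W → ℕ) × (ℤ × ℤ)))
      (bounded : ∀ {c v} → (c , v) ∈ pers → ∀ {ω} → ω ∈ ωs → c ω ≤ bound)
      (clock-bounded : ∀ {ω} → ω ∈ ωs → clock ω ≤ bound) where

      eqs : List (Eqn q)
      eqs = map perEqn′ pers ++ fixedEqns

      open Tile eqs

      data Kind : Eqn q → Set where
        per     : ∀ {c v} → (c , v) ∈ pers → Kind (perEqn (wt c ωs) v)
        graph   : Kind graphEqn
        sum     : Kind sumEqn
        rainbow : Kind rainbowEqn
        bool    : ∀ i → Kind (boolEqn i)

      kind : ∀ {e} → e ∈ eqs → Kind e
      kind e∈ with ∈-++⁻ (map perEqn′ pers) e∈
      ... | inj₁ h with ∈-map⁻ perEqn′ h
      ...   | (c , v) , m , refl = per m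
      kind e∈ | inj₂ (here refl) = graph
      kind e∈ | inj₂ (there (here refl)) = sum
      kind e∈ | inj₂ (there (there (here refl))) = rainbow
      kind e∈ | inj₂ (there (there (there h))) with ∈-map⁻ boolEqn h
      ... | i , _ , refl = bool i

      fixed : ∀ {e} → e ∈ fixedEqns → e ∈ eqs
      fixed = ∈-++⁺ʳ (map perEqn′ pers)

      flips<2 : ∀ {e} → e ∈ eqs → ∀ {p} → p ∈ parts e → flip p < 2
      flips<2 e∈ with kind e∈
      ... | per _   = λ { (here refl) → s≤s z≤n ; (there (here refl)) → s≤s z≤n }
      ... | graph   = λ { (here refl) → s≤s z≤n ; (there (here refl)) → s≤s z≤n }
      ... | sum     = λ { (here refl) → s≤s z≤n }
      ... | bool i  = λ { (here refl) → s≤s z≤n ; (there (here refl)) → s≤s (s≤s z≤n) }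
      ... | rainbow = λ p∈ → help (∈-map⁻ rainbowPart p∈)
        where
        help : ∀ {p} → ∃ (λ j → j ∈ upTo B × p ≡ rainbowPart j) → flip p < 2
        help (j , _ , refl) = s≤s z≤n

      inst : Instance
      inst = record { k = suc (suc q) ; ms = ms ; E = E ; F = F ; E⊆G = E⊆ ; F⊆G = F⊆ flips<2 }

      record Solution : Set where
        field
          φ        : ℤ → ℤ → W
          φ∈       : ∀ x y → φ x y ∈ ωs
          periodic : ∀ {c v} → (c , v) ∈ pers → ∀ x y → c (φ x y) ≡ c (φ (x -ℤ proj₁ v) (y -ℤ proj₂ v))
          spread   : ∀ x y j j′ → j < B → j′ < B → Cg (+ B) (+ clock (φ (x -ℤ + j) y)) (+ clock (φ (x -ℤ + j′) y)) → j ≡ j′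

      private
        back : ∀ x j → x -ℤ j +ℤ j ≡ x
        back x j = eq x j
          where eq : ∀ x j → x +ℤ -ℤ j +ℤ j ≡ x
                eq = solveℤ

      tiling⇒solution : TilingProblem inst → Solution
      tiling⇒solution (A , tv) = record { φ = φ ; φ∈ = λ x y → ∈-lookup (ix x y) ; periodic = periodic ; spread = spread }
        where
        pivot : ∀ {e} → e ∈ eqs → ∃ λ p → p ∈ parts e × T (sel p 0)
        pivot e∈ with kind e∈
        ... | per _   = _ , there (here refl) , tt
        ... | graph   = _ , there (here refl) , tt
        ... | sum     = _ , here refl , tt
        ... | bool i  = _ , here refl , tt
        ... | rainbow = rainbowPart 0 , ∈-map⁺ rainbowPart (∈-upTo⁺ (s≤s z≤n)) , tt
        at-origin : ∀ {p} → p ∈ parts graphEqn → shift p ≡ origin × flip p ≡ 0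
        at-origin (here refl)         = refl , refl
        at-origin (there (here refl)) = refl , refl
        open FromTiling tv pivot (fixed (here refl)) at-origin (λ _ → tt)
        lookup-can : ∀ {n} (v : Vec ℕ n) → Can v → ∀ i → lookup v i < N
        lookup-can (x ∷ xs) (l , _) zero    = l
        lookup-can (x ∷ xs) (_ , c) (suc i) = lookup-can xs c i
        bit : ∀ x y i → lookup (α x y) i ≤ 1
        bit x y i = atMost1⁻ (subst (λ z → T (atMost1 z))
          (trans (cong (_% N) (dot-unitˡ i (α x y))) (m<n⇒m%n≡m (lookup-can _ (α-can x y) i)))
          (in-target (fixed (there (there (there (∈-map⁺ boolEqn (∈-allFin i)))))) (here refl) refl tt x y))
          where
          atMost1⁻ : ∀ {z} → T (atMost1 z) → z ≤ 1
          atMost1⁻ {zero}     _ = z≤n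
          atMost1⁻ {suc zero} _ = s≤s z≤n
        total : ∀ x y → dot (ones q) (α x y) ≡ 1
        total x y = trans (sym (m<n⇒m%n≡m (ℕₚ.≤-<-trans (dot-ones-≤ (α x y) (bit x y)) q<N)))
          (ℕₚ.≡ᵇ⇒≡ _ 1 (in-target (fixed (there (here refl))) (here refl) refl tt x y))
        ix : ℤ → ℤ → Fin q
        ix x y = proj₁ (one-hot (α x y) (bit x y) (total x y))
        φ : ℤ → ℤ → W
        φ x y = List.lookup ωs (ix x y)
        value-φ : ∀ c → (∀ {ω} → ω ∈ ωs → c ω ≤ bound) → ∀ x y → value (wt c ωs) (α x y) ≡ c (φ x y)
        value-φ c bd x y =
          trans (cong (_% N) (trans (proj₂ (one-hot (α x y) (bit x y) (total x y)) (wt c ωs)) (lookup-wt c ωs (ix x y))))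
                (m<n⇒m%n≡m (ℕₚ.≤-<-trans (bd (∈-lookup (ix x y))) bound<N))
        periodic : ∀ {c v} → (c , v) ∈ pers → ∀ x y → c (φ x y) ≡ c (φ (x -ℤ proj₁ v) (y -ℤ proj₂ v))
        periodic {c} {v} m x y = trans (sym (value-φ c (bounded m) x y)) (trans same (value-φ c (bounded m) x′ y′))
          where
          x′ = x -ℤ proj₁ v
          y′ = y -ℤ proj₂ v
          w = wt c ωs
          d = value w (α x y ⊖ α x′ y′)
          vanish : ∀ d′ → d ≡ d′ → d ≡ 0
          vanish zero    e = e
          vanish (suc k) e = proj₂ (no-overlap (∈-++⁺ˡ (∈-map⁺ perEqn′ m)) (there (here refl)) (here refl) refl refl tt
            (trans (ℤₚ.+-identityʳ x) (sym (back x (proj₁ v)))) (trans (ℤₚ.+-identityʳ y) (sym (back y (proj₂ v))))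
            (subst (T ∘ nonZero) (sym e) tt))
          same : value w (α x y) ≡ value w (α x′ y′)
          same = trans (sym (difference w x y x′ y′))
            (trans (cong (λ z → (value w (α x′ y′) + z) % N) (vanish d refl))
                   (%-stable (dot w (α x′ y′))))
        spread : ∀ x y j j′ → j < B → j′ < B → Cg (+ B) (+ clock (φ (x -ℤ + j) y)) (+ clock (φ (x -ℤ + j′) y)) → j ≡ j′
        spread x y j j′ j<B j′<B e = ℤₚ.+-injective (cong proj₁ (proj₁
          (no-overlap {p = rainbowPart j} {p′ = rainbowPart j′} (fixed (there (there (here refl))))
            (∈-map⁺ rainbowPart (∈-upTo⁺ j<B)) (∈-map⁺ rainbowPart (∈-upTo⁺ j′<B)) refl refl tt
            (trans (back x (+ j)) (sym (back x (+ j′)))) refl (subst (T ∘ isZero) (sym d%B) tt))))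
          where
          w = wt clock ωs
          d = value w (α (x -ℤ + j) y ⊖ α (x -ℤ + j′) y)
          c₁ = value w (α (x -ℤ + j) y)
          c₂ = value w (α (x -ℤ + j′) y)
          step : Cg (+ B) (+ c₂ +ℤ + d) (+ c₂ +ℤ + 0)
          step = cg-trans (N⇒B (cg-trans (cg-sym (cg-mod (c₂ + d) N)) (cg-reflexive (cong +_ (difference w (x -ℤ + j) y (x -ℤ + j′) y)))))
            (cg-trans (cg-reflexive (cong +_ (value-φ clock clock-bounded (x -ℤ + j) y)))
              (cg-trans e (cg-reflexive (trans (cong +_ (sym (value-φ clock clock-bounded (x -ℤ + j′) y))) (sym (ℤₚ.+-identityʳ (+ c₂)))))))
          d%B : d % B ≡ 0
          d%B = cg⇒% (cg-cancelˡ (+ c₂) step)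

      module _ (φ : ℤ → ℤ → W) (φ∈ : ∀ x y → φ x y ∈ ωs)
        (periodic : ∀ {c v} → (c , v) ∈ pers → ∀ x y → c (φ x y) ≡ c (φ (x -ℤ proj₁ v) (y -ℤ proj₂ v)))
        (clocked : ∀ x y → Cg (+ B) (+ clock (φ x y)) x) where

        private
          ix : ℤ → ℤ → Fin q
          ix x y = Any.index (φ∈ x y)

          α : ℤ → ℤ → ℕ → Vec ℕ q
          α x y zero    = unit (ix x y)
          α x y (suc _) = compl (ix x y)

          can-replicate : ∀ n {a} → a < N → Can (replicate n a)
          can-replicate zero    h = tt
          can-replicate (suc n) h = h , can-replicate n h

          can-unit : ∀ {n} (i : Fin n) → Can (unit i)
          can-unit zero    = 1<N , can-zeros _
          can-unit (suc i) = s≤s z≤n , can-unit i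

          can-compl : ∀ {n} (i : Fin n) → Can (compl i)
          can-compl zero    = s≤s z≤n , can-replicate _ 1<N
          can-compl (suc i) = 1<N , can-compl i

          α-can : ∀ x y t → Can (α x y t)
          α-can x y zero    = can-unit _
          α-can x y (suc _) = can-compl _

          open ToTiling α α-can

          mod2 : ∀ {t} → t < 2 → (t + 0) % 2 ≡ t
          mod2 {t} t<2 = trans (cong (_% 2) (ℕₚ.+-identityʳ t)) (m<n⇒m%n≡m t<2)

          mod2-inj : ∀ {t t′} → t < 2 → t′ < 2 → (t + 0) % 2 ≡ (t′ + 0) % 2 → t ≡ t′
          mod2-inj h h′ e = trans (sym (mod2 h)) (trans e (mod2 h′))

          +0-inj : ∀ {x x′ : ℤ} → x +ℤ + 0 ≡ x′ +ℤ + 0 → x ≡ x′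
          +0-inj {x} {x′} = +ℤ-cancelʳ (+ 0) x x′

          cancel : ∀ c {d} → d < N → (c % N + d) % N ≡ c % N → d ≡ 0
          cancel c {d} d<N e = +%-cancelˡ {N} (c % N) {d} {0} d<N (s≤s z≤n)
            (trans e (sym (%-stable c)))

          dot-α : ∀ c x y → dot (wt c ωs) (unit (ix x y)) ≡ c (φ x y)
          dot-α c x y = trans (dot-unitʳ (wt c ωs) (ix x y)) (trans (lookup-wt c ωs (ix x y)) (cong c (sym (lookup-index (φ∈ x y)))))

          dot-ᾱ : ∀ c x y → dot (wt c ωs) (compl (ix x y)) + c (φ x y) ≡ dot (wt c ωs) (ones q)
          dot-ᾱ c x y = trans (cong (_+_ (dot (wt c ωs) (compl (ix x y)))) (trans (sym (dot-α c x y)) (dot-unitʳ (wt c ωs) (ix x y))))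
                              (dot-compl (wt c ωs) (ix x y))

        -- A target value equal to that of the cell is reached from the cell itself, any other one
        -- from the cell displaced by `v`. As both cells have the same value, exactly one of the two
        -- applies.
        solve-per : ∀ w v → (∀ x y t → dot w (α x y t) ≡ dot w (α (x -ℤ proj₁ v) (y -ℤ proj₂ v) t)) → Solves (perEqn w v)
        solve-per w v H = record
          { inside = λ _ _ _ _ _ _ _ _ → tt ; apart = apart ; reached = reached }
          where
          clash : ∀ {x y t x′ y′ t′ z z′} → t < 2 → t′ < 2 → z < N → z′ < N → T (nonZero z) → T (isZero z′) →
            x +ℤ proj₁ v ≡ x′ +ℤ + 0 → y +ℤ proj₂ v ≡ y′ +ℤ + 0 → (t + 0) % 2 ≡ (t′ + 0) % 2 →
            (value w (α x y t) + z) % N ≡ (value w (α x′ y′ t′) + z′) % N → ⊥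
          clash {x} {y} {t} {x′} {y′} {t′} {z} {z′} ht ht′ hz hz′ s s′ ex ey et ev =
            contra (+%-cancelˡ (value w (α x y t)) hz hz′ (trans ev (cong (λ c → (c + z′) % N) (sym same))))
            where
            contra : z ≡ z′ → ⊥
            contra refl with refl ← isZero⁻ {z} s′ = s
            pos : ∀ a b c → a +ℤ b ≡ c +ℤ + 0 → c -ℤ b ≡ a
            pos a b c e = trans (cong (_-ℤ b) (trans (sym (ℤₚ.+-identityʳ c)) (sym e))) (eq a b)
              where eq : ∀ a b → a +ℤ b +ℤ -ℤ b ≡ a
                    eq = solveℤ
            same : value w (α x y t) ≡ value w (α x′ y′ t′)
            same = cong (_% N) (sym (trans (H x′ y′ t′)
              (cong (dot w) (trans (cong₂ (λ a b → α a b t′) (pos x (proj₁ v) x′ ex) (pos y (proj₂ v) y′ ey))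
                                   (cong (α x y) (sym (mod2-inj ht ht′ et)))))))
          apart : Apart (perEqn w v)
          apart (here refl) (here refl) ht ht′ hz hz′ s s′ ex ey et ev = refl , refl
          apart (there (here refl)) (there (here refl)) ht ht′ hz hz′ s s′ ex ey et ev = refl , refl
          apart {x = x} {y} {t} {x′} {y′} {t′} (here refl) (there (here refl)) ht ht′ hz hz′ s s′ ex ey et ev =
            ⊥-elim (clash {x} {y} {t} {x′} {y′} {t′} ht ht′ hz hz′ s s′ ex ey et ev)
          apart {x = x} {y} {t} {x′} {y′} {t′} (there (here refl)) (here refl) ht ht′ hz hz′ s s′ ex ey et ev =
            ⊥-elim (clash {x′} {y′} {t′} {x} {y} {t} ht′ ht hz′ hz s′ s (sym ex) (sym ey) (sym et) (sym ev))
          reached : Reached (perEqn w v)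
          reached x y t z ht hz _ with z ≟ value w (α x y t)
          ... | yes refl = _ , x , y , t , there (here refl) , ht , ℤₚ.+-identityʳ x , ℤₚ.+-identityʳ y , mod2 ht ,
            λ d d<N e → subst (T ∘ isZero) (sym (cancel (dot w (α x y t)) d<N e)) tt
          ... | no z≢ = _ , x -ℤ proj₁ v , y -ℤ proj₂ v , t , here refl , ht , back x _ , back y _ , mod2 ht ,
            λ { zero d<N e → ⊥-elim (z≢ (trans (sym e) (trans (%-stable (dot w (α (x -ℤ proj₁ v) (y -ℤ proj₂ v) t)))
                  (cong (_% N) (sym (H x y t))))))
              ; (suc d) d<N e → tt }

        solve-sum : Solves sumEqn
        solve-sum = record
          { inside = λ { x y t z (here refl) t<2 z<N s → inside x y t z t<2 s }
          ; apart = λ { (here refl) (here refl) _ _ _ _ _ _ _ _ _ _ → refl , refl }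
          ; reached = λ x y t z t<2 z<N s → _ , x , y , t , here refl , t<2 , ℤₚ.+-identityʳ x , ℤₚ.+-identityʳ y , mod2 t<2 ,
              λ d d<N e → subst (T ∘ isZero) (sym (cancel (dot (ones q) (α x y t)) d<N (trans e (hit x y t z t<2 s)))) tt }
          where
          one : ∀ x y → dot (ones q) (unit (ix x y)) ≡ 1
          one x y = trans (dot-unitʳ (ones q) (ix x y)) (lookup-replicate (ix x y) 1)
          rest : ∀ x y → suc (dot (ones q) (compl (ix x y))) ≡ q
          rest x y = trans (ℕₚ.+-comm 1 _) (trans (cong (_+_ (dot (ones q) (compl (ix x y)))) (sym (lookup-replicate (ix x y) 1)))
            (trans (dot-compl (ones q) (ix x y)) (dot-ones-ones q)))
          rest<N : ∀ x y → dot (ones q) (compl (ix x y)) < N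
          rest<N x y = ℕₚ.<-trans (subst (dot (ones q) (compl (ix x y)) <_) (rest x y) (ℕₚ.n<1+n _)) q<N
          val1 : ∀ x y → value (ones q) (unit (ix x y)) ≡ 1
          val1 x y = trans (cong (_% N) (one x y)) (m<n⇒m%n≡m 1<N)
          val2 : ∀ x y → suc (value (ones q) (compl (ix x y))) ≡ q
          val2 x y = trans (cong suc (m<n⇒m%n≡m (rest<N x y))) (rest x y)
          same : ∀ {v : Vec ℕ q} z → T (isZero z) → (value (ones q) v + z) % N ≡ value (ones q) v
          same {v} z s with refl ← isZero⁻ {z} s = %-stable (dot (ones q) v)
          inside : ∀ x y t z → t < 2 → T (isZero z) → T (sumTarget ((t + 0) % 2) ((value (ones q) (α x y t) + z) % N))
          inside x y zero z _ s = ℕₚ.≡⇒≡ᵇ _ 1 (trans (same {unit (ix x y)} z s) (val1 x y))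
          inside x y (suc zero) z _ s = ℕₚ.≡⇒≡ᵇ _ q (trans (cong suc (same {compl (ix x y)} z s)) (val2 x y))
          inside x y (suc (suc t)) z (s≤s (s≤s ())) s
          hit : ∀ x y t z → t < 2 → T (sumTarget t z) → z ≡ value (ones q) (α x y t)
          hit x y zero z _ s = trans (ℕₚ.≡ᵇ⇒≡ z 1 s) (sym (val1 x y))
          hit x y (suc t) z _ s = ℕₚ.suc-injective (trans (ℕₚ.≡ᵇ⇒≡ (suc z) q s) (sym (val2 x y)))

        -- The two signs over a point carry complementary bits, so each of 0 and 1 is carried by
        -- exactly one of them; the flip brings it to the requested sign.
        solve-bool : ∀ i → Solves (boolEqn i)
        solve-bool i = record
          { inside = λ { x y t z (here refl) t<2 z<N s → inside x y t z s ; x y t z (there (here refl)) t<2 z<N s → inside x y t z s }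
          ; apart = apart ; reached = reached }
          where
          v : ℤ → ℤ → ℕ → ℕ
          v x y t = value (unit i) (α x y t)
          ᾱ+ : ∀ x y → lookup (unit (ix x y)) i + lookup (compl (ix x y)) i ≡ 1
          ᾱ+ x y = lookup-unit-compl (ix x y) i
          small : ∀ x y t → lookup (α x y t) i ≤ 1
          small x y zero    = lookup-unit-≤ (ix x y) i
          small x y (suc t) = subst (lookup (compl (ix x y)) i ≤_) (ᾱ+ x y) (ℕₚ.m≤n+m _ _)
          val≡ : ∀ x y t → v x y t ≡ lookup (α x y t) i
          val≡ x y t = trans (cong (_% N) (dot-unitˡ i (α x y t))) (m<n⇒m%n≡m (ℕₚ.≤-<-trans (small x y t) 1<N))
          opp : ∀ x y → v x y 0 + v x y 1 ≡ 1
          opp x y = trans (cong₂ _+_ (val≡ x y 0) (val≡ x y 1)) (ᾱ+ x y)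
          same : ∀ x y t z → T (isZero z) → (v x y t + z) % N ≡ v x y t
          same x y t z s with refl ← isZero⁻ {z} s = %-stable (dot (unit i) (α x y t))
          le1 : ∀ {z} → z ≤ 1 → T (atMost1 z)
          le1 z≤n       = tt
          le1 (s≤s z≤n) = tt
          inside : ∀ x y t z → T (isZero z) → T (atMost1 ((v x y t + z) % N))
          inside x y t z s = le1 (subst (_≤ 1) (sym (trans (same x y t z s) (val≡ x y t))) (small x y t))
          odd : ∀ {a} → ¬ (a + a ≡ 1)
          odd {suc a} e with () ← ℕₚ.suc-injective (trans (sym (ℕₚ.+-suc (suc a) a)) e)
          differ : ∀ {x y t t′} → t < 2 → t′ < 2 → (t + 0) % 2 ≡ (t′ + 1) % 2 → ¬ (v x y t ≡ v x y t′)
          differ {x} {y} {zero} {suc zero} _ _ _ e = odd {v x y 0} (trans (cong (_+_ (v x y 0)) e) (opp x y))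
          differ {x} {y} {suc zero} {zero} _ _ _ e = odd {v x y 0} (trans (cong (_+_ (v x y 0)) (sym e)) (opp x y))
          differ {t = suc (suc _)} (s≤s (s≤s ()))
          differ {t′ = suc (suc _)} _ (s≤s (s≤s ()))
          clash : ∀ {x y t x′ y′ t′ z z′} → t < 2 → t′ < 2 → T (isZero z) → T (isZero z′) →
            x +ℤ + 0 ≡ x′ +ℤ + 0 → y +ℤ + 0 ≡ y′ +ℤ + 0 → (t + 0) % 2 ≡ (t′ + 1) % 2 →
            (v x y t + z) % N ≡ (v x′ y′ t′ + z′) % N → ⊥
          clash {x} {y} {t} {x′} {y′} {t′} {z} {z′} ht ht′ s s′ ex ey et ev with +0-inj {x} {x′} ex | +0-inj {y} {y′} ey
          ... | refl | refl = differ {x} {y} ht ht′ et (trans (sym (same x y t z s)) (trans ev (same x y t′ z′ s′)))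
          apart : Apart (boolEqn i)
          apart (here refl) (here refl) ht ht′ hz hz′ s s′ ex ey et ev = refl , refl
          apart (there (here refl)) (there (here refl)) ht ht′ hz hz′ s s′ ex ey et ev = refl , refl
          apart {x = x} {y} {t} {x′} {y′} {t′} {z} {z′} (here refl) (there (here refl)) ht ht′ hz hz′ s s′ ex ey et ev =
            ⊥-elim (clash {x} {y} {t} {x′} {y′} {t′} {z} {z′} ht ht′ s s′ ex ey et ev)
          apart {x = x} {y} {t} {x′} {y′} {t′} {z} {z′} (there (here refl)) (here refl) ht ht′ hz hz′ s s′ ex ey et ev =
            ⊥-elim (clash {x′} {y′} {t′} {x} {y} {t} {z′} {z} ht′ ht s′ s (sym ex) (sym ey) (sym et) (sym ev))
          stay : ∀ x y t z → v x y t ≡ z → ∀ d → d < N → (v x y t + d) % N ≡ z → T (isZero d)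
          stay x y t z e d d<N e′ = subst (T ∘ isZero) (sym (cancel (dot (unit i) (α x y t)) d<N (trans e′ (sym e)))) tt
          pick : ∀ x y z → T (atMost1 z) → (v x y 0 ≡ z × v x y 1 ≡ 1 ∸ z) ⊎ (v x y 1 ≡ z × v x y 0 ≡ 1 ∸ z)
          pick x y z s with v x y 0 | v x y 1 | opp x y
          pick x y zero s       | zero     | _ | refl = inj₁ (refl , refl)
          pick x y (suc zero) s | zero     | _ | refl = inj₂ (refl , refl)
          pick x y zero s       | suc zero | _ | refl = inj₂ (refl , refl)
          pick x y (suc zero) s | suc zero | _ | refl = inj₁ (refl , refl)
          reached : Reached (boolEqn i)
          reached x y zero z ht hz s with pick x y z s
          ... | inj₁ (e , _) = _ , x , y , 0 , here refl , s≤s z≤n , ℤₚ.+-identityʳ x , ℤₚ.+-identityʳ y , refl , stay x y 0 z e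
          ... | inj₂ (e , _) = _ , x , y , 1 , there (here refl) , s≤s (s≤s z≤n) , ℤₚ.+-identityʳ x , ℤₚ.+-identityʳ y , refl , stay x y 1 z e
          reached x y (suc zero) z ht hz s with pick x y z s
          ... | inj₂ (e , _) = _ , x , y , 1 , here refl , s≤s (s≤s z≤n) , ℤₚ.+-identityʳ x , ℤₚ.+-identityʳ y , refl , stay x y 1 z e
          ... | inj₁ (e , _) = _ , x , y , 0 , there (here refl) , s≤s z≤n , ℤₚ.+-identityʳ x , ℤₚ.+-identityʳ y , refl , stay x y 0 z e
          reached x y (suc (suc t)) z (s≤s (s≤s ())) hz s

        -- On either sign, the cells at distance `j < B` to the left run through all residues modulo
        -- `B`, so exactly one of them differs from a given value by a multiple of `B`.
        solve-rainbow : Solves rainbowEqn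
        solve-rainbow = record
          { inside = λ _ _ _ _ _ _ _ _ → tt
          ; apart = apart
          ; reached = reached }
          where
          w = wt clock ωs
          S = + dot w (ones q)
          v : ℤ → ℤ → ℕ → ℕ
          v x y t = value w (α x y t)
          -- The clock runs forwards on t = 0 and backwards on t = 1.
          v≈0 : ∀ x y → Cg (+ B) (+ v x y 0) x
          v≈0 x y = cg-trans (N⇒B (cg-mod (dot w (unit (ix x y))) N)) (cg-trans (cg-reflexive (cong +_ (dot-α clock x y))) (clocked x y))
          v≈1 : ∀ x y → Cg (+ B) (+ v x y 1) (S -ℤ x)
          v≈1 x y = cg-trans (N⇒B (cg-mod (dot w (compl (ix x y))) N))
            (cg-trans (cg-reflexive (trans (eq (+ dot w (compl (ix x y))) (+ clock (φ x y))) (cong (λ s → + s -ℤ + clock (φ x y)) (dot-ᾱ clock x y))))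
                      (cg-+ (cg-refl {u = S}) (cg-neg (clocked x y))))
            where eq : ∀ a c → a ≡ a +ℤ c +ℤ -ℤ c
                  eq = solveℤ
          v-inj : ∀ x y x′ y′ t → t < 2 → Cg (+ B) (+ v x y t) (+ v x′ y′ t) → Cg (+ B) x x′
          v-inj x y x′ y′ zero _ e = cg-trans (cg-sym (v≈0 x y)) (cg-trans e (v≈0 x′ y′))
          v-inj x y x′ y′ (suc zero) _ e =
            cg-sym (flip⁻ x′ x (cg-cancelˡ S (cg-trans (cg-sym (v≈1 x y)) (cg-trans e (v≈1 x′ y′)))))
            where flip⁻ : ∀ a b → Cg (+ B) (-ℤ b) (-ℤ a) → Cg (+ B) a b
                  flip⁻ a b (cg d) = cg (recast d (eq a b))
                    where eq : ∀ a b → -ℤ b +ℤ -ℤ (-ℤ a) ≡ a +ℤ -ℤ b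
                          eq = solveℤ
          v-inj x y x′ y′ (suc (suc t)) (s≤s (s≤s ())) e
          z≈0 : ∀ z → T (isZero (z % B)) → Cg (+ B) (+ z) (+ 0)
          z≈0 z s = cg-trans (cg-sym (cg-mod z B)) (cg-reflexive (cong +_ (isZero⁻ s)))
          drop : ∀ c z → T (isZero (z % B)) → Cg (+ B) (+ ((c + z) % N)) (+ c)
          drop c z s = cg-trans (N⇒B (cg-mod (c + z) N)) (cg-trans (cg-+ (cg-refl {u = + c}) (z≈0 z s)) (cg-reflexive (ℤₚ.+-identityʳ (+ c))))
          apart : Apart rainbowEqn
          apart {x = x} {y} {t} {x′} {y′} {t′} {z} {z′} p∈ p′∈ ht ht′ hz hz′ s s′ ex ey et ev
            with ∈-map⁻ rainbowPart p∈ | ∈-map⁻ rainbowPart p′∈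
          ... | j , j∈ , refl | j′ , j′∈ , refl with refl ← mod2-inj ht ht′ et =
            cong (λ j → + j , + 0) (cg⇒≡ (∈-upTo⁻ j∈) (∈-upTo⁻ j′∈) (cg-cancelˡ x (cg-trans (cg-reflexive ex)
              (cg-+ (cg-sym (v-inj x y x′ y′ t ht (cg-trans (cg-sym (drop (v x y t) z s))
                (cg-trans (cg-reflexive (cong +_ ev)) (drop (v x′ y′ t) z′ s′))))) (cg-refl {u = + j′}))))) , refl
          residue : ∀ x y t z → t < 2 → ∃ λ j → j < B × Cg (+ B) (+ v (x -ℤ + j) y t) (+ z)
          residue x y zero z _ = j , n%ℕd<d (x -ℤ + z) B , cg-trans (v≈0 (x -ℤ + j) y)
            (cg-trans (cg-+ (cg-refl {u = x}) (cg-neg (%-cg (x -ℤ + z) B))) (cg-reflexive (eq x (+ z))))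
            where j = (x -ℤ + z) %ℕ B
                  eq : ∀ x z → x +ℤ -ℤ (x +ℤ -ℤ z) ≡ z
                  eq = solveℤ
          residue x y (suc zero) z _ = j , n%ℕd<d (+ z -ℤ S +ℤ x) B , cg-trans (v≈1 (x -ℤ + j) y)
            (cg-trans (cg-reflexive (eq₁ S x (+ j))) (cg-trans (cg-+ (cg-refl {u = S -ℤ x}) (%-cg (+ z -ℤ S +ℤ x) B)) (cg-reflexive (eq₂ S x (+ z)))))
            where j = (+ z -ℤ S +ℤ x) %ℕ B
                  eq₁ : ∀ s x j → s +ℤ -ℤ (x +ℤ -ℤ j) ≡ s +ℤ -ℤ x +ℤ j
                  eq₁ = solveℤ
                  eq₂ : ∀ s x z → s +ℤ -ℤ x +ℤ (z +ℤ -ℤ s +ℤ x) ≡ z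
                  eq₂ = solveℤ
          residue x y (suc (suc t)) z (s≤s (s≤s ()))
          reached : Reached rainbowEqn
          reached x y t z ht hz _ with j , j<B , e ← residue x y t z ht =
            rainbowPart j , x -ℤ + j , y , t , ∈-map⁺ rainbowPart (∈-upTo⁺ j<B) , ht , back x (+ j) , ℤₚ.+-identityʳ y , mod2 ht ,
            λ d d<N e′ → subst (T ∘ isZero) (sym (zero-rest d e′)) tt
            where
            c = v (x -ℤ + j) y t
            zero-rest : ∀ d → (c + d) % N ≡ z → d % B ≡ 0
            zero-rest d e′ = cg⇒% {B} {d} {0} (cg-cancelˡ (+ c) (cg-trans (N⇒B (cg-sym (cg-mod (c + d) N)))
              (cg-trans (cg-reflexive (cong +_ e′)) (cg-trans (cg-sym e) (cg-reflexive (sym (ℤₚ.+-identityʳ (+ c))))))))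

        solution⇒tiling : TilingProblem inst
        solution⇒tiling = A sols , tiling sols
          where
          sols : ∀ {e} → e ∈ eqs → Solves e
          sols e∈ with kind e∈
          ... | graph   = solve-per (zeros q) origin (λ x y t → trans (zero-dot (α x y t)) (sym (zero-dot (α _ _ t))))
            where zero-dot : ∀ {n} (v : Vec ℕ n) → dot (zeros n) v ≡ 0
                  zero-dot v = trans (dot-comm (zeros _) v) (dot-zeros v)
          ... | sum     = solve-sum
          ... | rainbow = solve-rainbow
          ... | bool i  = solve-bool i
          ... | per {c} {v} m = solve-per (wt c ωs) v H
            where
            H : ∀ x y t → dot (wt c ωs) (α x y t) ≡ dot (wt c ωs) (α (x -ℤ proj₁ v) (y -ℤ proj₂ v) t)
            H x y zero    = trans (dot-α c x y) (trans (periodic m x y) (sym (dot-α c _ _)))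
            H x y (suc t) = ℕₚ.+-cancelʳ-≡ (c (φ x y)) _ _
              (trans (dot-ᾱ c x y) (sym (trans (cong (_+_ (dot (wt c ωs) (compl (ix _ _)))) (periodic m x y)) (dot-ᾱ c _ _))))

-- The bases, the counter machine, and the finite alphabet with its local rules.

module LocalRules where

  open import Defs using (Regs; upd)
  open Arithmetic
  open Digits
  open Tilings using (allVec)
  open import Data.Nat as ℕ using (ℕ; zero; suc; z≤n; s≤s; _<_; _≤_)
  import Data.Nat.Properties as ℕₚ
  open import Data.Nat.DivMod using (m<n⇒m%n≡m; [m+kn]%n≡m%n)
  open import Data.Integer using (ℤ; +_; _+_; _-_; _*_; -_; _^_; 0ℤ; 1ℤ)
  import Data.Integer.Properties as ℤₚ
  open import Data.Integer.Divisibility.Signed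
  open import Data.Integer.Tactic.RingSolver using (solve-∀)
  open import Data.Bool using (Bool; true; false; not)
  open import Data.Vec using (Vec; []; _∷_; replicate)
  open import Data.List using (List; []; _∷_; map; filter; upTo; cartesianProduct; _++_)
  open import Data.List.Membership.Propositional using (_∈_)
  open import Data.List.Membership.Propositional.Properties
  open import Data.List.Relation.Unary.Any using (here; there)
  open import Data.Product using (_×_; _,_; proj₁; proj₂)
  open import Data.Sum using (_⊎_; inj₁; inj₂)
  open import Data.Unit using (⊤; tt)
  open import Data.Empty using (⊥-elim)
  open import Relation.Nullary using (¬_; Dec; yes; no)
  open import Relation.Nullary.Decidable using (_×-dec_; _⊎-dec_; _→-dec_; ¬?; map′)
  open import Relation.Binary.Definitions using (tri<; tri≈; tri>)
  open import Relation.Binary.PropositionalEquality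

  -- Sylvester's sequence, started at 12: each term is 1 modulo 12 and modulo all earlier terms.
  P sylv : ℕ → ℕ
  P zero    = 12
  P (suc n) = P n ℕ.* suc (P n)
  sylv n = suc (P n)

  P∣ : ∀ {m n} → m ≤ n → + P m ∣ + P n
  P∣ {m} {zero}  z≤n = ∣-refl
  P∣ {m} {suc n} le with ℕₚ.m≤n⇒m<n∨m≡n le
  ... | inj₁ (s≤s lt) = ∣-trans (P∣ lt) (recast (∣m⇒∣m*n (+ sylv n) ∣-refl) (sym (ℤₚ.pos-* (P n) (sylv n))))
  ... | inj₂ refl     = ∣-refl

  sylv∣P : ∀ {m n} → m < n → + sylv m ∣ + P n
  sylv∣P {m} {n} lt = ∣-trans (recast (∣n⇒∣m*n (+ P m) ∣-refl) (sym (ℤₚ.pos-* (P m) (sylv m)))) (P∣ lt)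

  cop-sylv : ∀ {c n} → c ∣ + P n → Cop (+ sylv n) c
  cop-sylv {c} {n} (divides q e) = 1ℤ , - q , trans (cong (_+ - q * c) (cong (λ z → 1ℤ * (1ℤ + z)) e)) (eq q c)
    where eq : ∀ q c → 1ℤ * (1ℤ + q * c) + - q * c ≡ 1ℤ
          eq = solve-∀

  12≤P : ∀ n → 12 ≤ P n
  12≤P zero    = ℕₚ.≤-refl
  12≤P (suc n) = ℕₚ.≤-trans (12≤P n) (ℕₚ.m≤m*n (P n) (sylv n))

  module Bases (k : ℕ) where

    kb : ℕ
    kb = suc k

    -- The terms after the first are taken in reverse order: base 1, the input register, gets the
    -- largest one, which is 1 modulo all the others.
    β : ℕ → ℕ
    β zero    = 13
    β (suc i) = sylv (k ℕ.∸ i)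

    b : ℕ → ℤ
    b i = + β i

    place : ℕ → ℕ
    place zero    = 0
    place (suc i) = k ℕ.∸ i

    β-place : ∀ i → β i ≡ sylv (place i)
    β-place zero    = refl
    β-place (suc i) = refl

    place-inj : ∀ i j → i < kb → j < kb → place i ≡ place j → i ≡ j
    place-inj zero    zero    _ _ _ = refl
    place-inj zero    (suc j) _ (s≤s l) e = ⊥-elim (ℕₚ.<⇒≢ (ℕₚ.m<n⇒0<n∸m l) e)
    place-inj (suc i) zero    (s≤s l) _ e = ⊥-elim (ℕₚ.<⇒≢ (ℕₚ.m<n⇒0<n∸m l) (sym e))
    place-inj (suc i) (suc j) (s≤s l) (s≤s l′) e = cong suc (ℕₚ.∸-cancelˡ-≡ (ℕₚ.<⇒≤ l) (ℕₚ.<⇒≤ l′) e)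

    place≤ : ∀ i → place i ≤ k
    place≤ zero    = z≤n
    place≤ (suc i) = ℕₚ.m∸n≤m k i

    12<β : ∀ i → 12 < β i
    12<β i rewrite β-place i = s≤s (12≤P (place i))

    1<β : ∀ i → 1 < β i
    1<β i = ℕₚ.<-trans (s≤s (s≤s z≤n)) (12<β i)

    cop12 : ∀ i → Cop (b i) (+ 12)
    cop12 i rewrite β-place i = cop-sylv {n = place i} (P∣ {n = place i} z≤n)

    cop-β : ∀ i j → i < kb → j < kb → i ≢ j → Cop (b i) (b j)
    cop-β i j i<k j<k i≢j rewrite β-place i | β-place j with ℕₚ.<-cmp (place i) (place j)
    ... | tri< lt _ _ = cop-sym (cop-sylv {n = place j} (sylv∣P lt))
    ... | tri≈ _ e _  = ⊥-elim (i≢j (place-inj i j i<k j<k e))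
    ... | tri> _ _ gt = cop-sylv {n = place i} (sylv∣P gt)

    input≈1 : ∀ i → 1 < kb → i < kb → i ≢ 1 → Cg (b i) (b 1) 1ℤ
    input≈1 i 1<k i<k i≢1 = cg (recast (sub i 1<k i<k i≢1) (eq (+ P k)))
      where
      eq : ∀ p → p ≡ 1ℤ + p + - 1ℤ
      eq = solve-∀
      sub : ∀ i → 1 < kb → i < kb → i ≢ 1 → b i ∣ + P k
      sub i 1<k i<k i≢1 rewrite β-place i with ℕₚ.m≤n⇒m<n∨m≡n (place≤ i)
      ... | inj₁ lt = sylv∣P lt
      ... | inj₂ e  = ⊥-elim (i≢1 (place-inj i 1 i<k 1<k e))

    ∤1 : ∀ i → ¬ (b i ∣ 1ℤ)
    ∤1 i x = small-∤ (s≤s z≤n) (1<β i) (cg x)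

    ∤-cop : ∀ i {r} → Cop (b i) r → ¬ (b i ∣ r)
    ∤-cop i cop x = ∤1 i (cop-cancel cop {1ℤ} (recast x (sym (ℤₚ.*-identityʳ _))))

    2-cancel : ∀ i {x} → b i ∣ + 2 * x → b i ∣ x
    2-cancel i = cop-cancel {c = + 2} (cop-∣ {c = + 2} (cop12 i) (divides (+ 6) refl))

    -- Encodes the initial configuration with input n. Its last nonzero digit is 1 in every base, so no rule depends on n.
    start-code : ℕ → ℕ
    start-code n = β 1 ℕ.^ n

    start-code≡ : ∀ n → + start-code n ≡ b 1 ^ n
    start-code≡ n = pos-^ (β 1) n

    start-code≈1 : ∀ n i → 1 < kb → i < kb → i ≢ 1 → Cg (b i) (+ start-code n) 1ℤ
    start-code≈1 n i 1<k i<k i≢1 = cg-trans (cg-reflexive (start-code≡ n)) (cg-^ n (input≈1 i 1<k i<k i≢1))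

    start-code-cop : ∀ n i → 1 < kb → i < kb → i ≢ 1 → Cop (b i) (+ start-code n)
    start-code-cop n i 1<k i<k i≢1 = subst (Cop (b i)) (sym (start-code≡ n)) (cop-^ n (cop-β i 1 i<k 1<k i≢1))

    -- The modulus `P kb` is a common multiple of all bases, so that one residue of a form yields
    -- its residues in every base.
    B′ : ℕ
    B′ = ℕ.pred (P kb)

    B≡ : suc B′ ≡ P kb
    B≡ = ℕₚ.suc-pred (P kb) {{ℕ.>-nonZero (ℕₚ.≤-trans (s≤s z≤n) (12≤P kb))}}

    β∣B : ∀ i → i < kb → b i ∣ + suc B′
    β∣B i i<k rewrite B≡ | β-place i = sylv∣P (s≤s (place≤ i))

    β≤B : ∀ i → i < kb → β i ≤ suc B′
    β≤B i i<k = ∣⇒≤ (∣⇒∣ᵤ (β∣B i i<k))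
      where open import Data.Nat.Divisibility using (∣⇒≤)

  data Op : Set where
    inc  : ℕ → ℕ → Op
    dec  : ℕ → ℕ → ℕ → Op
    jmp  : ℕ → Op
    stop : Op
    fail : Op

  Config : Set
  Config = ℕ × Regs

  module Machine (code : ℕ → Op) where

    branch : ℕ → ℕ → ℕ → Regs → ℕ → Config
    branch r s′ s₀ R zero    = s₀ , R
    branch r s′ s₀ R (suc v) = s′ , upd R r v

    exec : Op → Config → Config
    exec (inc r s′)    (s , R) = s′ , upd R r (suc (R r))
    exec (dec r s′ s₀) (s , R) = branch r s′ s₀ R (R r)
    exec (jmp s′)      (s , R) = s′ , R
    exec stop          c       = c
    exec fail          c       = c

    step : Config → Config
    step (s , R) = exec (code s) (s , R)

    steps : ℕ → Config → Config
    steps zero    c = c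
    steps (suc n) c = step (steps n c)

  upd-same : ∀ R r v → upd R r v r ≡ v
  upd-same R zero    v = refl
  upd-same R (suc r) v = upd-same (λ i → R (suc i)) r v

  upd-other : ∀ R r v j → j ≢ r → upd R r v j ≡ R j
  upd-other R zero    v zero    h = ⊥-elim (h refl)
  upd-other R zero    v (suc j) h = refl
  upd-other R (suc r) v zero    h = refl
  upd-other R (suc r) v (suc j) h = upd-other (λ i → R (suc i)) r v j (λ e → h (cong suc e))

  RegsBelow : ℕ → Op → Set
  RegsBelow k (inc r _)   = r < k
  RegsBelow k (dec r _ _) = r < k
  RegsBelow k _           = ⊤

  get : ∀ {A : Set} {n} → A → Vec A n → ℕ → A
  get d []       _       = d
  get d (x ∷ xs) zero    = x
  get d (x ∷ xs) (suc i) = get d xs i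

  tab : ∀ {A : Set} → (ℕ → A) → ∀ n → Vec A n
  tab f zero    = []
  tab f (suc n) = f 0 ∷ tab (λ i → f (suc i)) n

  get-tab : ∀ {A : Set} {d : A} f n {i} → i < n → get d (tab f n) i ≡ f i
  get-tab f (suc n) {zero}  _       = refl
  get-tab f (suc n) {suc i} (s≤s h) = get-tab (λ i → f (suc i)) n h

  ∈-tab : ∀ {A : Set} {xs : List A} f n → (∀ i → i < n → f i ∈ xs) → tab f n ∈ allVec xs n
  ∈-tab f zero    h = here refl
  ∈-tab f (suc n) h = ∈-cartesianProductWith⁺ _∷_ (h 0 (s≤s z≤n)) (∈-tab (λ i → f (suc i)) n (λ i l → h (suc i) (s≤s l)))

  ∈-get : ∀ {A : Set} {xs : List A} {d n} (v : Vec A n) → v ∈ allVec xs n → ∀ {i} → i < n → get d v i ∈ xs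
  ∈-get {xs = xs} {n = suc n} v m i<n with ∈-cartesianProductWith⁻ _∷_ xs (allVec xs n) m
  ∈-get {xs = xs} {n = suc n} _ m {zero}  i<n       | x , v , x∈ , v∈ , refl = x∈
  ∈-get {xs = xs} {n = suc n} _ m {suc i} (s≤s i<n) | x , v , x∈ , v∈ , refl = ∈-get v v∈ i<n

  pack : ∀ {n} → ℕ → Vec ℕ n → ℕ
  pack w []       = 0
  pack w (x ∷ xs) = x ℕ.+ pack w xs ℕ.* w

  pack-≤ : ∀ {n} w (v : Vec ℕ n) → v ∈ allVec (upTo (suc w)) n → pack (suc w) v < suc w ℕ.^ n
  pack-≤ w [] _ = s≤s z≤n
  pack-≤ {suc n} w v m with ∈-cartesianProductWith⁻ _∷_ (upTo (suc w)) (allVec (upTo (suc w)) n) m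
  ... | x , xs , x∈ , xs∈ , refl = ℕₚ.<-≤-trans (ℕₚ.+-monoˡ-< (pack (suc w) xs ℕ.* suc w) (∈-upTo⁻ x∈))
    (subst (suc (pack (suc w) xs) ℕ.* suc w ≤_) (ℕₚ.*-comm (suc w ℕ.^ n) (suc w)) (ℕₚ.*-monoˡ-≤ (suc w) (pack-≤ w xs xs∈)))

  pack-inj : ∀ {n} w (v v′ : Vec ℕ n) → v ∈ allVec (upTo (suc w)) n → v′ ∈ allVec (upTo (suc w)) n →
             pack (suc w) v ≡ pack (suc w) v′ → v ≡ v′
  pack-inj w [] [] _ _ _ = refl
  pack-inj {suc n} w v v′ m m′ e
    with ∈-cartesianProductWith⁻ _∷_ (upTo (suc w)) (allVec (upTo (suc w)) n) m
       | ∈-cartesianProductWith⁻ _∷_ (upTo (suc w)) (allVec (upTo (suc w)) n) m′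
  ... | x , xs , x∈ , xs∈ , refl | x′ , xs′ , x′∈ , xs′∈ , refl = cong₂ _∷_ x≡ (pack-inj w xs xs′ xs∈ xs′∈ p≡)
    where
    low : ∀ {x} p → x < suc w → (x ℕ.+ p ℕ.* suc w) ℕ.% suc w ≡ x
    low {x} p l = trans ([m+kn]%n≡m%n x p (suc w)) (m<n⇒m%n≡m l)
    x≡ : x ≡ x′
    x≡ = trans (sym (low (pack (suc w) xs) (∈-upTo⁻ x∈)))
           (trans (cong (ℕ._% suc w) e) (low (pack (suc w) xs′) (∈-upTo⁻ x′∈)))
    p≡ : pack (suc w) xs ≡ pack (suc w) xs′
    p≡ = ℕₚ.*-cancelʳ-≡ _ _ (suc w) (ℕₚ.+-cancelˡ-≡ x _ _ (trans e (cong (ℕ._+ pack (suc w) xs′ ℕ.* suc w) (sym x≡))))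

  all<? : ∀ {Q : ℕ → Set} n → (∀ i → Dec (Q i)) → Dec (∀ i → i < n → Q i)
  all<? n Q? = map′ (λ h i l → h {i} l) (λ h {i} l → h i l) (ℕₚ.allUpTo? Q? n)

  bool? : ∀ {Q : Bool → Set} → (∀ σ → Dec (Q σ)) → Dec (∀ σ → Q σ)
  bool? Q? = map′ (λ { (p , q) false → p ; (p , q) true → q }) (λ h → h false , h true) (Q? false ×-dec Q? true)

  -- The relations satisfied by the last nonzero digits dₒ, dᵤ, dₘ of o, u and o + m u,
  -- where δ is the last nonzero digit of m; near says that o/(m u) is 1 up to higher order.
  Tri : ℤ → ℤ → ℤ → ℤ → ℤ → Set
  Tri b δ dₒ dᵤ dₘ = ¬ (b ∣ dₒ + δ * dᵤ) → Cg b dₘ dₒ ⊎ Cg b dₘ (δ * dᵤ) ⊎ Cg b dₘ (dₒ + δ * dᵤ)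

  -- Here `d₁`, `d₂`, `d` are the digits of `o + u`, `o + 2 u`, `o + b u`. The two hypotheses
  -- express that `o` has larger valuation than `u`.
  Scale : ℤ → ℤ → ℤ → ℤ → ℤ → ℤ → Set
  Scale b dₒ dᵤ d₁ d₂ d = Cg b d₁ dᵤ → Cg b d₂ (+ 2 * dᵤ) → Cg b d dᵤ ⊎ Cg b dₒ (- dᵤ) ⊎ Cg b d (dₒ + dᵤ)

  near : ℤ → ℤ → ℤ → ℤ → ℤ → Set
  near b δ dₒ dᵤ dₘ = Cg b dₒ (δ * dᵤ) × Cg b dₘ (+ 2 * (δ * dᵤ))

  tri? : ∀ b δ dₒ dᵤ dₘ → Dec (Tri b δ dₒ dᵤ dₘ)
  tri? b δ dₒ dᵤ dₘ = ¬? (b ∣? _) →-dec (cg? _ _ _ ⊎-dec (cg? _ _ _ ⊎-dec cg? _ _ _))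

  scale? : ∀ b dₒ dᵤ d₁ d₂ d → Dec (Scale b dₒ dᵤ d₁ d₂ d)
  scale? b dₒ dᵤ d₁ d₂ d = cg? _ _ _ →-dec (cg? _ _ _ →-dec (cg? _ _ _ ⊎-dec (cg? _ _ _ ⊎-dec cg? _ _ _)))

  near? : ∀ b δ dₒ dᵤ dₘ → Dec (near b δ dₒ dᵤ dₘ)
  near? b δ dₒ dᵤ dₘ = cg? _ _ _ ×-dec cg? _ _ _

  module Local (k nS : ℕ) (code : ℕ → Op) where

    open Bases k public

    -- A row consists of `kb` digits, then the residue modulo `B` at index `kb`, then `nS` state
    -- flags. The `nF` proper multipliers are 1, 2 and the bases; index 0 of a side stands for
    -- multiplier 0, that is for the bare form `x` or `y`.
    L wd nF : ℕ
    L  = suc (kb ℕ.+ nS)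
    wd = suc B′
    nF = suc (suc kb)

    Row Side W : Set
    Row  = Vec ℕ L
    Side = Vec Row (suc nF)
    W    = Row × Side × Side

    noRow : Row
    noRow = replicate L 0

    -- side false holds the rows of the forms y + m x, side true those of x + m y, for m = mult a.
    row : Bool → ℕ → W → Row
    row false a (_ , s , _) = get noRow s a
    row true  a (_ , _ , s) = get noRow s a

    rowX : W → Row
    rowX = proj₁

    mult : ℕ → ℤ
    mult 0 = 0ℤ
    mult 1 = 1ℤ
    mult 2 = + 2
    mult (suc (suc (suc i))) = b i

    -- In base `b i` the factor `b i` only raises the valuation and has digit 1, while any other
    -- base is itself an admissible digit. The decision is an argument so that proofs can match on
    -- it.
    δ′ : ∀ r {i} → Dec (r ≡ i) → ℤ
    δ′ r (yes _) = 1ℤ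
    δ′ r (no  _) = b r

    δ : ℕ → ℕ → ℤ
    δ (suc (suc (suc r))) i = δ′ r (r ℕₚ.≟ i)
    δ a i = mult a

    digit : Row → ℕ → ℤ
    digit v i = + get 0 v i

    D : Bool → ℕ → ℕ → W → ℤ
    D σ a i ω = digit (row σ a ω) i

    ρ : Bool → W → ℤ
    ρ σ ω = digit (row σ 0 ω) kb

    ρ₊ : W → ℤ
    ρ₊ ω = digit (row false 1 ω) kb

    flag : Row → ℕ → Set
    flag v s = s < nS → get 0 v (suc kb ℕ.+ s) ≡ 1

    On : Bool → ℕ → W → Set
    On σ s ω = flag (row σ 0 ω) s

    Near : Bool → ℕ → W → Set
    Near σ a ω = ∀ i → i < kb → near (b i) (δ a i) (D σ 0 i ω) (D (not σ) 0 i ω) (D σ a i ω)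

    NearX : W → Set
    NearX ω = ∀ i → i < kb → near (b i) 1ℤ (D true 0 i ω) (D false 0 i ω) (digit (rowX ω) i)

    -- A step of the machine leads from x to y by a tick of the clock, and back to some x by the operation proper.
    OpRule : ℕ → Op → W → Set
    OpRule s (inc r s′)    ω = Near true (4 ℕ.+ r) ω → On false s ω → On true s′ ω
    OpRule s (dec r s′ s₀) ω = (Near false (4 ℕ.+ r) ω → On false s ω → On true s′ ω)
                             × (Near false 1 ω → ¬ (b (suc r) ∣ ρ false ω) → On false s ω → On true s₀ ω)
    OpRule s (jmp s′)      ω = Near false 1 ω → On false s ω → On true s′ ω
    OpRule s stop          ω = ⊤
    OpRule s fail          ω = ¬ On false s ω

    record Rules (ω : W) : Set where
      constructor mkRules
      field
        additive : Cg (+ suc B′) (ρ₊ ω) (ρ false ω + ρ true ω)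
        lowest   : ∀ σ i → i < kb → ¬ (b i ∣ ρ σ ω) → Cg (b i) (D σ 0 i ω) (ρ σ ω)
        tri      : ∀ σ i → i < kb → ∀ a → a < nF → Tri (b i) (δ (suc a) i) (D σ 0 i ω) (D (not σ) 0 i ω) (D σ (suc a) i ω)
        triX     : ∀ i → i < kb → Tri (b i) 1ℤ (D true 0 i ω) (D false 0 i ω) (digit (rowX ω) i)
        scale    : ∀ σ i → i < kb → Scale (b i) (D σ 0 i ω) (D (not σ) 0 i ω) (D σ 1 i ω) (D σ 2 i ω) (D σ (3 ℕ.+ i) i ω)
        -- A `y` divisible by no base plays the part of 1, and then `x`, being near `X y`, has the
        -- valuations of the initial configuration.
        start    : NearX ω → (∀ i → i < kb → ¬ (b i ∣ ρ false ω)) → On true 0 ω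
        -- Multiplier 3 is `b 0`, the base counting time: `y` is near `b 0 * x`.
        tick     : Near false 3 ω → ∀ s → s < nS → On true s ω → On false s ω
        ops      : ∀ s → s < nS → OpRule s (code s) ω

    on? : ∀ σ s ω → Dec (On σ s ω)
    on? σ s ω = (s ℕₚ.<? nS) →-dec (_ ℕₚ.≟ 1)

    Near? : ∀ σ a ω → Dec (Near σ a ω)
    Near? σ a ω = all<? kb λ i → near? (b i) (δ a i) (D σ 0 i ω) (D (not σ) 0 i ω) (D σ a i ω)

    opRule? : ∀ s op ω → Dec (OpRule s op ω)
    opRule? s (inc r s′)    ω = Near? true (4 ℕ.+ r) ω →-dec (on? false s ω →-dec on? true s′ ω)
    opRule? s (dec r s′ s₀) ω = (Near? false (4 ℕ.+ r) ω →-dec (on? false s ω →-dec on? true s′ ω))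
      ×-dec (Near? false 1 ω →-dec (¬? (b (suc r) ∣? ρ false ω) →-dec (on? false s ω →-dec on? true s₀ ω)))
    opRule? s (jmp s′)      ω = Near? false 1 ω →-dec (on? false s ω →-dec on? true s′ ω)
    opRule? s stop          ω = yes tt
    opRule? s fail          ω = ¬? (on? false s ω)

    abstract
      rules? : ∀ ω → Dec (Rules ω)
      rules? ω = map′ (λ { (p₁ , p₂ , p₃ , p₄ , p₅ , p₆ , p₇ , p₈) → mkRules p₁ p₂ p₃ p₄ p₅ p₆ p₇ p₈ })
        (λ { (mkRules p₁ p₂ p₃ p₄ p₅ p₆ p₇ p₈) → p₁ , p₂ , p₃ , p₄ , p₅ , p₆ , p₇ , p₈ })
        (cg? (+ suc B′) (ρ₊ ω) (ρ false ω + ρ true ω)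
         ×-dec bool? (λ σ → all<? kb λ i → ¬? (b i ∣? ρ σ ω) →-dec cg? (b i) (D σ 0 i ω) (ρ σ ω))
         ×-dec bool? (λ σ → all<? kb λ i → all<? nF λ a → tri? (b i) (δ (suc a) i) (D σ 0 i ω) (D (not σ) 0 i ω) (D σ (suc a) i ω))
         ×-dec all<? kb (λ i → tri? (b i) 1ℤ (D true 0 i ω) (D false 0 i ω) (digit (rowX ω) i))
         ×-dec bool? (λ σ → all<? kb λ i → scale? (b i) (D σ 0 i ω) (D (not σ) 0 i ω) (D σ 1 i ω) (D σ 2 i ω) (D σ (3 ℕ.+ i) i ω))
         ×-dec ((all<? kb λ i → near? (b i) 1ℤ (D true 0 i ω) (D false 0 i ω) (digit (rowX ω) i))
                 →-dec ((all<? kb λ i → ¬? (b i ∣? ρ false ω)) →-dec on? true 0 ω))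
         ×-dec (Near? false 3 ω →-dec all<? nS (λ s → on? true s ω →-dec on? false s ω))
         ×-dec all<? nS (λ s → opRule? s (code s) ω))

    rows : List Row
    rows = allVec (upTo (suc wd)) L

    sides : List Side
    sides = allVec rows (suc nF)

    ωs : List W
    ωs = filter rules? (cartesianProduct rows (cartesianProduct sides sides))

    bound : ℕ
    bound = suc wd ℕ.^ L ℕ.+ suc wd

    code-of : Row → ℕ
    code-of = pack (suc wd)

    sidePers : List ((W → ℕ) × (ℤ × ℤ))
    sidePers = map (λ a → (λ ω → code-of (row false a ω)) , (1ℤ , - mult a)) (upTo (suc nF))
            ++ map (λ a → (λ ω → code-of (row true a ω)) , (mult a , - 1ℤ)) (upTo (suc nF))

    -- `X` occurs in a single period vector, placed first, so that it affects only the first block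
    -- of the tile. Alphabet and modulus do not depend on it.
    pers : ℕ → List ((W → ℕ) × (ℤ × ℤ))
    pers X = ((λ ω → code-of (rowX ω)) , (+ X , - 1ℤ)) ∷ sidePers

    clock : W → ℕ
    clock ω = get 0 (row true 0 ω) kb

    record WellFormed (ω : W) : Set where
      field
        X∈   : rowX ω ∈ rows
        row∈ : ∀ σ a → a < suc nF → row σ a ω ∈ rows
        good : Rules ω

    ∈ωs⁻ : ∀ {ω} → ω ∈ ωs → WellFormed ω
    ∈ωs⁻ {ω} m with ∈-filter⁻ rules? {xs = cartesianProduct rows (cartesianProduct sides sides)} m
    ... | m′ , g with ∈-cartesianProduct⁻ rows (cartesianProduct sides sides) m′
    ...   | x∈ , ss with ∈-cartesianProduct⁻ sides sides ss
    ...     | s∈ , t∈ = record { X∈ = x∈ ; row∈ = r ; good = g }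
      where
      r : ∀ σ a → a < suc nF → row σ a ω ∈ rows
      r false a l = ∈-get (proj₁ (proj₂ ω)) s∈ l
      r true  a l = ∈-get (proj₂ (proj₂ ω)) t∈ l

    data PerKind (X : ℕ) : (W → ℕ) × (ℤ × ℤ) → Set where
      isX : PerKind X ((λ ω → code-of (rowX ω)) , (+ X , - 1ℤ))
      isF : ∀ a → a < suc nF → PerKind X ((λ ω → code-of (row false a ω)) , (1ℤ , - mult a))
      isT : ∀ a → a < suc nF → PerKind X ((λ ω → code-of (row true a ω)) , (mult a , - 1ℤ))

    per-kind : ∀ X {cv} → cv ∈ pers X → PerKind X cv
    per-kind X (here refl) = isX
    per-kind X (there m) with ∈-++⁻ (map (λ a → (λ ω → code-of (row false a ω)) , (1ℤ , - mult a)) (upTo (suc nF))) m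
    ... | inj₁ h with ∈-map⁻ (λ a → (λ ω → code-of (row false a ω)) , (1ℤ , - mult a)) h
    ...   | a , a∈ , refl = isF a (∈-upTo⁻ a∈)
    per-kind X (there m) | inj₂ h with ∈-map⁻ (λ a → (λ ω → code-of (row true a ω)) , (mult a , - 1ℤ)) h
    ...   | a , a∈ , refl = isT a (∈-upTo⁻ a∈)

    per-F : ∀ X a → a < suc nF → ((λ ω → code-of (row false a ω)) , (1ℤ , - mult a)) ∈ pers X
    per-F X a l = there (∈-++⁺ˡ (∈-map⁺ (λ a → (λ ω → code-of (row false a ω)) , (1ℤ , - mult a)) (∈-upTo⁺ l)))

    per-T : ∀ X a → a < suc nF → ((λ ω → code-of (row true a ω)) , (mult a , - 1ℤ)) ∈ pers X
    per-T X a l = there (∈-++⁺ʳ (map (λ a → (λ ω → code-of (row false a ω)) , (1ℤ , - mult a)) (upTo (suc nF))) (∈-map⁺ (λ a → (λ ω → code-of (row true a ω)) , (mult a , - 1ℤ)) (∈-upTo⁺ l)))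

    code-bound : ∀ {v} → v ∈ rows → code-of v ≤ bound
    code-bound {v} m = ℕₚ.≤-trans (ℕₚ.<⇒≤ (pack-≤ wd v m)) (ℕₚ.m≤m+n _ _)

    bounded : ∀ X {c v} → (c , v) ∈ pers X → ∀ {ω} → ω ∈ ωs → c ω ≤ bound
    bounded X m {ω} ω∈ with per-kind X m
    ... | isX     = code-bound (WellFormed.X∈ (∈ωs⁻ ω∈))
    ... | isF a l = code-bound (WellFormed.row∈ (∈ωs⁻ ω∈) false a l)
    ... | isT a l = code-bound (WellFormed.row∈ (∈ωs⁻ ω∈) true a l)

    clock-bounded : ∀ {ω} → ω ∈ ωs → clock ω ≤ bound
    clock-bounded {ω} ω∈ = ℕₚ.≤-trans (ℕₚ.<⇒≤ (∈-upTo⁻ (∈-get (row true 0 ω) (WellFormed.row∈ (∈ωs⁻ ω∈) true 0 (s≤s z≤n)) (s≤s (ℕₚ.m≤m+n kb nS)))))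
                             (ℕₚ.m≤n+m _ _)

-- The rules force the digit functions to be b-adic digits around a centre.

module Rigid where

  open Arithmetic
  open LocalRules using (Tri; Scale; near)
  open import Data.Nat as ℕ using (ℕ; zero; suc; s≤s; _<_)
  import Data.Nat.Properties as ℕₚ
  open import Data.Integer using (ℤ; +_; _+_; _-_; _*_; -_; _^_; 1ℤ)
  import Data.Integer.Properties as ℤₚ
  open import Data.Integer.Divisibility.Signed
  open import Data.Integer.Tactic.RingSolver using (solve-∀)
  open import Data.Bool using (Bool; not)
  open import Data.Product using (Σ; _×_; _,_; proj₁; proj₂)
  open import Data.Sum using (_⊎_; inj₁; inj₂)
  open import Data.Empty using (⊥-elim)
  open import Function using (_∘_)
  open import Relation.Nullary using (¬_)
  open import Relation.Binary.PropositionalEquality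

  open Cg

  module Rigidity (b : ℕ) (8<b : 8 < b) (c12 : Cop (+ b) (+ 12)) (g h : ℤ) (gh : Cg (+ b) (g * h) 1ℤ)
    (U D₁ D₂ D : Bool → ℤ → ℤ)
    (tri₁ : ∀ σ o u → Tri (+ b) 1ℤ (U σ o) (U (not σ) u) (D₁ σ (o + 1ℤ * u)))
    (tri₂ : ∀ σ o u → Tri (+ b) (+ 2) (U σ o) (U (not σ) u) (D₂ σ (o + + 2 * u)))
    (scale : ∀ σ o u → Scale (+ b) (U σ o) (U (not σ) u) (D₁ σ (o + 1ℤ * u)) (D₂ σ (o + + 2 * u)) (D σ (o + + b * u)))
    where

    B : ℤ
    B = + b

    cancel : ∀ k k′ → k′ * k ≡ + 12 → ∀ {u} → B ∣ k * u → B ∣ u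
    cancel k k′ e = cop-cancel (cop-∣ c12 (divides k′ (sym e)))

    g-cancel : ∀ {u} → B ∣ g * u → B ∣ u
    g-cancel {u} d = cg-∣ (cg-trans (cg-reflexive (sym (ℤₚ.*-identityʳ u))) (cg-trans (cg-*ˡ u (cg-sym gh)) (cg-reflexive (eq u g h)))) (∣n⇒∣m*n h d)
      where eq : ∀ u g h → u * (g * h) ≡ h * (g * u)
            eq = solve-∀

    hg : ∀ u → Cg B (h * (g * u)) u
    hg u = cg-trans (cg-reflexive (eq u g h)) (cg-trans (cg-*ˡ u gh) (cg-reflexive (ℤₚ.*-identityʳ u)))
      where eq : ∀ u g h → h * (g * u) ≡ u * (g * h)
            eq = solve-∀

    gh′ : ∀ u → Cg B (g * (h * u)) u
    gh′ u = cg-trans (cg-reflexive (eq u g h)) (cg-trans (cg-*ˡ u gh) (cg-reflexive (ℤₚ.*-identityʳ u)))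
      where eq : ∀ u g h → g * (h * u) ≡ u * (g * h)
            eq = solve-∀

    -- At distances from `c σ` of valuation below `K`, the function `U σ` is the last nonzero digit
    -- of the distance, up to the common unit `g`.
    Lev : ℕ → (Bool → ℤ) → Set
    Lev K c = ∀ σ a u → a < K → ¬ (B ∣ u) → Cg B (U σ (c σ + B ^ a * u)) (g * u)

    +B∤ : ∀ {u} v → ¬ (B ∣ u) → ¬ (B ∣ u + B * v)
    +B∤ v ¬d d = ¬d (∣m+n∣n⇒∣m d (∣m⇒∣m*n v ∣-refl))

    +B≈ : ∀ u v → Cg B (u + B * v) u
    +B≈ u v = cg (recast (∣m⇒∣m*n v (∣-refl {B})) (eq u (B * v)))
      where eq : ∀ u w → w ≡ u + w + - u
            eq = solve-∀

    -- Moving the centre by a multiple of `B ^ K` alters a distance of valuation below `K` only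
    -- beyond its last nonzero digit.
    Lev-shift : ∀ {K c c′} → (∀ σ → Cg (B ^ K) (c′ σ) (c σ)) → Lev K c → Lev K c′
    Lev-shift {K} {c} {c′} e lev σ a u a<K ¬d with e σ
    ... | cg (divides q eq) = subst (λ z → Cg B (U σ z) (g * u)) pos
          (cg-trans (lev σ a (u + B * v) a<K (+B∤ v ¬d)) (cg-*ˡ g (+B≈ u v)))
      where
      r = K ℕ.∸ suc a
      v = B ^ r * q
      split : B ^ K ≡ B ^ a * (B * B ^ r)
      split = trans (cong (B ^_) (sym (trans (ℕₚ.+-suc a r) (ℕₚ.m+[n∸m]≡n a<K)))) (ℤₚ.^-distribˡ-+-* B a (suc r))
      ring₁ : ∀ c A u b r q → c + A * (u + b * (r * q)) ≡ c + q * (A * (b * r)) + A * u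
      ring₁ = solve-∀
      ring₂ : ∀ c c′ → c + (c′ + - c) ≡ c′
      ring₂ = solve-∀
      pos : c σ + B ^ a * (u + B * v) ≡ c′ σ + B ^ a * u
      pos = trans (ring₁ (c σ) (B ^ a) u B (B ^ r) q)
        (cong (_+ B ^ a * u) (trans (cong (λ z → c σ + q * z) (sym split)) (trans (cong (_+_ (c σ)) (sym eq)) (ring₂ (c σ) (c′ σ)))))

    module _ (m : ℤ) (Dₘ : Bool → ℤ → ℤ)
      (tri : ∀ σ o u → Tri B m (U σ o) (U (not σ) u) (Dₘ σ (o + m * u))) where

      -- Any decomposition `1 = p + m q` writes the point at distance `B ^ a * u` as `o + m w` with
      -- `o` and `w` at known distances from their centres, which leaves three candidates for its
      -- digit.
      tri-cell : ∀ K c → Lev K c → ∀ σ a u p q → a < K → ¬ (B ∣ u) → ¬ (B ∣ p * u) → ¬ (B ∣ q * u) → p + m * q ≡ 1ℤ →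
        let d = Dₘ σ (c σ + m * c (not σ) + B ^ a * u) ; e = g * u in
        Cg B d (p * e) ⊎ Cg B d (m * q * e) ⊎ Cg B d e
      tri-cell K c lev σ a u p q a<K ¬u ¬p ¬q pq = conv (subst (λ z → Tri B m (U σ o) (U (not σ) w) (Dₘ σ z)) pos (tri σ o w) ¬sum)
        where
        o = c σ + B ^ a * (p * u)
        w = c (not σ) + B ^ a * (q * u)
        e = g * u
        ring₁ : ∀ c m c′ A p q u → c + A * (p * u) + m * (c′ + A * (q * u)) ≡ c + m * c′ + A * ((p + m * q) * u)
        ring₁ = solve-∀
        ring₂ : ∀ g p u → g * (p * u) ≡ p * (g * u)
        ring₂ = solve-∀
        ring₃ : ∀ g m q u → m * (g * (q * u)) ≡ m * q * (g * u)
        ring₃ = solve-∀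
        ring₄ : ∀ m p q e → p * e + m * q * e ≡ (p + m * q) * e
        ring₄ = solve-∀
        pos : o + m * w ≡ c σ + m * c (not σ) + B ^ a * u
        pos = trans (ring₁ (c σ) m (c (not σ)) (B ^ a) p q u)
          (cong (λ z → c σ + m * c (not σ) + B ^ a * z) (trans (cong (_* u) pq) (ℤₚ.*-identityˡ u)))
        Uo : Cg B (U σ o) (p * e)
        Uo = cg-trans (lev σ a (p * u) a<K ¬p) (cg-reflexive (ring₂ g p u))
        Uw : Cg B (m * U (not σ) w) (m * q * e)
        Uw = cg-trans (cg-*ˡ m (lev (not σ) a (q * u) a<K ¬q)) (cg-reflexive (ring₃ g m q u))
        sum≈ : Cg B (U σ o + m * U (not σ) w) e
        sum≈ = cg-trans (cg-+ Uo Uw) (cg-reflexive (trans (ring₄ m p q e) (trans (cong (_* e) pq) (ℤₚ.*-identityˡ e))))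
        ¬sum : ¬ (B ∣ U σ o + m * U (not σ) w)
        ¬sum d = ¬u (g-cancel (cg-∣ (cg-sym sum≈) d))
        conv : ∀ {d} → Cg B d (U σ o) ⊎ Cg B d (m * U (not σ) w) ⊎ Cg B d (U σ o + m * U (not σ) w) →
               Cg B d (p * e) ⊎ Cg B d (m * q * e) ⊎ Cg B d e
        conv (inj₁ x)        = inj₁ (cg-trans x Uo)
        conv (inj₂ (inj₁ x)) = inj₂ (inj₁ (cg-trans x Uw))
        conv (inj₂ (inj₂ x)) = inj₂ (inj₂ (cg-trans x sum≈))

    clash : ∀ {d e} k l k′ → k′ * (k - l) ≡ + 12 → Cg B d (k * e) → Cg B d (l * e) → B ∣ e
    clash {d} {e} k l k′ eq x y = cancel (k - l) k′ eq (recast (dvd (cg-trans (cg-sym x) y)) (ring k l e))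
      where ring : ∀ k l e → k * e + - (l * e) ≡ (k + - l) * e
            ring = solve-∀

    -- Two decompositions give the candidate multiples -1, 2, 1 and -2, 3, 1 of `e`. Every other
    -- coincidence between the lists would make a divisor of 12 times `e` divisible by the base.
    pick : ∀ {d e} → ¬ (B ∣ e) → Cg B d (- 1ℤ * e) ⊎ Cg B d (+ 2 * e) ⊎ Cg B d e →
           Cg B d (- (+ 2) * e) ⊎ Cg B d (+ 3 * e) ⊎ Cg B d e → Cg B d e
    pick ¬e (inj₂ (inj₂ x)) _ = x
    pick ¬e _ (inj₂ (inj₂ y)) = y
    pick ¬e (inj₁ x) (inj₁ y) = ⊥-elim (¬e (clash (- 1ℤ) (- (+ 2)) (+ 12) refl x y))
    pick ¬e (inj₁ x) (inj₂ (inj₁ y)) = ⊥-elim (¬e (clash (- 1ℤ) (+ 3) (- (+ 3)) refl x y))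
    pick ¬e (inj₂ (inj₁ x)) (inj₁ y) = ⊥-elim (¬e (clash (+ 2) (- (+ 2)) (+ 3) refl x y))
    pick ¬e (inj₂ (inj₁ x)) (inj₂ (inj₁ y)) = ⊥-elim (¬e (clash (+ 2) (+ 3) (- (+ 12)) refl x y))

    -- The sum in question has two contributions `d`, hence digit `d` or `2 d`. It is also a sum
    -- with contributions `- d` and `3 d`, hence has digit `- d`, `3 d` or `2 d`; only `2 d`
    -- survives, and the two points test as near.
    near-cell : ∀ K c → Lev K c → ∀ σ M eM δ (Dₘ : ℤ → ℤ) →
      (∀ o u → Tri B δ (U σ o) (U (not σ) u) (Dₘ (o + M * u))) → M ≡ B ^ eM * δ → (∀ {x} → B ∣ δ * x → B ∣ x) →
      ∀ n e u → n ≡ B ^ e * u → ¬ (B ∣ u) → eM ℕ.+ e < K →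
      near B δ (U σ (c σ + M * n)) (U (not σ) (c (not σ) + n)) (Dₘ (c σ + M * n + M * (c (not σ) + n)))
    near-cell K c lev σ M eM δ Dₘ tri refl can n e u refl ¬u l =
      cg-trans Uo₁ (cg-sym Uw₁) , cg-trans D≈ (cg-*ˡ (+ 2) (cg-sym Uw₁))
      where
      A d o₁ w₁ o₂ w₂ dₘ : ℤ
      A = B ^ (eM ℕ.+ e)
      d = g * (δ * u)
      o₁ = c σ + M * n
      w₁ = c (not σ) + n
      o₂ = c σ + A * (- 1ℤ * (δ * u))
      w₂ = c (not σ) + B ^ e * (+ 3 * u)
      dₘ = Dₘ (o₁ + M * w₁)
      e<K : e < K
      e<K = ℕₚ.≤-<-trans (ℕₚ.m≤n+m e eM) l
      ¬δu : ¬ (B ∣ δ * u)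
      ¬δu = ¬u ∘ can
      ¬d : ¬ (B ∣ d)
      ¬d = ¬δu ∘ g-cancel
      A≡ : A ≡ B ^ eM * B ^ e
      A≡ = ℤₚ.^-distribˡ-+-* B eM e
      ring₁ : ∀ c p q δ u → c + p * q * (δ * u) ≡ c + p * δ * (q * u)
      ring₁ = solve-∀
      ring₂ : ∀ g δ u → δ * (g * u) ≡ g * (δ * u)
      ring₂ = solve-∀
      ring₃ : ∀ g x → g * (- 1ℤ * x) ≡ - 1ℤ * (g * x)
      ring₃ = solve-∀
      ring₄ : ∀ g δ u → δ * (g * (+ 3 * u)) ≡ + 3 * (g * (δ * u))
      ring₄ = solve-∀
      ring₅ : ∀ d → d + d ≡ + 2 * d
      ring₅ = solve-∀
      ring₆ : ∀ d → - 1ℤ * d + + 3 * d ≡ + 2 * d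
      ring₆ = solve-∀
      ring₇ : ∀ c c′ p q δ u → c + p * q * (- 1ℤ * (δ * u)) + p * δ * (c′ + q * (+ 3 * u)) ≡ c + p * δ * (q * u) + p * δ * (c′ + q * u)
      ring₇ = solve-∀
      Uo₁ : Cg B (U σ o₁) d
      Uo₁ = subst (λ z → Cg B (U σ z) d) (trans (cong (λ z → c σ + z * (δ * u)) A≡) (ring₁ (c σ) (B ^ eM) (B ^ e) δ u))
              (lev σ (eM ℕ.+ e) (δ * u) l ¬δu)
      Uw₁ : Cg B (δ * U (not σ) w₁) d
      Uw₁ = cg-trans (cg-*ˡ δ (lev (not σ) e u e<K ¬u)) (cg-reflexive (ring₂ g δ u))
      Uo₂ : Cg B (U σ o₂) (- 1ℤ * d)
      Uo₂ = cg-trans (lev σ (eM ℕ.+ e) (- 1ℤ * (δ * u)) l (¬δu ∘ cancel (- 1ℤ) (- (+ 12)) refl)) (cg-reflexive (ring₃ g (δ * u)))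
      Uw₂ : Cg B (δ * U (not σ) w₂) (+ 3 * d)
      Uw₂ = cg-trans (cg-*ˡ δ (lev (not σ) e (+ 3 * u) e<K (¬u ∘ cancel (+ 3) (+ 4) refl))) (cg-reflexive (ring₄ g δ u))
      sum₁ : Cg B (U σ o₁ + δ * U (not σ) w₁) (+ 2 * d)
      sum₁ = cg-trans (cg-+ Uo₁ Uw₁) (cg-reflexive (ring₅ d))
      sum₂ : Cg B (U σ o₂ + δ * U (not σ) w₂) (+ 2 * d)
      sum₂ = cg-trans (cg-+ Uo₂ Uw₂) (cg-reflexive (ring₆ d))
      ¬2d : ¬ (B ∣ + 2 * d)
      ¬2d = ¬d ∘ cancel (+ 2) (+ 6) refl
      pos : o₂ + M * w₂ ≡ o₁ + M * w₁
      pos = trans (cong (λ z → c σ + z * (- 1ℤ * (δ * u)) + M * w₂) A≡) (ring₇ (c σ) (c (not σ)) (B ^ eM) (B ^ e) δ u)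
      t₁ : Cg B dₘ (U σ o₁) ⊎ Cg B dₘ (δ * U (not σ) w₁) ⊎ Cg B dₘ (U σ o₁ + δ * U (not σ) w₁)
      t₁ = tri o₁ w₁ (¬2d ∘ cg-∣ (cg-sym sum₁))
      t₂ : Cg B dₘ (U σ o₂) ⊎ Cg B dₘ (δ * U (not σ) w₂) ⊎ Cg B dₘ (U σ o₂ + δ * U (not σ) w₂)
      t₂ = subst (λ z → Tri B δ (U σ o₂) (U (not σ) w₂) (Dₘ z)) pos (tri o₂ w₂) (¬2d ∘ cg-∣ (cg-sym sum₂))
      d≡1d : Cg B d (1ℤ * d)
      d≡1d = cg-reflexive (sym (ℤₚ.*-identityˡ d))
      join : Cg B dₘ (U σ o₁) ⊎ Cg B dₘ (δ * U (not σ) w₁) ⊎ Cg B dₘ (U σ o₁ + δ * U (not σ) w₁) →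
             Cg B dₘ (1ℤ * d) ⊎ Cg B dₘ (+ 2 * d)
      join (inj₁ x)        = inj₁ (cg-trans x (cg-trans Uo₁ d≡1d))
      join (inj₂ (inj₁ x)) = inj₁ (cg-trans x (cg-trans Uw₁ d≡1d))
      join (inj₂ (inj₂ x)) = inj₂ (cg-trans x sum₁)
      settle : Cg B dₘ (1ℤ * d) ⊎ Cg B dₘ (+ 2 * d) →
               Cg B dₘ (U σ o₂) ⊎ Cg B dₘ (δ * U (not σ) w₂) ⊎ Cg B dₘ (U σ o₂ + δ * U (not σ) w₂) → Cg B dₘ (+ 2 * d)
      settle (inj₂ x) _               = x
      settle (inj₁ x) (inj₂ (inj₂ y)) = cg-trans y sum₂
      settle (inj₁ x) (inj₁ y)        = ⊥-elim (¬d (clash 1ℤ (- 1ℤ) (+ 6) refl x (cg-trans y Uo₂)))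
      settle (inj₁ x) (inj₂ (inj₁ y)) = ⊥-elim (¬d (clash 1ℤ (+ 3) (- (+ 6)) refl x (cg-trans y Uw₂)))
      D≈ : Cg B dₘ (+ 2 * d)
      D≈ = settle (join t₁) t₂

    private
      swap : ∀ {A B C : Set} → A ⊎ B ⊎ C → B ⊎ A ⊎ C
      swap (inj₁ x)        = inj₂ (inj₁ x)
      swap (inj₂ (inj₁ x)) = inj₁ x
      swap (inj₂ (inj₂ x)) = inj₂ (inj₂ x)

    lev₁ : ∀ K c → Lev K c → ∀ σ a u → a < K → ¬ (B ∣ u) → Cg B (D₁ σ (c σ + 1ℤ * c (not σ) + B ^ a * u)) (g * u)
    lev₁ K c lev σ a u a<K ¬u = pick (¬u ∘ g-cancel)
      (tri-cell 1ℤ D₁ tri₁ K c lev σ a u (- 1ℤ) (+ 2) a<K ¬u (¬u ∘ cancel (- 1ℤ) (- (+ 12)) refl) (¬u ∘ cancel (+ 2) (+ 6) refl) refl)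
      (tri-cell 1ℤ D₁ tri₁ K c lev σ a u (- (+ 2)) (+ 3) a<K ¬u (¬u ∘ cancel (- (+ 2)) (- (+ 6)) refl) (¬u ∘ cancel (+ 3) (+ 4) refl) refl)

    -- The decompositions are `1 = -1 + 2 * 1` and `1 = 3 + 2 * (-1)`; `swap` puts the candidates of
    -- the latter in the order expected by `pick`.
    lev₂ : ∀ K c → Lev K c → ∀ σ a u → a < K → ¬ (B ∣ u) → Cg B (D₂ σ (c σ + + 2 * c (not σ) + B ^ a * u)) (g * u)
    lev₂ K c lev σ a u a<K ¬u = pick (¬u ∘ g-cancel)
      (tri-cell (+ 2) D₂ tri₂ K c lev σ a u (- 1ℤ) 1ℤ a<K ¬u (¬u ∘ cancel (- 1ℤ) (- (+ 12)) refl) (¬u ∘ cancel (1ℤ) (+ 12) refl) refl)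
      (swap (tri-cell (+ 2) D₂ tri₂ K c lev σ a u (+ 3) (- 1ℤ) a<K ¬u (¬u ∘ cancel (+ 3) (+ 4) refl) (¬u ∘ cancel (- 1ℤ) (- (+ 12)) refl) refl))

    module Step (K : ℕ) (c : Bool → ℤ) (lev : Lev (suc K) c) (σ : Bool) where

      A A′ : ℤ
      A = B ^ K
      A′ = B ^ suc K

      -- The digits at multiples of `B ^ (K + 1)` are still unknown. If the one at `m` were `g`
      -- times the distance from the true centre `z`, then `a₀ m` would be `z`; so `a₀` and `a₁`
      -- read the unknown digits as claims about the centre.
      τ₀ τ₁ a₀ a₁ : ℤ → ℤ
      τ₀ m = U σ (c σ + A′ * m)
      τ₁ s = D σ (c σ + B * c (not σ) + A′ * s)
      a₀ m = m - h * τ₀ m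
      a₁ s = s - h * τ₁ s

      -- The point `s` of the scaled form is reached from `m` through a `u` at distance
      -- `B ^ K * (s - m)`, whose digit is known. The known levels verify both hypotheses of
      -- `Scale`, and its three alternatives become those required by `Pointing`.
      cells : ∀ m s → ¬ Cg B s m → Cg B (a₁ s) m ⊎ Cg B (a₀ m) s ⊎ Cg B (a₀ m) (a₁ s)
      cells m s ¬sm = conv (subst (λ z → Scale B (U σ o) (U (not σ) u) (D₁ σ (o + 1ℤ * u)) (D₂ σ (o + + 2 * u)) (D σ z)) pos₃
          (scale σ o u) (subst (λ z → Cg B (D₁ σ z) (U (not σ) u)) (sym pos₁) near₁)
          (subst (λ z → Cg B (D₂ σ z) (+ 2 * U (not σ) u)) (sym pos₂) near₂))
        where
        x = s - m
        ¬x : ¬ (B ∣ x)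
        ¬x d = ¬sm (cg d)
        o = c σ + A′ * m
        u = c (not σ) + A * x
        Uu : Cg B (U (not σ) u) (g * x)
        Uu = lev (not σ) K x ℕₚ.≤-refl ¬x
        ring₁ : ∀ n c c′ A b m x → c + b * A * m + n * (c′ + A * x) ≡ c + n * c′ + A * (n * x + b * m)
        ring₁ = solve-∀
        ring₂ : ∀ c c′ A b m s → c + b * A * m + b * (c′ + A * (s + - m)) ≡ c + b * c′ + b * A * s
        ring₂ = solve-∀
        ring₃ : ∀ n g x → g * (n * x) ≡ n * (g * x)
        ring₃ = solve-∀
        pos₁ : o + 1ℤ * u ≡ c σ + 1ℤ * c (not σ) + A * (1ℤ * x + B * m)
        pos₁ = ring₁ 1ℤ (c σ) (c (not σ)) A B m x
        pos₂ : o + + 2 * u ≡ c σ + + 2 * c (not σ) + A * (+ 2 * x + B * m)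
        pos₂ = ring₁ (+ 2) (c σ) (c (not σ)) A B m x
        pos₃ : o + B * u ≡ c σ + B * c (not σ) + A′ * s
        pos₃ = ring₂ (c σ) (c (not σ)) A B m s
        at : ∀ n (Dₙ : Bool → ℤ → ℤ) → (∀ σ a u → a < suc K → ¬ (B ∣ u) → Cg B (Dₙ σ (c σ + n * c (not σ) + B ^ a * u)) (g * u)) →
             (∀ {w} → B ∣ n * w → B ∣ w) → Cg B (Dₙ σ (c σ + n * c (not σ) + A * (n * x + B * m))) (n * U (not σ) u)
        at n Dₙ l can = cg-trans (l σ K (n * x + B * m) ℕₚ.≤-refl (+B∤ m (¬x ∘ can)))
          (cg-trans (cg-*ˡ g (+B≈ (n * x) m)) (cg-trans (cg-reflexive (ring₃ n g x)) (cg-*ˡ n (cg-sym Uu))))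
        near₁ : Cg B (D₁ σ (c σ + 1ℤ * c (not σ) + A * (1ℤ * x + B * m))) (U (not σ) u)
        near₁ = cg-trans (at 1ℤ D₁ (lev₁ (suc K) c lev) (cancel (1ℤ) (+ 12) refl)) (cg-reflexive (ℤₚ.*-identityˡ _))
        near₂ : Cg B (D₂ σ (c σ + + 2 * c (not σ) + A * (+ 2 * x + B * m))) (+ 2 * U (not σ) u)
        near₂ = at (+ 2) D₂ (lev₂ (suc K) c lev) (cancel (+ 2) (+ 6) refl)
        ring₄ : ∀ s m → s + - (s + - m) ≡ m
        ring₄ = solve-∀
        ring₅ : ∀ h u → h * - u ≡ - (h * u)
        ring₅ = solve-∀
        ring₆ : ∀ s m → m + - (- (s + - m)) ≡ s
        ring₆ = solve-∀
        ring₇ : ∀ s m h t → s + - (h * t + (s + - m)) ≡ m + - (h * t)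
        ring₇ = solve-∀
        hU : Cg B (h * U (not σ) u) x
        hU = cg-trans (cg-*ˡ h Uu) (hg x)
        conv : Cg B (τ₁ s) (U (not σ) u) ⊎ Cg B (τ₀ m) (- U (not σ) u) ⊎ Cg B (τ₁ s) (τ₀ m + U (not σ) u) →
               Cg B (a₁ s) m ⊎ Cg B (a₀ m) s ⊎ Cg B (a₀ m) (a₁ s)
        conv (inj₁ e) = inj₁ (cg-trans (cg-+ (cg-refl {u = s}) (cg-neg (cg-trans (cg-*ˡ h e) hU))) (cg-reflexive (ring₄ s m)))
        conv (inj₂ (inj₁ e)) = inj₂ (inj₁ (cg-trans
          (cg-+ (cg-refl {u = m}) (cg-neg (cg-trans (cg-*ˡ h e) (cg-trans (cg-reflexive (ring₅ h _)) (cg-neg hU)))))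
          (cg-reflexive (ring₆ s m))))
        conv (inj₂ (inj₂ e)) = inj₂ (inj₂ (cg-sym (cg-trans
          (cg-+ (cg-refl {u = s}) (cg-neg (cg-trans (cg-*ˡ h e)
            (cg-trans (cg-reflexive (ℤₚ.*-distribˡ-+ h (τ₀ m) _)) (cg-+ (cg-refl {u = h * τ₀ m}) hU)))))
          (cg-reflexive (ring₇ s m h (τ₀ m))))))

      open Pointing b 8<b a₀ a₁ cells

      z : ℤ
      z = proj₁ centre

      -- Every `m` other than `z` points at `z`, which says that its digit is `g * (m - z)`; the
      -- point at `z` itself corresponds to `u` divisible by `B`.
      new : ∀ u → ¬ (B ∣ u) → Cg B (U σ (c σ + A′ * z + A′ * u)) (g * u)
      new u ¬u = go (proj₂ centre (u + z))
        where
        ring₀ : ∀ u z → u + z + - z ≡ u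
        ring₀ = solve-∀
        ring₁ : ∀ c A u z → c + A * (u + z) ≡ c + A * z + A * u
        ring₁ = solve-∀
        ring₂ : ∀ u z t → u + z + - t + - z ≡ u + - t
        ring₂ = solve-∀
        go : Pts z (u + z) → Cg B (U σ (c σ + A′ * z + A′ * u)) (g * u)
        go (inj₁ e) = ⊥-elim (¬u (recast (dvd e) (ring₀ u z)))
        go (inj₂ e) = subst (λ w → Cg B (U σ w) (g * u)) (ring₁ (c σ) A′ u z)
            (cg-trans (cg-sym (gh′ (τ₀ (u + z)))) (cg-*ˡ g (cg-sym ht)))
          where
          ht : Cg B u (h * τ₀ (u + z))
          ht = cg (recast (dvd e) (ring₂ u z (h * τ₀ (u + z))))

    module _ (c₀ : Bool → ℤ) (base : ∀ σ u → ¬ (B ∣ u) → Cg B (U σ (c₀ σ + u)) (g * u)) where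

      Levels : ℕ → Set
      Levels K = Σ (Bool → ℤ) λ c → (∀ σ → Cg B (c σ) (c₀ σ)) × Lev (suc K) c

      refine : ∀ K → Levels K → Levels (suc K)
      refine K (c , e , lev) = c′ , (λ σ → cg-trans (close σ) (e σ)) , λ { σ a u (s≤s a≤) ¬u → lev′ σ a u (ℕₚ.m≤n⇒m<n∨m≡n a≤) ¬u }
        where
        c′ : Bool → ℤ
        c′ σ = c σ + B ^ suc K * Step.z K c lev σ
        diff : ∀ σ → Cg (B ^ suc K) (c′ σ) (c σ)
        diff σ = cg (recast (∣m⇒∣m*n (Step.z K c lev σ) (∣-refl {B ^ suc K})) (ring (c σ) _))
          where ring : ∀ c w → w ≡ c + w + - c
                ring = solve-∀
        close : ∀ σ → Cg B (c′ σ) (c σ)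
        close σ = cg (∣-trans (∣m⇒∣m*n (B ^ K) (∣-refl {B})) (dvd (diff σ)))
        lev′ : ∀ σ a u → a < suc K ⊎ a ≡ suc K → ¬ (B ∣ u) → Cg B (U σ (c′ σ + B ^ a * u)) (g * u)
        lev′ σ a u (inj₁ lt)   ¬u = Lev-shift {suc K} {c} {c′} diff lev σ a u lt ¬u
        lev′ σ a u (inj₂ refl) ¬u = Step.new K c lev σ u ¬u

      abstract
        levels : ∀ K → Levels K
        levels zero = c₀ , (λ _ → cg-refl) , lev
          where
          lev : Lev 1 c₀
          lev σ zero u _ ¬u = subst (λ z → Cg B (U σ (c₀ σ + z)) (g * u)) (sym (ℤₚ.*-identityˡ u)) (base σ u ¬u)
          lev σ (suc a) u (s≤s ()) ¬u
        levels (suc K) = refine K (levels K)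

-- From a tiling to the machine: flags follow the run, so it never fails.

module Necessity where

  open import Defs using (Regs; upd; initial)
  open Arithmetic
  open Digits using (%-cg; module Digit)
  open LocalRules
  open Rigid
  open import Data.Nat as ℕ using (ℕ; zero; suc; z≤n; s≤s; _<_; _≤_)
  import Data.Nat.Properties as ℕₚ
  open import Data.Integer using (ℤ; +_; -[1+_]; _+_; _-_; _*_; -_; _^_; 0ℤ; 1ℤ)
  open import Data.Integer.DivMod using (n%ℕd<d)
  import Data.Integer.Properties as ℤₚ
  open import Data.Integer.Divisibility.Signed
  open import Data.Integer.Tactic.RingSolver using (solve-∀)
  open import Data.Bool using (Bool; true; false; not)
  open import Data.Fin using (Fin; toℕ; fromℕ<)
  import Data.Fin as Fin
  import Data.Fin.Properties as Finₚ
  open import Data.Vec using (Vec)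
  open import Data.Product using (∃; _×_; _,_; proj₁; proj₂)
  open import Data.Sum using (_⊎_; inj₁; inj₂)
  open import Data.Empty using (⊥; ⊥-elim)
  open import Function using (_∘_)
  open import Relation.Nullary using (¬_; Dec; yes; no)
  open import Relation.Binary.PropositionalEquality

  open Cg

  ℤ-ind : (Q : ℤ → Set) → Q 0ℤ → (∀ n → Q n → Q (n + 1ℤ)) → (∀ n → Q (n + 1ℤ) → Q n) → ∀ n → Q n
  ℤ-ind Q z up down (+ zero)      = z
  ℤ-ind Q z up down (+ suc n)     = subst Q (cong +_ (ℕₚ.+-comm n 1)) (up (+ n) (ℤ-ind Q z up down (+ n)))
  ℤ-ind Q z up down -[1+ zero ]   = down -[1+ zero ] z
  ℤ-ind Q z up down -[1+ suc n ]  = down -[1+ suc n ] (ℤ-ind Q z up down -[1+ n ])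

  constant : ∀ {C : Set} (f : ℤ → C) → (∀ n → f n ≡ f (n - 1ℤ)) → ∀ n → f n ≡ f 0ℤ
  constant f h = ℤ-ind (λ n → f n ≡ f 0ℤ) refl
    (λ n e → trans (h (n + 1ℤ)) (trans (cong f (back n)) e))
    (λ n e → trans (cong f (sym (back n))) (trans (sym (h (n + 1ℤ))) e))
    where back : ∀ n → n + 1ℤ + - 1ℤ ≡ n
          back = solve-∀

  constant-on-lines : ∀ {C : Set} (f : ℤ → ℤ → C) m → (∀ x y → f x y ≡ f (x - 1ℤ) (y - - m)) →
                      ∀ x y → f x y ≡ f 0ℤ (y + m * x)
  constant-on-lines f m h x y =
    trans (cong (f x) (r₁ x y m)) (trans (constant (λ n → f n (w - m * n)) (λ n → trans (h n _) (cong (f (n - 1ℤ)) (r₂ w m n))) x)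
      (cong (f 0ℤ) (r₃ w m)))
    where
    w = y + m * x
    r₁ : ∀ x y m → y ≡ y + m * x + - (m * x)
    r₁ = solve-∀
    r₂ : ∀ w m n → w + - (m * n) + - (- m) ≡ w + - (m * (n + - 1ℤ))
    r₂ = solve-∀
    r₃ : ∀ w m → w + - (m * 0ℤ) ≡ w
    r₃ = solve-∀

  constant-on-lines′ : ∀ {C : Set} (f : ℤ → ℤ → C) m → (∀ x y → f x y ≡ f (x - m) (y - - 1ℤ)) →
                      ∀ x y → f x y ≡ f (x + m * y) 0ℤ
  constant-on-lines′ f m h x y = constant-on-lines (λ a b → f b a) m
    (λ a b → sym (trans (h (b - - m) (a - 1ℤ)) (cong₂ f (r₁ b m) (r₂ a)))) y x
    where
    r₁ : ∀ b m → b + - (- m) + - m ≡ b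
    r₁ = solve-∀
    r₂ : ∀ a → a + - 1ℤ + - (- 1ℤ) ≡ a
    r₂ = solve-∀

  ∏-cong : ∀ {m m′ : ℕ → ℤ} k → (∀ i → i < k → m i ≡ m′ i) → ∏ m k ≡ ∏ m′ k
  ∏-cong zero    h = refl
  ∏-cong (suc k) h = cong₂ _*_ (h k ℕₚ.≤-refl) (∏-cong k (λ i l → h i (ℕₚ.m≤n⇒m≤1+n l)))

  ∏-update : ∀ {m m′ : ℕ → ℤ} c k {i} → i < k → m′ i ≡ c * m i → (∀ j → j < k → j ≢ i → m′ j ≡ m j) → ∏ m′ k ≡ c * ∏ m k
  ∏-update {m} {m′} c (suc k) {i} l e h with ℕₚ.m≤n⇒m<n∨m≡n (ℕₚ.≤-pred l)
  ... | inj₁ l′ = trans (cong₂ _*_ (h k ℕₚ.≤-refl (ℕₚ.<⇒≢ l′ ∘ sym)) (∏-update c k l′ e (λ j j<k → h j (ℕₚ.m≤n⇒m≤1+n j<k)))) (r (m k) c _)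
    where r : ∀ a c p → a * (c * p) ≡ c * (a * p)
          r = solve-∀
  ... | inj₂ refl = trans (cong₂ _*_ e (∏-cong k (λ j j<k → h j (ℕₚ.m≤n⇒m≤1+n j<k) (ℕₚ.<⇒≢ j<k)))) (ℤₚ.*-assoc c (m k) _)

  ∏-split : ∀ {b} (m : ℕ → ℤ) k {i} → i < k → (∀ j → j < k → j ≢ i → Cop b (m j)) → ∃ λ r → ∏ m k ≡ m i * r × Cop b r
  ∏-split {b} m (suc k) {i} l h with ℕₚ.m≤n⇒m<n∨m≡n (ℕₚ.≤-pred l)
  ... | inj₂ refl = ∏ m k , refl , cop-∏ m k (λ j j<k → h j (ℕₚ.m≤n⇒m≤1+n j<k) (ℕₚ.<⇒≢ j<k))
  ... | inj₁ l′ with ∏-split {b} m k l′ (λ j j<k → h j (ℕₚ.m≤n⇒m≤1+n j<k))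
  ...   | r , e , cop = m k * r , trans (cong (m k *_) e) (eq (m k) (m i) r) , cop-* (h k ℕₚ.≤-refl (ℕₚ.<⇒≢ l′ ∘ sym)) cop
    where eq : ∀ a c p → a * (c * p) ≡ c * (a * p)
          eq = solve-∀

  abstract
    -- Multiplication by `g` is injective on `B` residues. If it missed 1, removing that value would
    -- squeeze `B` residues into `B′` places.
    inverse : ∀ B′ → 0 < B′ → (g : ℤ) → (∀ j j′ → j < suc B′ → j′ < suc B′ → Cg (+ suc B′) (g * + j) (g * + j′) → j ≡ j′) →
              ∃ λ h → Cg (+ suc B′) (g * h) 1ℤ
    inverse B′ 0<B′ g inj = result (Finₚ.any? (λ j → f j Finₚ.≟ one))
      where
      B : ℕ
      B = suc B′
      f : Fin B → Fin B
      f j = fromℕ< (n%ℕd<d (g * + toℕ j) B)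
      one : Fin B
      one = fromℕ< (s≤s 0<B′)
      val : ∀ j → Cg (+ B) (+ toℕ (f j)) (g * + toℕ j)
      val j = cg-trans (cg-reflexive (cong +_ (Finₚ.toℕ-fromℕ< _))) (%-cg (g * + toℕ j) B)
      result : Dec (∃ λ j → f j ≡ one) → ∃ λ h → Cg (+ B) (g * h) 1ℤ
      result (yes (j , e)) = + toℕ j , cg-trans (cg-sym (val j)) (cg-reflexive (cong +_ (trans (cong toℕ e) (Finₚ.toℕ-fromℕ< (s≤s 0<B′)))))
      result (no none) = ⊥-elim clash
        where
        f≢ : ∀ j → one ≢ f j
        f≢ j e = none (j , sym e)
        clash : ⊥
        clash with i , j , i<j , e ← Finₚ.pigeonhole (ℕₚ.n<1+n B′) (λ j → Fin.punchOut (f≢ j)) =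
          ℕₚ.<⇒≢ i<j (inj (toℕ i) (toℕ j) (Finₚ.toℕ<n i) (Finₚ.toℕ<n j)
            (cg-trans (cg-sym (val i)) (cg-trans (cg-reflexive (cong (λ z → + toℕ z) (Finₚ.punchOut-injective (f≢ i) (f≢ j) e))) (val j))))

  upd-≤ : ∀ {R r v m} → v ≤ m → (∀ j → R j ≤ m) → ∀ j → upd R r v j ≤ m
  upd-≤ {R} {r} {v} {m} h h′ j with j ℕₚ.≟ r
  ... | yes refl = subst (_≤ m) (sym (upd-same R r v)) h
  ... | no j≢r   = subst (_≤ m) (sym (upd-other R r v j j≢r)) (h′ j)

  -- Bounds the registers, and thereby the b-adic precision, needed to follow the run up to a given
  -- time.
  growth : ∀ code op s R {m} → (∀ j → R j ≤ m) → ∀ j → proj₂ (Machine.exec code op (s , R)) j ≤ suc m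
  growth code (inc r s′) s R h = upd-≤ {r = r} (s≤s (h r)) (λ j → ℕₚ.m≤n⇒m≤1+n (h j))
  growth code (dec r s′ s₀) s R {m} h = go (R r) refl
    where
    go : ∀ v → R r ≡ v → ∀ j → proj₂ (Machine.branch code r s′ s₀ R v) j ≤ suc m
    go zero    eq = λ j → ℕₚ.m≤n⇒m≤1+n (h j)
    go (suc v) eq = upd-≤ {r = r} (ℕₚ.≤-trans (ℕₚ.n≤1+n v) (ℕₚ.≤-trans (subst (_≤ m) eq (h r)) (ℕₚ.n≤1+n m))) (λ j → ℕₚ.m≤n⇒m≤1+n (h j))
  growth code (jmp s′) s R h = λ j → ℕₚ.m≤n⇒m≤1+n (h j)
  growth code stop s R h = λ j → ℕₚ.m≤n⇒m≤1+n (h j)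
  growth code fail s R h = λ j → ℕₚ.m≤n⇒m≤1+n (h j)

  module NoSolution (k nS : ℕ) (code : ℕ → Op) (0<k : 0 < k) (outside : ∀ s → nS ≤ s → code s ≡ stop)
    (regs : ∀ s → RegsBelow k (code s)) (input : ℕ) where

    open Local k nS code
    open Machine code
    open Sampling.Problem ωs B′ clock bound hiding (B)

    X : ℕ
    X = start-code input

    open Periodic (pers X) (bounded X) clock-bounded

    module _ (sol : Solution) where
      open Solution sol

      wf : ∀ x y → WellFormed (φ x y)
      wf x y = ∈ωs⁻ (φ∈ x y)

      rowOf : Bool → ℕ → ℤ → Row
      rowOf false a w = row false a (φ 0ℤ w)
      rowOf true  a w = row true a (φ w 0ℤ)

      rowXOf : ℤ → Row
      rowXOf w = rowX (φ w 0ℤ)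

      pt : Bool → ℤ → ℤ → W
      pt false o u = φ u o
      pt true  o u = φ o u

      along : ∀ σ a o u → a < suc nF → row σ a (pt σ o u) ≡ rowOf σ a (o + mult a * u)
      along false a o u l = constant-on-lines (λ x y → row false a (φ x y)) (mult a)
        (λ x y → pack-inj wd _ _ (WellFormed.row∈ (wf _ _) false a l) (WellFormed.row∈ (wf _ _) false a l) (periodic (per-F X a l) x y)) u o
      along true a o u l = constant-on-lines′ (λ x y → row true a (φ x y)) (mult a)
        (λ x y → pack-inj wd _ _ (WellFormed.row∈ (wf _ _) true a l) (WellFormed.row∈ (wf _ _) true a l) (periodic (per-T X a l) x y)) o u

      alongX : ∀ o u → rowX (pt true o u) ≡ rowXOf (o + + X * u)
      alongX o u = constant-on-lines′ (λ x y → rowX (φ x y)) (+ X)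
        (λ x y → pack-inj wd _ _ (WellFormed.X∈ (wf _ _)) (WellFormed.X∈ (wf _ _)) (periodic (here refl) x y)) o u
        where open import Data.List.Relation.Unary.Any using (here)

      along₀ : ∀ σ o u → row σ 0 (pt σ o u) ≡ rowOf σ 0 o
      along₀ σ o u = trans (along σ 0 o u (s≤s z≤n)) (cong (rowOf σ 0) (eq o u))
        where eq : ∀ o u → o + 0ℤ * u ≡ o
              eq = solve-∀

      across₀ : ∀ σ o u → row (not σ) 0 (pt σ o u) ≡ rowOf (not σ) 0 u
      across₀ false o u = along₀ true u o
      across₀ true  o u = along₀ false u o

      d : Bool → ℕ → ℕ → ℤ → ℤ
      d σ a i w = digit (rowOf σ a w) i

      r : Bool → ℤ → ℤ
      r σ w = d σ 0 kb w

      rules : ∀ σ o u → Rules (pt σ o u)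
      rules false o u = WellFormed.good (wf u o)
      rules true  o u = WellFormed.good (wf o u)

      tri-at : ∀ σ i a → i < kb → a < nF → ∀ o u → Tri (b i) (δ (suc a) i) (d σ 0 i o) (d (not σ) 0 i u) (d σ (suc a) i (o + mult (suc a) * u))
      tri-at σ i a i< a< o u = subst₂ (λ p q → Tri (b i) (δ (suc a) i) (digit p i) (digit q i) (d σ (suc a) i (o + mult (suc a) * u)))
        (along₀ σ o u) (across₀ σ o u)
        (subst (λ q → Tri (b i) (δ (suc a) i) (D σ 0 i (pt σ o u)) (D (not σ) 0 i (pt σ o u)) (digit q i)) (along σ (suc a) o u (s≤s a<))
          (Rules.tri (rules σ o u) σ i i< a a<))

      triX-at : ∀ i → i < kb → ∀ o u → Tri (b i) 1ℤ (d true 0 i o) (d false 0 i u) (digit (rowXOf (o + + X * u)) i)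
      triX-at i i< o u = subst₂ (λ p q → Tri (b i) 1ℤ (digit p i) (digit q i) (digit (rowXOf (o + + X * u)) i))
        (along₀ true o u) (across₀ true o u)
        (subst (λ q → Tri (b i) 1ℤ (D true 0 i (pt true o u)) (D false 0 i (pt true o u)) (digit q i)) (alongX o u)
          (Rules.triX (rules true o u) i i<))

      scale-at : ∀ σ i → i < kb → ∀ o u → Scale (b i) (d σ 0 i o) (d (not σ) 0 i u) (d σ 1 i (o + 1ℤ * u)) (d σ 2 i (o + + 2 * u)) (d σ (3 ℕ.+ i) i (o + b i * u))
      scale-at σ i i< o u = subst₂ (λ p q → Scale (b i) (digit p i) (digit q i) (d σ 1 i (o + 1ℤ * u)) (d σ 2 i (o + + 2 * u)) (d σ (3 ℕ.+ i) i (o + b i * u)))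
        (along₀ σ o u) (across₀ σ o u)
        (subst₂ (λ p q → Scale (b i) (D σ 0 i ω) (D (not σ) 0 i ω) (digit p i) (digit q i) (d σ (3 ℕ.+ i) i (o + b i * u)))
          (along σ 1 o u (s≤s (s≤s z≤n))) (along σ 2 o u (s≤s (s≤s (s≤s z≤n))))
          (subst (λ q → Scale (b i) (D σ 0 i ω) (D (not σ) 0 i ω) (D σ 1 i ω) (D σ 2 i ω) (digit q i)) (along σ (3 ℕ.+ i) o u (s≤s (s≤s (s≤s i<))))
            (Rules.scale (rules σ o u) σ i i<)))
        where ω = pt σ o u

      lowest-at : ∀ σ i → i < kb → ∀ w → ¬ (b i ∣ r σ w) → Cg (b i) (d σ 0 i w) (r σ w)
      lowest-at σ i i< w = subst (λ p → ¬ (b i ∣ digit p kb) → Cg (b i) (digit p i) (digit p kb)) (along₀ σ w 0ℤ) (Rules.lowest (rules σ w 0ℤ) σ i i<)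

      private
        Bℤ : ℤ
        Bℤ = + suc B′

      additive-at : ∀ x y → Cg Bℤ (digit (rowOf false 1 (y + 1ℤ * x)) kb) (r false y + r true x)
      additive-at x y = subst₂ (λ p q → Cg Bℤ (digit (rowOf false 1 (y + 1ℤ * x)) kb) (digit p kb + digit q kb)) (along₀ false y x) (across₀ false y x)
        (subst (λ q → Cg Bℤ (digit q kb) (ρ false (pt false y x) + ρ true (pt false y x))) (along false 1 y x (s≤s (s≤s z≤n)))
          (Rules.additive (rules false y x)))

      g : ℤ
      g = r false 1ℤ - r false 0ℤ

      private
        r-eq : ∀ x y x′ y′ → y + 1ℤ * x ≡ y′ + 1ℤ * x′ → Cg Bℤ (r false y + r true x) (r false y′ + r true x′)
        r-eq x y x′ y′ e = cg-trans (cg-sym (additive-at x y))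
          (cg-trans (cg-reflexive (cong (λ w → digit (rowOf false 1 w) kb) e)) (additive-at x′ y′))

        -- The rule `additive` makes `r false y + r true x` a function of `x + y` modulo `B`. As in
        -- Cauchy's equation, both summands are then affine with the same slope `g`.
        lin : ∀ σ w → Cg Bℤ (r σ w) (r σ 0ℤ + g * w)
        lin true = ℤ-ind (λ w → Cg Bℤ (r true w) (r true 0ℤ + g * w)) (cg-reflexive (eq₀ (r true 0ℤ) g))
          (λ n e → cg-trans (bump n) (cg-trans (cg-+ e (cg-refl {u = g})) (cg-reflexive (eq₁ (r true 0ℤ) g n))))
          (λ n e → drop n (cg-trans (cg-sym (bump n)) (cg-trans e (cg-reflexive (sym (eq₁ (r true 0ℤ) g n))))))
          where
          eq₀ : ∀ a g → a ≡ a + g * 0ℤ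
          eq₀ = solve-∀
          eq₁ : ∀ a g n → a + g * n + g ≡ a + g * (n + 1ℤ)
          eq₁ = solve-∀
          eq₂ : ∀ n → 0ℤ + 1ℤ * (n + 1ℤ) ≡ 1ℤ + 1ℤ * n
          eq₂ = solve-∀
          eq₃ : ∀ f₀ f₁ t t′ → f₀ + t + - (f₁ + t′) ≡ t + - (t′ + (f₁ + - f₀))
          eq₃ = solve-∀
          eq₄ : ∀ u v g → u + g + - (v + g) ≡ u + - v
          eq₄ = solve-∀
          bump : ∀ n → Cg Bℤ (r true (n + 1ℤ)) (r true n + g)
          bump n = cg (recast (dvd (r-eq (n + 1ℤ) 0ℤ n 1ℤ (eq₂ n))) (eq₃ (r false 0ℤ) (r false 1ℤ) (r true (n + 1ℤ)) (r true n)))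
          drop : ∀ n → Cg Bℤ (r true n + g) (r true 0ℤ + g * n + g) → Cg Bℤ (r true n) (r true 0ℤ + g * n)
          drop n (cg h) = cg (recast h (eq₄ (r true n) (r true 0ℤ + g * n) g))
        lin false w = cg-trans (swap (r-eq 0ℤ w w 0ℤ (eq₁ w))) (cg-trans (cg-+ (cg-refl {u = r false 0ℤ - r true 0ℤ}) (lin true w)) (cg-reflexive (eq₂ (r false 0ℤ) (r true 0ℤ) (g * w))))
          where
          eq₁ : ∀ w → w + 1ℤ * 0ℤ ≡ 0ℤ + 1ℤ * w
          eq₁ = solve-∀
          eq₂ : ∀ f t x → f + - t + (t + x) ≡ f + x
          eq₂ = solve-∀
          eq₃ : ∀ fw f t tw → fw + t + - (f + tw) ≡ fw + - (f + - t + tw)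
          eq₃ = solve-∀
          swap : Cg Bℤ (r false w + r true 0ℤ) (r false 0ℤ + r true w) → Cg Bℤ (r false w) (r false 0ℤ - r true 0ℤ + r true w)
          swap (cg h) = cg (recast h (eq₃ (r false w) (r false 0ℤ) (r true 0ℤ) (r true w)))

        -- The clock is `r true`, affine with slope `g`, and `spread` says that it takes distinct
        -- residues at `B` consecutive places. This excludes degenerate solutions such as constant
        -- residues.
        g-inj : ∀ j j′ → j < suc B′ → j′ < suc B′ → Cg Bℤ (g * + j) (g * + j′) → j ≡ j′
        g-inj j j′ l l′ (cg h) = spread 0ℤ 0ℤ j j′ l l′
          (cg-trans (lin true (0ℤ - + j)) (cg-trans (cg (recast (∣m⇒∣-m h) (eq (r true 0ℤ) g (+ j) (+ j′)))) (cg-sym (lin true (0ℤ - + j′)))))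
          where eq : ∀ a g j j′ → - (g * j + - (g * j′)) ≡ a + g * (0ℤ + - j) + - (a + g * (0ℤ + - j′))
                eq = solve-∀

        inv : ∃ λ h → Cg Bℤ (g * h) 1ℤ
        inv = inverse B′ (ℕₚ.≤-trans (s≤s z≤n) (ℕₚ.≤-pred (ℕₚ.≤-trans (s≤s (s≤s z≤n)) (subst (12 ≤_) (sym B≡) (12≤P kb))))) g g-inj

        h : ℤ
        h = proj₁ inv

        -- The zero of the affine function `r σ`, and thus the centre at the lowest level.
        c₀ : Bool → ℤ
        c₀ σ = - (h * r σ 0ℤ)

        r-centred : ∀ σ w → Cg Bℤ (r σ (c₀ σ + w)) (g * w)
        r-centred σ w = cg-trans (lin σ (c₀ σ + w)) (cg (recast (∣n⇒∣m*n (- r σ 0ℤ) (dvd (proj₂ inv))) (eq (r σ 0ℤ) g h w)))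
          where eq : ∀ a g h w → - a * (g * h + - 1ℤ) ≡ a + g * (- (h * a) + w) + - (g * w)
                eq = solve-∀

      module At (i : ℕ) (i< : i < kb) where

        down : ∀ {u v} → Cg Bℤ u v → Cg (b i) u v
        down (cg x) = cg (∣-trans (β∣B i i<) x)

        private
          8<β : 8 < β i
          8<β = ℕₚ.<-trans (s≤s (s≤s (s≤s (s≤s (s≤s (s≤s (s≤s (s≤s (s≤s z≤n))))))))) (12<β i)

        open Rigidity (β i) 8<β (cop12 i) g h (down (proj₂ inv))
          (λ σ → d σ 0 i) (λ σ → d σ 1 i) (λ σ → d σ 2 i) (λ σ → d σ (3 ℕ.+ i) i)
          (λ σ → tri-at σ i 0 i< (s≤s z≤n)) (λ σ → tri-at σ i 1 i< (s≤s (s≤s z≤n))) (λ σ → scale-at σ i i<) public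

        base : ∀ σ u → ¬ (b i ∣ u) → Cg (b i) (d σ 0 i (c₀ σ + u)) (g * u)
        base σ u ¬u = cg-trans (lowest-at σ i i< (c₀ σ + u) (λ x → ¬u (g-cancel (cg-∣ (cg-sym (down (r-centred σ u))) x)))) (down (r-centred σ u))

      -- The centre depends on the precision `K`: the approximations in one base need not stabilise
      -- in ℤ. For fixed `K`, one integer serves all bases by the Chinese remainder theorem.
      module Centre (K : ℕ) where

        centres : ∀ σ → ∃ λ c → ∀ i (l : i < kb) → Cg (b i ^ suc K) c (proj₁ (At.levels i l c₀ (At.base i l) K) σ)
        centres σ = chinese (λ i → b i ^ suc K) kb (λ i j i<j j<k → cop-^^ (suc K) (suc K) (cop-β j i j<k (ℕₚ.<-trans i<j j<k) (ℕₚ.<⇒≢ i<j ∘ sym)))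
          (λ i l → proj₁ (At.levels i l c₀ (At.base i l) K) σ)

        c : Bool → ℤ
        c σ = proj₁ (centres σ)

        lev : ∀ i (l : i < kb) → At.Lev i l (suc K) c
        lev i l = At.Lev-shift i l {suc K} {proj₁ (At.levels i l c₀ (At.base i l) K)} {c} (λ σ → proj₂ (centres σ) i l)
          (proj₂ (proj₂ (At.levels i l c₀ (At.base i l) K)))

        c≈c₀ : ∀ i (l : i < kb) σ → Cg (b i) (c σ) (c₀ σ)
        c≈c₀ i l σ = cg-trans (cg (∣-trans (∣m⇒∣m*n (b i ^ K) (∣-refl {b i})) (dvd (proj₂ (centres σ) i l)))) (proj₁ (proj₂ (At.levels i l c₀ (At.base i l) K)) σ)

        r∤ : ∀ i → i < kb → ∀ σ w → ¬ (b i ∣ w) → ¬ (b i ∣ r σ (c σ + w))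
        r∤ i l σ w ¬w x = ¬w (At.g-cancel i l (cg-∣ (cg-trans (cg-*ˡ g near-w) (cg-trans (cg-sym (At.down i l (r-centred σ w′))) (cg-reflexive (cong (r σ) (eq (c₀ σ) (c σ) w))))) x))
          where
          w′ = c σ + w - c₀ σ
          eq : ∀ a c w → a + (c + w + - a) ≡ c + w
          eq = solve-∀
          near-w : Cg (b i) w w′
          near-w = cg (recast (∣m⇒∣-m (dvd (c≈c₀ i l σ))) (eq′ (c₀ σ) (c σ) w))
            where eq′ : ∀ a c w → - (c + - a) ≡ w + - (c + w + - a)
                  eq′ = solve-∀

        record Val (i : ℕ) (n : ℤ) (e : ℕ) : Set where
          constructor mkVal
          field
            u  : ℤ
            n≡ : n ≡ b i ^ e * u
            ¬u : ¬ (b i ∣ u)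

        multVal : ∀ a i → suc a < suc nF → i < kb → ∃ λ e → e ≤ 1 × mult (suc a) ≡ b i ^ e * δ (suc a) i × (∀ {x} → b i ∣ δ (suc a) i * x → b i ∣ x)
        multVal 0 i _ _ = 0 , z≤n , refl , λ {x} q → recast q (ℤₚ.*-identityˡ x)
        multVal 1 i _ _ = 0 , z≤n , refl , 2-cancel i
        multVal (suc (suc a)) i (s≤s (s≤s (s≤s a<))) i< = go (a ℕₚ.≟ i)
          where
          eq : ∀ b → b ≡ b * 1ℤ * 1ℤ
          eq = solve-∀
          go : (p : Dec (a ≡ i)) → ∃ λ e → e ≤ 1 × b a ≡ b i ^ e * δ′ a p × (∀ {x} → b i ∣ δ′ a p * x → b i ∣ x)
          go (yes refl) = 1 , s≤s z≤n , eq (b i) , λ {x} q → recast q (ℤₚ.*-identityˡ x)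
          go (no a≢i)   = 0 , z≤n , sym (ℤₚ.*-identityˡ (b a)) , cop-cancel (cop-β i a i< a< (a≢i ∘ sym))

        -- A multiplier has valuation at most 1 in each base, so for `n` of valuations below `K` the
        -- known `suc K` levels suffice.
        near-at : ∀ σ a n → suc a < suc nF → (∀ i → i < kb → ∃ λ e → Val i n e × e < K) →
                  Near σ (suc a) (pt σ (c σ + mult (suc a) * n) (c (not σ) + n))
        near-at σ a n a< vals i i< = go (multVal a i a< i<) (vals i i<)
          where
          o = c σ + mult (suc a) * n
          w = c (not σ) + n
          go : (∃ λ e → e ≤ 1 × mult (suc a) ≡ b i ^ e * δ (suc a) i × (∀ {x} → b i ∣ δ (suc a) i * x → b i ∣ x)) →
               (∃ λ e → Val i n e × e < K) → near (b i) (δ (suc a) i) (D σ 0 i (pt σ o w)) (D (not σ) 0 i (pt σ o w)) (D σ (suc a) i (pt σ o w))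
          go (eM , eM≤1 , m≡ , can) (e , mkVal u n≡ ¬u , e<K) =
            subst₂ (λ p q → near (b i) (δ (suc a) i) (digit p i) (digit q i) (D σ (suc a) i (pt σ o w))) (sym (along₀ σ o w)) (sym (across₀ σ o w))
              (subst (λ q → near (b i) (δ (suc a) i) (d σ 0 i o) (d (not σ) 0 i w) (digit q i)) (sym (along σ (suc a) o w a<))
                (At.near-cell i i< (suc K) c (lev i i<) σ (mult (suc a)) eM (δ (suc a) i) (d σ (suc a) i)
                  (tri-at σ i a i< (ℕₚ.≤-pred a<)) m≡ can n e u n≡ ¬u (ℕₚ.≤-<-trans (ℕₚ.+-monoˡ-≤ e eM≤1) (s≤s e<K))))

        1-val : ∀ i → Val i 1ℤ 0
        1-val i = mkVal 1ℤ refl (∤1 i)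

        private
          tri-δ : ∀ {b δ δ′ p q m} → Cg b δ δ′ → Tri b δ p q m → Tri b δ′ p q m
          tri-δ {b} {δ} {δ′} {p} {q} e t ¬s = conv (t (¬s ∘ cg-∣ (cg-+ (cg-refl {u = p}) (cg-sym eq))))
            where
            eq : Cg b (δ * q) (δ′ * q)
            eq = subst₂ (Cg b) (ℤₚ.*-comm q δ) (ℤₚ.*-comm q δ′) (cg-*ˡ q e)
            conv : ∀ {m} → Cg b m p ⊎ Cg b m (δ * q) ⊎ Cg b m (p + δ * q) → Cg b m p ⊎ Cg b m (δ′ * q) ⊎ Cg b m (p + δ′ * q)
            conv (inj₁ x)        = inj₁ x
            conv (inj₂ (inj₁ x)) = inj₂ (inj₁ (cg-trans x eq))
            conv (inj₂ (inj₂ x)) = inj₂ (inj₂ (cg-trans x (cg-+ (cg-refl {u = p}) eq)))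

          near-δ : ∀ {b δ δ′ p q m} → Cg b δ δ′ → near b δ p q m → near b δ′ p q m
          near-δ {b} {δ} {δ′} {p} {q} e (x , y) = cg-trans x eq , cg-trans y (cg-*ˡ (+ 2) eq)
            where
            eq : Cg b (δ * q) (δ′ * q)
            eq = subst₂ (Cg b) (ℤₚ.*-comm q δ) (ℤₚ.*-comm q δ′) (cg-*ˡ q e)

          1<kb : 1 < kb
          1<kb = s≤s 0<k

        -- In base 1 the slope `X` is a pure power, of valuation `input`. In every other base it has
        -- valuation 0 and is congruent to 1, so the digit 1 in the rule may be exchanged for `X`.
        nearX-at : input < K → NearX (pt true (c true + + X * 1ℤ) (c false + 1ℤ))
        nearX-at le i i< = subst₂ (λ p q → near (b i) 1ℤ (digit p i) (digit q i) (digit (rowX (pt true o w)) i)) (sym (along₀ true o w)) (sym (across₀ true o w))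
            (subst (λ q → near (b i) 1ℤ (d true 0 i o) (d false 0 i w) (digit q i)) (sym (alongX o w)) (go (i ℕₚ.≟ 1)))
          where
          o = c true + + X * 1ℤ
          w = c false + 1ℤ
          go : Dec (i ≡ 1) → near (b i) 1ℤ (d true 0 i o) (d false 0 i w) (digit (rowXOf (o + + X * w)) i)
          go (yes refl) = At.near-cell 1 i< (suc K) c (lev 1 i<) true (+ X) input 1ℤ (λ z → digit (rowXOf z) 1) (triX-at 1 i<)
            (trans (start-code≡ input) (sym (ℤₚ.*-identityʳ _))) (λ {x} q → recast q (ℤₚ.*-identityˡ x)) 1ℤ 0 1ℤ refl (Val.¬u (1-val 1))
            (subst (_< suc K) (sym (ℕₚ.+-identityʳ input)) (ℕₚ.m≤n⇒m≤1+n le))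
          go (no i≢1) = near-δ {δ = + X} e
            (At.near-cell i i< (suc K) c (lev i i<) true (+ X) 0 (+ X) (λ z → digit (rowXOf z) i)
              (λ o u → tri-δ {δ = 1ℤ} {δ′ = + X} {p = d true 0 i o} {q = d false 0 i u} (cg-sym e) (triX-at i i< o u))
              (sym (ℤₚ.*-identityˡ (+ X))) (cop-cancel (start-code-cop input i 1<kb i< i≢1))
              1ℤ 0 1ℤ refl (Val.¬u (1-val i)) (s≤s z≤n))
            where
            e : Cg (b i) (+ X) 1ℤ
            e = start-code≈1 input i 1<kb i< i≢1

        lit : Bool → ℕ → ℤ → Set
        lit σ s n = flag (rowOf σ 0 (c σ + n)) s

        -- The configuration (s , R) at time t is the number with b₀-adic valuation t and b₁₊ᵣ-adic valuation R r.
        expo : ℕ → Regs → ℕ → ℕ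
        expo t R zero    = t
        expo t R (suc r) = R r

        abstract
          num : (ℕ → ℕ) → ℤ
          num e = ∏ (λ i → b i ^ e i) kb

          num-val : ∀ e i → i < kb → Val i (num e) (e i)
          num-val e i i< = build (∏-split (λ i → b i ^ e i) kb i< (λ j j< j≢i → cop-^ (e j) (cop-β i j i< j< (j≢i ∘ sym))))
            where
            build : (∃ λ r → ∏ (λ i → b i ^ e i) kb ≡ b i ^ e i * r × Cop (b i) r) → Val i (num e) (e i)
            build (r , eq , cop) = mkVal r eq (∤-cop i cop)

          num-suc : ∀ e e′ i → i < kb → e′ i ≡ suc (e i) → (∀ j → j < kb → j ≢ i → e′ j ≡ e j) → num e′ ≡ b i * num e
          num-suc e e′ i i< p q = ∏-update {m = λ i → b i ^ e i} {m′ = λ i → b i ^ e′ i} (b i) kb i< (cong (b i ^_) p) (λ j j< j≢i → cong (b j ^_) (q j j< j≢i))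

          num-initial : num (expo 0 (proj₂ (initial input))) ≡ + X
          num-initial = trans (∏-update {m = λ _ → 1ℤ} {m′ = λ i → b i ^ expo 0 (proj₂ (initial input)) i} (+ X) kb {1} (s≤s 0<k) (trans (sym (start-code≡ input)) (sym (ℤₚ.*-identityʳ (+ X))))
              (λ { zero _ _ → refl ; (suc zero) _ h → ⊥-elim (h refl) ; (suc (suc j)) _ _ → refl }))
            (trans (cong (+ X *_) (all-ones kb)) (ℤₚ.*-identityʳ (+ X)))
            where
            all-ones : ∀ n → ∏ (λ _ → 1ℤ) n ≡ 1ℤ
            all-ones zero    = refl
            all-ones (suc n) = trans (ℤₚ.*-identityˡ _) (all-ones n)

        Below : (ℕ → ℕ) → Set
        Below e = ∀ i → i < kb → e i < K

        tick-at : ∀ s e n′ → s < nS → Below e → n′ ≡ b 0 * num e → lit true s (num e) → lit false s n′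
        tick-at s e n′ s< bd refl l =
          subst (λ v → flag v s) (along₀ false o w) (Rules.tick (rules false o w)
            (near-at false 2 (num e) (s≤s (s≤s (s≤s (s≤s z≤n)))) (λ i i< → e i , num-val e i i< , bd i i<))
            s s< (subst (λ v → flag v s) (sym (across₀ false o w)) l))
          where
          o = c false + b 0 * num e
          w = c true + num e

        op-at : ∀ σ o u {s op} → s < nS → code s ≡ op → OpRule s op (pt σ o u)
        op-at σ o u {s} s< cd = subst (λ op → OpRule s op (pt σ o u)) cd (Rules.ops (rules σ o u) s s<)

        inc-at : ∀ {s r s′} e n′ → s < nS → code s ≡ inc r s′ → r < k → Below e → n′ ≡ b (suc r) * num e →
                 lit false s (num e) → lit true s′ n′
        inc-at {s} {r} {s′} e n′ s< cd r< bd refl l =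
          subst (λ v → flag v s′) (along₀ true o w) (op-at true o w s< cd
            (near-at true (3 ℕ.+ r) (num e) (s≤s (s≤s (s≤s (s≤s r<)))) (λ i i< → e i , num-val e i i< , bd i i<))
            (subst (λ v → flag v s) (sym (across₀ true o w)) l))
          where
          o = c true + b (suc r) * num e
          w = c false + num e

        dec-at : ∀ {s r s′ s₀} e n′ → s < nS → code s ≡ dec r s′ s₀ → r < k → Below e → n′ ≡ b (suc r) * num e →
                 lit false s n′ → lit true s′ (num e)
        dec-at {s} {r} {s′} {s₀} e n′ s< cd r< bd refl l =
          subst (λ v → flag v s′) (across₀ false o w) (proj₁ (op-at false o w s< cd)
            (near-at false (3 ℕ.+ r) (num e) (s≤s (s≤s (s≤s (s≤s r<)))) (λ i i< → e i , num-val e i i< , bd i i<))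
            (subst (λ v → flag v s) (sym (along₀ false o w)) l))
          where
          o = c false + b (suc r) * num e
          w = c true + num e

        near₁ : ∀ e → Below e → Near false 1 (pt false (c false + num e) (c true + num e))
        near₁ e bd = subst (λ n → Near false 1 (pt false (c false + n) (c true + num e))) (ℤₚ.*-identityˡ (num e))
          (near-at false 0 (num e) (s≤s (s≤s z≤n)) (λ i i< → e i , num-val e i i< , bd i i<))

        zero-at : ∀ {s r s′ s₀} e → s < nS → code s ≡ dec r s′ s₀ → r < k → Below e → e (suc r) ≡ 0 →
                  lit false s (num e) → lit true s₀ (num e)
        zero-at {s} {r} {s′} {s₀} e s< cd r< bd e0 l =
          subst (λ v → flag v s₀) (across₀ false o w) (proj₂ (op-at false o w s< cd)
            (near₁ e bd) ¬ρ (subst (λ v → flag v s) (sym (along₀ false o w)) l))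
          where
          o = c false + num e
          w = c true + num e
          v = num-val e (suc r) (s≤s r<)
          ¬n : ¬ (b (suc r) ∣ num e)
          ¬n x = Val.¬u v (recast x (trans (Val.n≡ v) (trans (cong (λ z → b (suc r) ^ z * Val.u v) e0) (ℤₚ.*-identityˡ _))))
          ¬ρ : ¬ (b (suc r) ∣ ρ false (pt false o w))
          ¬ρ x = r∤ (suc r) (s≤s r<) false (num e) ¬n (subst (λ v → b (suc r) ∣ digit v kb) (along₀ false o w) x)

        jmp-at : ∀ {s s′} e → s < nS → code s ≡ jmp s′ → Below e → lit false s (num e) → lit true s′ (num e)
        jmp-at {s} {s′} e s< cd bd l =
          subst (λ v → flag v s′) (across₀ false o w) (op-at false o w s< cd
            (near₁ e bd) (subst (λ v → flag v s) (sym (along₀ false o w)) l))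
          where
          o = c false + num e
          w = c true + num e

        fail-at : ∀ {s} n → s < nS → code s ≡ fail → ¬ lit false s n
        fail-at {s} n s< cd l = op-at false (c false + n) 0ℤ s< cd (subst (λ v → flag v s) (sym (along₀ false (c false + n) 0ℤ)) l)

        start-at : input < K → lit true 0 (+ X)
        start-at le = subst (λ v → flag v 0) (trans (along₀ true o w) (cong (λ z → rowOf true 0 (c true + z)) (ℤₚ.*-identityʳ (+ X))))
          (Rules.start (rules true o w) (nearX-at le)
            (λ i i< x → r∤ i i< false 1ℤ (Val.¬u (1-val i)) (subst (λ v → b i ∣ digit v kb) (across₀ true o w) x)))
          where
          o = c true + + X * 1ℤ
          w = c false + 1ℤ

        -- The second alternative is needed because no rule passes a flag on from a `stop` state.
        Reach : ℕ → Config → Set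
        Reach t (s , R) = lit true s (num (expo t R)) ⊎ code s ≡ stop

        num-tick : ∀ t R → num (expo (suc t) R) ≡ b 0 * num (expo t R)
        num-tick t R = num-suc (expo t R) (expo (suc t) R) 0 (s≤s z≤n) refl λ { zero _ h → ⊥-elim (h refl) ; (suc j) _ _ → refl }

        num-upd : ∀ t R r v → r < k → v ≡ suc (R r) → num (expo t (upd R r v)) ≡ b (suc r) * num (expo t R)
        num-upd t R r v r< e = num-suc (expo t R) (expo t (upd R r v)) (suc r) (s≤s r<) (trans (upd-same R r v) e)
          λ { zero _ _ → refl ; (suc j) _ h → upd-other R r v j (h ∘ cong suc) }

        num-upd⁻ : ∀ t R r v → r < k → R r ≡ suc v → num (expo t R) ≡ b (suc r) * num (expo t (upd R r v))
        num-upd⁻ t R r v r< e = num-suc (expo t (upd R r v)) (expo t R) (suc r) (s≤s r<) (trans e (cong suc (sym (upd-same R r v))))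
          λ { zero _ _ → refl ; (suc j) _ h → sym (upd-other R r v j (h ∘ cong suc)) }

        below : ∀ {t R} → t < K → (∀ r → R r < K) → Below (expo t R)
        below t< R< zero    _ = t<
        below t< R< (suc i) _ = R< i

        alive : ∀ {s op} → code s ≡ op → op ≢ stop → s < nS
        alive cd h = ℕₚ.≰⇒> (λ le → h (trans (sym cd) (outside _ le)))

        ticked : ∀ {t s R op} → code s ≡ op → op ≢ stop → suc t < K → (∀ r → R r < K) → lit true s (num (expo t R)) → lit false s (num (expo (suc t) R))
        ticked {t} {s} {R} cd h t< R< l = tick-at s (expo t R) _ (alive cd h) (below (ℕₚ.<-trans (ℕₚ.n<1+n t) t<) R<) (num-tick t R) l

        -- The tick carries the flag from `x` at time `t` to `y` at time `t + 1`, with state and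
        -- registers still unchanged; the rule of the operation then carries it back to an `x` with
        -- the same time. For a successful `dec`, that `x` is the smaller number.
        one-step : ∀ t s R op → code s ≡ op → RegsBelow k op → suc t < K → (∀ r → R r < K) → (∀ r → proj₂ (exec op (s , R)) r < K) →
                   code s ≢ fail → Reach t (s , R) → Reach (suc t) (exec op (s , R))
        one-step t s R stop cd _ _ _ _ _ _ = inj₂ cd
        one-step t s R fail cd _ _ _ _ nf _ = ⊥-elim (nf cd)
        one-step t s R (inc r s′) cd r< t< R< _ nf (inj₂ x) = absurd (trans (sym cd) x)
          where absurd : ∀ {A : Set} → inc r s′ ≡ stop → A
                absurd ()
        one-step t s R (jmp s′) cd r< t< R< _ nf (inj₂ x) = absurd (trans (sym cd) x)
          where absurd : ∀ {A : Set} → jmp s′ ≡ stop → A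
                absurd ()
        one-step t s R (dec r s′ s₀) cd r< t< R< _ nf (inj₂ x) = absurd (trans (sym cd) x)
          where absurd : ∀ {A : Set} → dec r s′ s₀ ≡ stop → A
                absurd ()
        one-step t s R (inc r s′) cd r< t< R< _ nf (inj₁ l) =
          inj₁ (inc-at (expo (suc t) R) _ (alive cd (λ ())) cd r< (below t< R<) (num-upd (suc t) R r (suc (R r)) r< refl) (ticked cd (λ ()) t< R< l))
        one-step t s R (jmp s′) cd _ t< R< _ nf (inj₁ l) =
          inj₁ (jmp-at (expo (suc t) R) (alive cd (λ ())) cd (below t< R<) (ticked cd (λ ()) t< R< l))
        one-step t s R (dec r s′ s₀) cd r< t< R< R′< nf (inj₁ l) = go (R r) refl R′<
          where
          go : ∀ v → R r ≡ v → (∀ j → proj₂ (branch r s′ s₀ R v) j < K) → Reach (suc t) (branch r s′ s₀ R v)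
          go zero eq _ = inj₁ (zero-at (expo (suc t) R) (alive cd (λ ())) cd r< (below t< R<) eq (ticked cd (λ ()) t< R< l))
          go (suc v) eq R′< = inj₁ (dec-at (expo (suc t) (upd R r v)) _ (alive cd (λ ())) cd r< (below t< R′<)
            (num-upd⁻ (suc t) R r v r< eq) (ticked cd (λ ()) t< R< l))

        conf : ℕ → Config
        conf t = steps t (initial input)

        regs-≤ : ∀ t j → proj₂ (conf t) j ≤ t ℕ.+ input
        regs-≤ zero zero    = ℕₚ.≤-refl
        regs-≤ zero (suc j) = z≤n
        regs-≤ (suc t) = growth code (code (proj₁ (conf t))) (proj₁ (conf t)) (proj₂ (conf t)) (regs-≤ t)

        reach : ∀ t → t ℕ.+ suc input < K → (∀ t′ → t′ < t → code (proj₁ (conf t′)) ≢ fail) → Reach t (conf t)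
        reach zero    l nf = inj₁ (subst (lit true 0) (sym num-initial) (start-at (ℕₚ.<-trans (ℕₚ.n<1+n input) l)))
        reach (suc t) l nf = one-step t s R (code s) refl (regs s) (ℕₚ.≤-<-trans (ℕₚ.m≤m+n (suc t) (suc input)) l)
            (λ j → ℕₚ.≤-<-trans (regs-≤ t j) lt) (λ j → ℕₚ.≤-<-trans (regs-≤ (suc t) j) (ℕₚ.≤-<-trans (ℕₚ.+-monoʳ-≤ (suc t) (ℕₚ.n≤1+n input)) l))
            (nf t ℕₚ.≤-refl) (reach t (ℕₚ.<-trans (ℕₚ.n<1+n (t ℕ.+ suc input)) l) (λ t′ h → nf t′ (ℕₚ.m≤n⇒m≤1+n h)))
          where
          s = proj₁ (conf t)
          R = proj₂ (conf t)
          lt : t ℕ.+ input < K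
          lt = ℕₚ.≤-<-trans (ℕₚ.+-mono-≤ (ℕₚ.n≤1+n t) (ℕₚ.n≤1+n input)) l

        no-fail : ∀ t → suc t ℕ.+ suc input < K → Reach t (conf t) → code (proj₁ (conf t)) ≢ fail
        no-fail t l (inj₂ x) cd = absurd (trans (sym cd) x)
          where absurd : fail ≡ stop → ⊥
                absurd ()
        no-fail t l (inj₁ x) cd = fail-at (num (expo (suc t) R)) (alive cd (λ ())) cd
            (ticked cd (λ ()) (ℕₚ.≤-<-trans (ℕₚ.m≤m+n (suc t) (suc input)) l)
              (λ j → ℕₚ.≤-<-trans (regs-≤ t j) (ℕₚ.≤-<-trans (ℕₚ.+-mono-≤ (ℕₚ.n≤1+n t) (ℕₚ.n≤1+n input)) l)) x)
          where R = proj₂ (conf t)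

      never-fails : ∀ t → code (proj₁ (steps t (initial input))) ≢ fail
      never-fails t = upTo (suc t) ℕₚ.≤-refl t ℕₚ.≤-refl
        where
        -- Up to the tick following time `t`, the time is at most `t + 1` and the registers are at
        -- most `t + 1 + input`.
        open Centre (suc (suc (t ℕ.+ suc input)))
        -- Strong induction: following the run to a time already presupposes that it has not failed
        -- earlier.
        upTo : ∀ n → n ≤ suc t → ∀ t′ → t′ < n → code (proj₁ (conf t′)) ≢ fail
        upTo (suc n) (s≤s n≤t) t′ (s≤s t′≤n) = no-fail t′ (s≤s (s≤s (ℕₚ.+-monoˡ-≤ (suc input) t′≤t)))
          (reach t′ (ℕₚ.≤-<-trans (ℕₚ.+-monoˡ-≤ (suc input) t′≤t) (s≤s (ℕₚ.n≤1+n _))) (λ t″ h → upTo n (ℕₚ.m≤n⇒m≤1+n n≤t) t″ (ℕₚ.<-≤-trans h t′≤n)))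
          where t′≤t = ℕₚ.≤-trans t′≤n n≤t

-- From a run that never fails to a tiling: the intended solution centred at the origin.

module Sufficiency where

  open import Defs using (Regs; upd; initial; TilingProblem)
  open Arithmetic
  open Digits using (%-cg; module Digit)
  open LocalRules renaming (Tri to DTri)
  open import Data.Nat as ℕ using (ℕ; zero; suc; z≤n; s≤s; _<_; _≤_)
  import Data.Nat.Properties as ℕₚ
  open import Data.Integer using (ℤ; +_; _+_; _-_; _*_; -_; 0ℤ; 1ℤ; _≟_)
  open import Data.Integer.Base using (_%ℕ_)
  open import Data.Integer.DivMod using (n%ℕd<d)
  import Data.Integer.Properties as ℤₚ
  open import Data.Integer.Divisibility.Signed
  open import Data.Integer.Tactic.RingSolver using (solve-∀)
  open import Data.Bool using (Bool; true; false; not)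
  open import Data.List.Membership.Propositional using (_∈_)
  open import Data.List.Membership.Propositional.Properties
  open import Data.Product using (∃; _×_; _,_; proj₁; proj₂)
  open import Data.Sum using (_⊎_; inj₁; inj₂)
  open import Data.Unit using (tt)
  open import Data.Empty using (⊥; ⊥-elim)
  open import Function using (_∘_)
  open import Relation.Nullary using (¬_; Dec; yes; no)
  open import Relation.Nullary.Decidable using (_×-dec_; ¬?)
  open import Relation.Binary.Definitions using (Tri; tri<; tri≈; tri>)
  open import Relation.Binary.PropositionalEquality

  open Cg

  bit : ∀ {A : Set} → Dec A → ℕ
  bit (yes _) = 1
  bit (no _)  = 0

  bit≤1 : ∀ {A : Set} (a : Dec A) → bit a ≤ 1
  bit≤1 (yes _) = s≤s z≤n
  bit≤1 (no _)  = z≤n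

  bit⁻ : ∀ {A : Set} (a : Dec A) → bit a ≡ 1 → A
  bit⁻ (yes a) _ = a

  bit⁺ : ∀ {A : Set} (a : Dec A) → A → bit a ≡ 1
  bit⁺ (yes _) _ = refl
  bit⁺ (no ¬a) a = ⊥-elim (¬a a)

  trisect : ∀ {A : Set} {i j : ℕ} → A → A → A → Tri (i < j) (i ≡ j) (j < i) → A
  trisect a b c (tri< _ _ _) = a
  trisect a b c (tri≈ _ _ _) = b
  trisect a b c (tri> _ _ _) = c

  module HasTiling (k nS : ℕ) (code : ℕ → Op) (0<k : 0 < k) (regs : ∀ s → RegsBelow k (code s)) (input : ℕ) where

    open Local k nS code
    open Machine code
    open Sampling.Problem ωs B′ clock bound hiding (B)

    X : ℕ
    X = start-code input

    open Periodic (pers X) (bounded X) clock-bounded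

    dig val : ℕ → ℤ → ℕ
    dig i = Digit.dig (β i) (1<β i)
    val i = Digit.val (β i) (1<β i)

    conf : ℕ → Config
    conf t = steps t (initial input)

    st : ℕ → ℕ
    st t = proj₁ (conf t)

    reg : ℕ → Regs
    reg t = proj₂ (conf t)

    Codes : ℕ → ℕ → ℤ → Set
    Codes t s w = w ≢ 0ℤ × st t ≡ s × (∀ r → r < k → val (suc r) w ≡ reg t r)

    codes? : ∀ t s w → Dec (Codes t s w)
    codes? t s w = ¬? (w ≟ 0ℤ) ×-dec ((st t ℕₚ.≟ s) ×-dec all<? k (λ r → val (suc r) w ℕₚ.≟ reg t r))

    -- On `y` the time has been advanced but the operation not yet executed, so its state and
    -- registers are those of the preceding time.
    Q : Bool → ℕ → ℤ → Set
    Q true  s w = Codes (val 0 w) s w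
    Q false s w = 0 < val 0 w × Codes (ℕ.pred (val 0 w)) s w

    Q? : ∀ σ s w → Dec (Q σ s w)
    Q? true  s w = codes? (val 0 w) s w
    Q? false s w = (0 ℕₚ.<? val 0 w) ×-dec codes? (ℕ.pred (val 0 w)) s w

    entry : Bool → ℤ → ℕ → ℕ
    entry σ w i = trisect (dig i w) (w %ℕ suc B′) (bit (Q? σ (i ℕ.∸ suc kb) w)) (ℕₚ.<-cmp i kb)

    entry-dig : ∀ σ w i → i < kb → entry σ w i ≡ dig i w
    entry-dig σ w i l = go (ℕₚ.<-cmp i kb)
      where go : (t : Tri (i < kb) (i ≡ kb) (kb < i)) → trisect (dig i w) (w %ℕ suc B′) (bit (Q? σ (i ℕ.∸ suc kb) w)) t ≡ dig i w
            go (tri< _ _ _) = refl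
            go (tri≈ ¬l _ _) = ⊥-elim (¬l l)
            go (tri> ¬l _ _) = ⊥-elim (¬l l)

    entry-ρ : ∀ σ w → entry σ w kb ≡ w %ℕ suc B′
    entry-ρ σ w = go (ℕₚ.<-cmp kb kb)
      where go : (t : Tri (kb < kb) (kb ≡ kb) (kb < kb)) → trisect (dig kb w) (w %ℕ suc B′) (bit (Q? σ (kb ℕ.∸ suc kb) w)) t ≡ w %ℕ suc B′
            go (tri< _ ¬e _) = ⊥-elim (¬e refl)
            go (tri≈ _ _ _) = refl
            go (tri> _ ¬e _) = ⊥-elim (¬e refl)

    entry-flag : ∀ σ w s → entry σ w (suc kb ℕ.+ s) ≡ bit (Q? σ s w)
    entry-flag σ w s = go (ℕₚ.<-cmp (suc kb ℕ.+ s) kb)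
      where
      gt : kb < suc kb ℕ.+ s
      gt = s≤s (ℕₚ.m≤m+n kb s)
      go : (t : Tri (suc kb ℕ.+ s < kb) (suc kb ℕ.+ s ≡ kb) (kb < suc kb ℕ.+ s)) →
           trisect (dig (suc kb ℕ.+ s) w) (w %ℕ suc B′) (bit (Q? σ (suc kb ℕ.+ s ℕ.∸ suc kb) w)) t ≡ bit (Q? σ s w)
      go (tri< _ _ ¬g) = ⊥-elim (¬g gt)
      go (tri≈ _ _ ¬g) = ⊥-elim (¬g gt)
      go (tri> _ _ _) = cong (λ s → bit (Q? σ s w)) (ℕₚ.m+n∸m≡n (suc kb) s)

    entry-< : ∀ σ w i → entry σ w i < suc wd
    entry-< σ w i = go (ℕₚ.<-cmp i kb)
      where
      go : (t : Tri (i < kb) (i ≡ kb) (kb < i)) → trisect (dig i w) (w %ℕ suc B′) (bit (Q? σ (i ℕ.∸ suc kb) w)) t < suc wd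
      go (tri< l _ _) = ℕₚ.m≤n⇒m≤1+n (ℕₚ.<-≤-trans (Digit.dig<b (β i) (1<β i) w) (β≤B i l))
      go (tri≈ _ _ _) = ℕₚ.m≤n⇒m≤1+n (n%ℕd<d w (suc B′))
      go (tri> _ _ _) = s≤s (ℕₚ.≤-trans (bit≤1 (Q? σ (i ℕ.∸ suc kb) w)) (s≤s z≤n))

    rowFn : Bool → ℤ → Row
    rowFn σ w = tab (entry σ w) L

    own : Bool → ℤ → ℤ → ℤ
    own false x y = y
    own true  x y = x

    φ : ℤ → ℤ → W
    φ x y = rowFn true (x + + X * y) , tab (λ a → rowFn false (y + mult a * x)) (suc nF) , tab (λ a → rowFn true (x + mult a * y)) (suc nF)

    row-φ : ∀ σ a x y → a < suc nF → row σ a (φ x y) ≡ rowFn σ (own σ x y + mult a * own (not σ) x y)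
    row-φ false a x y l = get-tab (λ a → rowFn false (y + mult a * x)) (suc nF) l
    row-φ true  a x y l = get-tab (λ a → rowFn true (x + mult a * y)) (suc nF) l

    row-φ₀ : ∀ σ x y → row σ 0 (φ x y) ≡ rowFn σ (own σ x y)
    row-φ₀ σ x y = trans (row-φ σ 0 x y (s≤s z≤n)) (cong (rowFn σ) (eq (own σ x y) (own (not σ) x y)))
      where eq : ∀ o u → o + 0ℤ * u ≡ o
            eq = solve-∀

    digit-row : ∀ σ w i → i < kb → digit (rowFn σ w) i ≡ + dig i w
    digit-row σ w i l = cong +_ (trans (get-tab (entry σ w) L (ℕₚ.≤-trans l (ℕₚ.m≤n⇒m≤1+n (ℕₚ.m≤m+n kb nS)))) (entry-dig σ w i l))

    ρ-row : ∀ σ w → digit (rowFn σ w) kb ≡ + (w %ℕ suc B′)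
    ρ-row σ w = cong +_ (trans (get-tab (entry σ w) L (s≤s (ℕₚ.m≤m+n kb nS))) (entry-ρ σ w))

    flag-row : ∀ σ w s → s < nS → get 0 (rowFn σ w) (suc kb ℕ.+ s) ≡ bit (Q? σ s w)
    flag-row σ w s l = trans (get-tab (entry σ w) L (s≤s (ℕₚ.+-monoʳ-< kb l))) (entry-flag σ w s)

    D-φ : ∀ σ a i x y → a < suc nF → i < kb → D σ a i (φ x y) ≡ + dig i (own σ x y + mult a * own (not σ) x y)
    D-φ σ a i x y a< i< = trans (cong (λ v → digit v i) (row-φ σ a x y a<)) (digit-row σ _ i i<)

    D-φ₀ : ∀ σ i x y → i < kb → D σ 0 i (φ x y) ≡ + dig i (own σ x y)
    D-φ₀ σ i x y i< = trans (cong (λ v → digit v i) (row-φ₀ σ x y)) (digit-row σ _ i i<)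

    ρ-φ : ∀ σ x y → ρ σ (φ x y) ≡ + (own σ x y %ℕ suc B′)
    ρ-φ σ x y = trans (cong (λ v → digit v kb) (row-φ₀ σ x y)) (ρ-row σ _)

    ρ≈ : ∀ σ x y i → i < kb → Cg (b i) (ρ σ (φ x y)) (own σ x y)
    ρ≈ σ x y i i< = cg (∣-trans (β∣B i i<) (dvd (cg-trans (cg-reflexive (ρ-φ σ x y)) (%-cg (own σ x y) (suc B′)))))

    on⇒ : ∀ σ s x y → s < nS → On σ s (φ x y) → Q σ s (own σ x y)
    on⇒ σ s x y l h = bit⁻ (Q? σ s _) (trans (sym (flag-row σ _ s l)) (trans (cong (λ v → get 0 v (suc kb ℕ.+ s)) (sym (row-φ₀ σ x y))) (h l)))

    on⇐ : ∀ σ s x y → Q σ s (own σ x y) → On σ s (φ x y)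
    on⇐ σ s x y q l = trans (cong (λ v → get 0 v (suc kb ℕ.+ s)) (row-φ₀ σ x y)) (trans (flag-row σ _ s l) (bit⁺ (Q? σ s _) q))

    module Dg (i : ℕ) = Digit (β i) (1<β i)

    1<kb : 1 < kb
    1<kb = s≤s 0<k

    can1 : ∀ {b x} → b ∣ 1ℤ * x → b ∣ x
    can1 {x = x} q = recast q (ℤₚ.*-identityˡ x)

    V-1 : ∀ i → Dg.V i 1ℤ 0 1ℤ
    V-1 i = Dg.mkV {i} refl (∤1 i)

    V-β : ∀ i → Dg.V i (b i) 1 1ℤ
    V-β i = Dg.V-b i (2-cancel i)

    V-other : ∀ i r → i < kb → r < kb → r ≢ i → Dg.V i (b r) 0 (b r)
    V-other i r i< r< h = Dg.mkV {i} (sym (ℤₚ.*-identityˡ (b r))) (∤-cop i (cop-β i r i< r< (h ∘ sym)))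

    can-other : ∀ i r → i < kb → r < kb → r ≢ i → ∀ {x} → b i ∣ b r * x → b i ∣ x
    can-other i r i< r< h = cop-cancel (cop-β i r i< r< (h ∘ sym))

    multV : ∀ a i → suc a < suc nF → i < kb → ∃ λ e → Dg.V i (mult (suc a)) e (δ (suc a) i) × (∀ {x} → b i ∣ δ (suc a) i * x → b i ∣ x)
    multV 0 i _ _ = 0 , V-1 i , can1
    multV 1 i _ _ = 0 , Dg.V-2 i (2-cancel i) , 2-cancel i
    multV (suc (suc r)) i (s≤s (s≤s (s≤s r<))) i< = go (r ℕₚ.≟ i)
      where
      go : (p : Dec (r ≡ i)) → ∃ λ e → Dg.V i (b r) e (δ′ r p) × (∀ {x} → b i ∣ δ′ r p * x → b i ∣ x)
      go (yes refl) = 1 , V-β i , can1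
      go (no r≢i)   = 0 , V-other i r i< r< r≢i , can-other i r i< r< r≢i

    dig-mult : ∀ a i w → suc a < suc nF → i < kb → Cg (b i) (+ dig i (mult (suc a) * w)) (δ (suc a) i * + dig i w)
    dig-mult a i w a< i< = go (multV a i a< i<)
      where go : (∃ λ e → Dg.V i (mult (suc a)) e (δ (suc a) i) × (∀ {x} → b i ∣ δ (suc a) i * x → b i ∣ x)) → _
            go (e , v , can) = Dg.dig-* i w v can

    tri-φ : ∀ b δ p q m d₁ d₂ d₃ → d₁ ≡ p → d₂ ≡ q → d₃ ≡ m → DTri b δ p q m → DTri b δ d₁ d₂ d₃
    tri-φ b δ p q m _ _ _ refl refl refl t = t

    tri-digits : ∀ i δ {o q u} → Cg (b i) (+ dig i q) (δ * + dig i u) → DTri (b i) δ (+ dig i o) (+ dig i u) (+ dig i (o + q))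
    tri-digits i δ {o} {q} {u} e ¬d = conv (Dg.digit-of-sum i o q (λ x → ¬d (cg-∣ (cg-+ (cg-refl {u = + dig i o}) (cg-sym e)) x)))
      where
      conv : ∀ {m} → Cg (b i) m (+ dig i o) ⊎ Cg (b i) m (+ dig i q) ⊎ Cg (b i) m (+ dig i o + + dig i q) →
             Cg (b i) m (+ dig i o) ⊎ Cg (b i) m (δ * + dig i u) ⊎ Cg (b i) m (+ dig i o + δ * + dig i u)
      conv (inj₁ x)        = inj₁ x
      conv (inj₂ (inj₁ x)) = inj₂ (inj₁ (cg-trans x e))
      conv (inj₂ (inj₂ x)) = inj₂ (inj₂ (cg-trans x (cg-+ (cg-refl {u = + dig i o}) e)))

    V-X : Dg.V 1 (+ X) input 1ℤ
    V-X = Dg.mkV {1} (trans (start-code≡ input) (sym (ℤₚ.*-identityʳ _))) (∤1 1)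

    V-X′ : ∀ i → i < kb → i ≢ 1 → Dg.V i (+ X) 0 (+ X)
    V-X′ i i< h = Dg.mkV {i} (sym (ℤₚ.*-identityˡ (+ X))) (∤-cop i (start-code-cop input i 1<kb i< h))

    can-X′ : ∀ i → i < kb → i ≢ 1 → ∀ {x} → b i ∣ + X * x → b i ∣ x
    can-X′ i i< h = cop-cancel (start-code-cop input i 1<kb i< h)

    dig-X : ∀ i w → i < kb → Cg (b i) (+ dig i (+ X * w)) (1ℤ * + dig i w)
    dig-X i w i< = go (i ℕₚ.≟ 1)
      where
      go : Dec (i ≡ 1) → Cg (b i) (+ dig i (+ X * w)) (1ℤ * + dig i w)
      go (yes refl) = Dg.dig-* 1 w V-X can1
      go (no h) = cg-trans (Dg.dig-* i w (V-X′ i i< h) (can-X′ i i< h)) (subst₂ (Cg (b i)) (ℤₚ.*-comm (+ dig i w) (+ X)) (ℤₚ.*-comm (+ dig i w) 1ℤ)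
                    (cg-*ˡ (+ dig i w) (start-code≈1 input i 1<kb i< h)))

    near-digits : ∀ i δ {o q u} → Cg (b i) (+ dig i q) (δ * + dig i u) → q ≢ 0ℤ →
      near (b i) δ (+ dig i o) (+ dig i u) (+ dig i (o + q)) → o ≢ 0ℤ × val i o ≡ val i q
    near-digits i δ {o} {q} {u} e q0 (e₁ , e₂) = Dg.near-val i q0 (cg-trans e₁ (cg-sym e)) (cg-trans e₂ (cg-*ˡ (+ 2) (cg-sym e)))

    near-φ : ∀ σ a x y → suc a < suc nF → Near σ (suc a) (φ x y) → ∀ i → i < kb →
      near (b i) (δ (suc a) i) (+ dig i (own σ x y)) (+ dig i (own (not σ) x y)) (+ dig i (own σ x y + mult (suc a) * own (not σ) x y))
    near-φ σ a x y a< h i i< = subst₂ (λ p q → near (b i) (δ (suc a) i) p q (+ dig i (own σ x y + mult (suc a) * own (not σ) x y)))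
      (D-φ₀ σ i x y i<) (D-φ₀ (not σ) i x y i<)
      (subst (near (b i) (δ (suc a) i) (D σ 0 i (φ x y)) (D (not σ) 0 i (φ x y))) (D-φ σ (suc a) i x y a< i<) (h i i<))

    mult≢0 : ∀ a {w} → suc a < suc nF → w ≢ 0ℤ → mult (suc a) * w ≢ 0ℤ
    mult≢0 a a< w0 = go (multV a 0 a< (s≤s z≤n))
      where go : (∃ λ e → Dg.V 0 (mult (suc a)) e (δ (suc a) 0) × (∀ {x} → b 0 ∣ δ (suc a) 0 * x → b 0 ∣ x)) → _
            go (e , v , can) = Dg.V-≢0 0 (Dg.V-* 0 v can (Dg.V-unit 0 w0))

    near-val : ∀ σ a x y → suc a < suc nF → Near σ (suc a) (φ x y) → own (not σ) x y ≢ 0ℤ →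
      own σ x y ≢ 0ℤ × (∀ i → i < kb → val i (own σ x y) ≡ val i (mult (suc a) * own (not σ) x y))
    near-val σ a x y a< h u0 = proj₁ (at 0 (s≤s z≤n)) , λ i i< → proj₂ (at i i<)
      where
      at : ∀ i → i < kb → own σ x y ≢ 0ℤ × val i (own σ x y) ≡ val i (mult (suc a) * own (not σ) x y)
      at i i< = near-digits i (δ (suc a) i) {own σ x y} {mult (suc a) * own (not σ) x y} {own (not σ) x y} (dig-mult a i (own (not σ) x y) a< i<) (mult≢0 a a< u0) (near-φ σ a x y a< h i i<)

    -- Nearness equates the digit of the own form with a multiple of the digit of the other; the
    -- latter is 0 at 0, the former is not divisible by the base.
    near-other : ∀ σ a x y → suc a < suc nF → Near σ (suc a) (φ x y) → own σ x y ≢ 0ℤ → own (not σ) x y ≢ 0ℤ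
    near-other σ a x y a< h o0 u0 = Dg.dig-∤ 0 o0 (cg-∣ (proj₁ (near-φ σ a x y a< h 0 (s≤s z≤n)))
      (∣n⇒∣m*n (δ (suc a) 0) (subst (λ u → b 0 ∣ + dig 0 u) (sym u0) (subst (λ z → b 0 ∣ + z) (sym (Dg.dig-0 0)) (divides 0ℤ refl)))))

    val-1 : ∀ i w → val i (1ℤ * w) ≡ val i w
    val-1 i w = cong (val i) (ℤₚ.*-identityˡ w)

    val-same : ∀ i w → w ≢ 0ℤ → val i (b i * w) ≡ suc (val i w)
    val-same i w w0 = Dg.val-* i (V-β i) can1 w0

    val-other : ∀ i r w → i < kb → r < kb → r ≢ i → w ≢ 0ℤ → val i (b r * w) ≡ val i w
    val-other i r w i< r< h w0 = Dg.val-* i (V-other i r i< r< h) (can-other i r i< r< h) w0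

    nearX-φ : ∀ x y → NearX (φ x y) → ∀ i → i < kb → near (b i) 1ℤ (+ dig i x) (+ dig i y) (+ dig i (x + + X * y))
    nearX-φ x y h i i< = subst₂ (λ p q → near (b i) 1ℤ p q (+ dig i (x + + X * y))) (D-φ₀ true i x y i<) (D-φ₀ false i x y i<)
      (subst (near (b i) 1ℤ (D true 0 i (φ x y)) (D false 0 i (φ x y))) (digit-row true (x + + X * y) i i<) (h i i<))

    module _ (no-fail : ∀ t → code (st t) ≢ fail) (x y : ℤ) where

      private
        ω : W
        ω = φ x y

      -- All valuations of `y` vanish, so those of `x` agree with those of `X`: `input` in base 1
      -- and 0 elsewhere, including the base that counts time.
      start-φ : NearX ω → (∀ i → i < kb → ¬ (b i ∣ ρ false ω)) → On true 0 ω
      start-φ h ¬ρ = on⇐ true 0 x y (subst (λ t → Codes t 0 x) (sym val₀) (proj₁ (at 0 (s≤s z≤n)) , refl , vals))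
        where
        ¬y : ∀ i → i < kb → ¬ (b i ∣ y)
        ¬y i i< d = ¬ρ i i< (cg-∣ (ρ≈ false x y i i<) d)
        y0 : y ≢ 0ℤ
        y0 e = ¬y 0 (s≤s z≤n) (subst (b 0 ∣_) (sym e) (divides 0ℤ refl))
        val-y : ∀ i → i < kb → val i y ≡ 0
        val-y i i< = Dg.V-val i (Dg.mkV {i} (sym (ℤₚ.*-identityˡ y)) (¬y i i<))
        Xy0 : + X * y ≢ 0ℤ
        Xy0 = Dg.V-≢0 1 (Dg.V-* 1 V-X can1 (Dg.V-unit 1 y0))
        at : ∀ i → i < kb → x ≢ 0ℤ × val i x ≡ val i (+ X * y)
        at i i< = near-digits i 1ℤ {x} {+ X * y} {y} (dig-X i y i<) Xy0 (nearX-φ x y h i i<)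
        val-X′ : ∀ i → i < kb → i ≢ 1 → val i (+ X * y) ≡ 0
        val-X′ i i< h = trans (Dg.val-* i (V-X′ i i< h) (can-X′ i i< h) y0) (val-y i i<)
        val₀ : val 0 x ≡ 0
        val₀ = trans (proj₂ (at 0 (s≤s z≤n))) (val-X′ 0 (s≤s z≤n) (λ ()))
        vals : ∀ r → r < k → val (suc r) x ≡ reg 0 r
        vals zero r< = trans (proj₂ (at 1 (s≤s r<))) (trans (Dg.val-* 1 V-X can1 y0) (trans (cong (input ℕ.+_) (val-y 1 (s≤s r<))) (ℕₚ.+-identityʳ input)))
        vals (suc r) r< = trans (proj₂ (at (suc (suc r)) (s≤s r<))) (val-X′ (suc (suc r)) (s≤s r<) (λ ()))

      tick-φ : Near false 3 ω → ∀ s → s < nS → On true s ω → On false s ω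
      tick-φ h s s< on = go (on⇒ true s x y s< on)
        where
        go : Codes (val 0 x) s x → On false s ω
        go (x0 , e , vals) = on⇐ false s x y (subst (0 <_) (sym v0) (s≤s z≤n) ,
            subst (λ t → Codes t s y) (sym (cong ℕ.pred v0)) (proj₁ nv , e , λ r r< → trans (vs r r<) (vals r r<)))
          where
          nv : y ≢ 0ℤ × (∀ i → i < kb → val i y ≡ val i (b 0 * x))
          nv = near-val false 2 x y (s≤s (s≤s (s≤s (s≤s z≤n)))) h x0
          v0 : val 0 y ≡ suc (val 0 x)
          v0 = trans (proj₂ nv 0 (s≤s z≤n)) (val-same 0 x x0)
          vs : ∀ r → r < k → val (suc r) y ≡ val (suc r) x
          vs r r< = trans (proj₂ nv (suc r) (s≤s r<)) (val-other (suc r) 0 x (s≤s r<) (s≤s z≤n) (λ ()) x0)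

      Before : ℕ → ℕ → Set
      Before t s = val 0 y ≡ suc t × Codes t s y

      before : ∀ s → s < nS → On false s ω → ∃ λ t → Before t s
      before s s< on = go (val 0 y) refl (on⇒ false s x y s< on)
        where
        go : ∀ v → val 0 y ≡ v → Q false s y → ∃ λ t → Before t s
        go zero    e (l , _) = ⊥-elim (ℕₚ.<-irrefl (sym e) l)
        go (suc t) e (_ , c) = t , e , subst (λ v → Codes (ℕ.pred v) s y) e c

      after : ∀ t s op → code s ≡ op → st t ≡ s → conf (suc t) ≡ Machine.exec code op (conf t)
      after t s op cd e = cong (λ o → Machine.exec code o (conf t)) (trans (cong code e) cd)

      conclude : ∀ t s′ R → conf (suc t) ≡ (s′ , R) → x ≢ 0ℤ → val 0 x ≡ suc t → (∀ r → r < k → val (suc r) x ≡ R r) → On true s′ ω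
      conclude t s′ R e x0 v0 vs = on⇐ true s′ x y (subst (λ t → Codes t s′ x) (sym v0)
        (x0 , cong proj₁ e , λ r r< → trans (vs r r<) (cong (λ c → proj₂ c r) (sym e))))

      upd-vals : ∀ {R : Regs} r v (f : ℕ → ℕ) → f r ≡ v → (∀ j → j < k → j ≢ r → f j ≡ R j) → ∀ j → j < k → f j ≡ upd R r v j
      upd-vals {R} r v f e h j j< = go (j ℕₚ.≟ r)
        where go : Dec (j ≡ r) → f j ≡ upd R r v j
              go (yes refl) = trans e (sym (upd-same R j v))
              go (no j≢r) = trans (h j j< j≢r) (sym (upd-other R r v j j≢r))

      same-vals : Near false 1 ω → y ≢ 0ℤ → x ≢ 0ℤ × (∀ i → i < kb → val i y ≡ val i x)
      same-vals h y0 = x0 , λ i i< → trans (proj₂ (near-val false 0 x y (s≤s (s≤s z≤n)) h x0) i i<) (val-1 i x)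
        where x0 = near-other false 0 x y (s≤s (s≤s z≤n)) h y0

      -- Nearness transfers valuations exactly, so a flag on `y` before the operation gives the
      -- valuations on `x` after it. The `fail` rule is the only one that uses that the run does not
      -- fail.
      op-φ : ∀ s → s < nS → ∀ op → code s ≡ op → RegsBelow k op → OpRule s op ω
      op-φ s s< stop cd _ = tt
      op-φ s s< fail cd _ on = go (before s s< on)
        where go : (∃ λ t → Before t s) → ⊥
              go (t , _ , _ , e , _) = no-fail t (trans (cong code e) cd)
      op-φ s s< (jmp s′) cd _ h on = go (before s s< on)
        where
        go : (∃ λ t → Before t s) → On true s′ ω
        go (t , v0 , y0 , e , vs) = conclude t s′ (reg t) (after t s (jmp s′) cd e) (proj₁ sv)
            (trans (sym (proj₂ sv 0 (s≤s z≤n))) v0) (λ r r< → trans (sym (proj₂ sv (suc r) (s≤s r<))) (vs r r<))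
          where sv = same-vals h y0
      op-φ s s< (inc r s′) cd r<k h on = go (before s s< on)
        where
        a< : 4 ℕ.+ r < suc nF
        a< = s≤s (s≤s (s≤s (s≤s r<k)))
        go : (∃ λ t → Before t s) → On true s′ ω
        go (t , v0 , y0 , e , vs) = conclude t s′ (upd (reg t) r (suc (reg t r))) (after t s (inc r s′) cd e) (proj₁ nv)
            (trans (proj₂ nv 0 (s≤s z≤n)) (trans (val-other 0 (suc r) y (s≤s z≤n) (s≤s r<k) (λ ()) y0) v0))
            (upd-vals r (suc (reg t r)) (λ j → val (suc j) x)
              (trans (proj₂ nv (suc r) (s≤s r<k)) (trans (val-same (suc r) y y0) (cong suc (vs r r<k))))
              (λ j j< j≢r → trans (proj₂ nv (suc j) (s≤s j<)) (trans (val-other (suc j) (suc r) y (s≤s j<) (s≤s r<k) (j≢r ∘ sym ∘ ℕₚ.suc-injective) y0) (vs j j<))))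
          where
          nv : x ≢ 0ℤ × (∀ i → i < kb → val i x ≡ val i (b (suc r) * y))
          nv = near-val true (3 ℕ.+ r) x y a< h y0
      op-φ s s< (dec r s′ s₀) cd r<k = (λ h on → go h (before s s< on)) , (λ h ¬ρ on → go₀ h ¬ρ (before s s< on))
        where
        a< : 4 ℕ.+ r < suc nF
        a< = s≤s (s≤s (s≤s (s≤s r<k)))
        go : Near false (4 ℕ.+ r) ω → (∃ λ t → Before t s) → On true s′ ω
        go h (t , v0 , y0 , e , vs) = conclude t s′ (upd (reg t) r (val (suc r) x))
            (trans (after t s (dec r s′ s₀) cd e) (cong (Machine.branch code r s′ s₀ (reg t)) v≡)) x0
            (trans (sym (trans (proj₂ nv 0 (s≤s z≤n)) (val-other 0 (suc r) x (s≤s z≤n) (s≤s r<k) (λ ()) x0))) v0)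
            (upd-vals r (val (suc r) x) (λ j → val (suc j) x) refl
              (λ j j< j≢r → trans (sym (trans (proj₂ nv (suc j) (s≤s j<)) (val-other (suc j) (suc r) x (s≤s j<) (s≤s r<k) (j≢r ∘ sym ∘ ℕₚ.suc-injective) x0))) (vs j j<)))
          where
          x0 : x ≢ 0ℤ
          x0 = near-other false (3 ℕ.+ r) x y a< h y0
          nv : y ≢ 0ℤ × (∀ i → i < kb → val i y ≡ val i (b (suc r) * x))
          nv = near-val false (3 ℕ.+ r) x y a< h x0
          -- As `y` is near `b (suc r) * x`, the register is positive, so the machine takes the
          -- decrementing branch.
          v≡ : reg t r ≡ suc (val (suc r) x)
          v≡ = trans (sym (vs r r<k)) (trans (proj₂ nv (suc r) (s≤s r<k)) (val-same (suc r) x x0))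
        go₀ : Near false 1 ω → ¬ (b (suc r) ∣ ρ false ω) → (∃ λ t → Before t s) → On true s₀ ω
        go₀ h ¬ρ (t , v0 , y0 , e , vs) = conclude t s₀ (reg t)
            (trans (after t s (dec r s′ s₀) cd e) (cong (Machine.branch code r s′ s₀ (reg t)) v≡)) (proj₁ sv)
            (trans (sym (proj₂ sv 0 (s≤s z≤n))) v0) (λ j j< → trans (sym (proj₂ sv (suc j) (s≤s j<))) (vs j j<))
          where
          sv = same-vals h y0
          v≡ : reg t r ≡ 0
          v≡ = trans (sym (vs r r<k)) (Dg.V-val (suc r) (Dg.mkV {suc r} (sym (ℤₚ.*-identityˡ y)) (λ d → ¬ρ (cg-∣ (ρ≈ false x y (suc r) (s≤s r<k)) d))))

      rules-φ : Rules ω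
      rules-φ = mkRules additive lowest tri triX scale start-φ tick-φ (λ s s< → op-φ s s< (code s) refl (regs s))
        where
        additive : Cg (+ suc B′) (ρ₊ ω) (ρ false ω + ρ true ω)
        additive = cg-trans (cg-reflexive (trans (cong (λ v → digit v kb) (row-φ false 1 x y (s≤s (s≤s z≤n)))) (ρ-row false (y + 1ℤ * x))))
          (cg-trans (%-cg (y + 1ℤ * x) (suc B′)) (cg-trans (cg-reflexive (cong (_+_ y) (ℤₚ.*-identityˡ x)))
            (cg-sym (cg-+ (cg-trans (cg-reflexive (ρ-φ false x y)) (%-cg y (suc B′))) (cg-trans (cg-reflexive (ρ-φ true x y)) (%-cg x (suc B′)))))))
        lowest : ∀ σ i → i < kb → ¬ (b i ∣ ρ σ ω) → Cg (b i) (D σ 0 i ω) (ρ σ ω)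
        lowest σ i i< ¬d = cg-trans (cg-reflexive (D-φ₀ σ i x y i<))
          (cg-trans (Dg.V-dig i {a = 0} (Dg.mkV {i} (sym (ℤₚ.*-identityˡ (own σ x y))) (λ d → ¬d (cg-∣ (ρ≈ σ x y i i<) d)))) (cg-sym (ρ≈ σ x y i i<)))
        tri : ∀ σ i → i < kb → ∀ a → a < nF → DTri (b i) (δ (suc a) i) (D σ 0 i ω) (D (not σ) 0 i ω) (D σ (suc a) i ω)
        tri σ i i< a a< = tri-φ (b i) (δ (suc a) i) (+ dig i o) (+ dig i u) (+ dig i (o + mult (suc a) * u)) (D σ 0 i ω) (D (not σ) 0 i ω) (D σ (suc a) i ω) (D-φ₀ σ i x y i<) (D-φ₀ (not σ) i x y i<) (D-φ σ (suc a) i x y (s≤s a<) i<)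
          (tri-digits i (δ (suc a) i) {o} {mult (suc a) * u} {u} (dig-mult a i u (s≤s a<) i<))
          where
          o = own σ x y
          u = own (not σ) x y
        triX : ∀ i → i < kb → DTri (b i) 1ℤ (D true 0 i ω) (D false 0 i ω) (digit (rowX ω) i)
        triX i i< = tri-φ (b i) 1ℤ (+ dig i x) (+ dig i y) (+ dig i (x + + X * y)) (D true 0 i ω) (D false 0 i ω) (digit (rowX ω) i) (D-φ₀ true i x y i<) (D-φ₀ false i x y i<) (digit-row true (x + + X * y) i i<)
          (tri-digits i 1ℤ {x} {+ X * y} {y} (dig-X i y i<))
        scale : ∀ σ i → i < kb → Scale (b i) (D σ 0 i ω) (D (not σ) 0 i ω) (D σ 1 i ω) (D σ 2 i ω) (D σ (3 ℕ.+ i) i ω)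
        scale σ i i< = subst₂ (λ p q → Scale (b i) p q (D σ 1 i ω) (D σ 2 i ω) (D σ (3 ℕ.+ i) i ω)) (sym (D-φ₀ σ i x y i<)) (sym (D-φ₀ (not σ) i x y i<))
          (subst₂ (λ p q → Scale (b i) (+ dig i o) (+ dig i u) p q (D σ (3 ℕ.+ i) i ω))
            (sym (trans (D-φ σ 1 i x y (s≤s (s≤s z≤n)) i<) (cong (λ z → + dig i (o + z)) (ℤₚ.*-identityˡ u)))) (sym (D-φ σ 2 i x y (s≤s (s≤s (s≤s z≤n))) i<))
            (subst (λ q → Scale (b i) (+ dig i o) (+ dig i u) (+ dig i (o + u)) (+ dig i (o + + 2 * u)) q) (sym (D-φ σ (3 ℕ.+ i) i x y (s≤s (s≤s (s≤s i<))) i<))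
              (Dg.scale-rule i (2-cancel i) u o)))
          where
          o = own σ x y
          u = own (not σ) x y

    module _ (no-fail : ∀ t → code (st t) ≢ fail) where

      row∈ : ∀ σ w → rowFn σ w ∈ rows
      row∈ σ w = ∈-tab (entry σ w) L (λ i _ → ∈-upTo⁺ (entry-< σ w i))

      φ∈ : ∀ x y → φ x y ∈ ωs
      φ∈ x y = ∈-filter⁺ rules? (∈-cartesianProduct⁺ (row∈ true (x + + X * y)) (∈-cartesianProduct⁺
        (∈-tab (λ a → rowFn false (y + mult a * x)) (suc nF) (λ a _ → row∈ false (y + mult a * x))) (∈-tab (λ a → rowFn true (x + mult a * y)) (suc nF) (λ a _ → row∈ true (x + mult a * y)))))
        (rules-φ no-fail x y)

      periodic : ∀ {c v} → (c , v) ∈ pers X → ∀ x y → c (φ x y) ≡ c (φ (x - proj₁ v) (y - proj₂ v))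
      periodic m x y = go (per-kind X m)
        where
        eq₁ : ∀ m x y → y + m * x ≡ y + - (- m) + m * (x + - 1ℤ)
        eq₁ = solve-∀
        eq₂ : ∀ m x y → x + m * y ≡ x + - m + m * (y + - (- 1ℤ))
        eq₂ = solve-∀
        go : ∀ {cv} → PerKind X cv → proj₁ cv (φ x y) ≡ proj₁ cv (φ (x - proj₁ (proj₂ cv)) (y - proj₂ (proj₂ cv)))
        go isX = cong (λ w → code-of (rowFn true w)) (eq₂ (+ X) x y)
        go (isF a a<) = cong code-of (trans (row-φ false a x y a<) (trans (cong (rowFn false) (eq₁ (mult a) x y)) (sym (row-φ false a (x - 1ℤ) (y - - mult a) a<))))
        go (isT a a<) = cong code-of (trans (row-φ true a x y a<) (trans (cong (rowFn true) (eq₂ (mult a) x y)) (sym (row-φ true a (x - mult a) (y - - 1ℤ) a<))))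

      clocked : ∀ x y → Cg (+ suc B′) (+ clock (φ x y)) x
      clocked x y = cg-trans (cg-reflexive (ρ-φ true x y)) (%-cg x (suc B′))

      tiles : TilingProblem inst
      tiles = solution⇒tiling φ φ∈ periodic clocked

-- A small while language compiled to the counter machine, the self-encoder, and the embedding of a
-- decider.

module Programs where

  open import Defs hiding (fetch) renaming (inc to incᵢ)
  open Defs using (fetch)
  open LocalRules using (Op; inc; dec; jmp; stop; fail; Config; module Machine; RegsBelow; get)
  open import Data.Nat using (ℕ; zero; suc; _+_; _*_; _^_; _<_; _≤_; z≤n; s≤s; _⊓_; pred)
  import Data.Nat.Properties as ℕₚ
  import Data.Nat
  open import Data.Nat.Tactic.RingSolver using (solve-∀)
  open import Data.Vec using (Vec; []; _∷_)
  open import Data.List using (List; []; _∷_; _++_; length; foldl)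
  open import Data.List.Properties using (length-++)
  open import Data.List.Relation.Unary.All using (All; []; _∷_)
  open import Data.List.Relation.Unary.All.Properties using (++⁺)
  open import Data.Maybe using (Maybe; just; nothing)
  open import Data.Maybe.Properties using (just-injective)
  open import Data.Product using (∃; _×_; _,_; proj₁; proj₂)
  open import Data.Unit using (⊤; tt)
  open import Data.Empty using (⊥-elim)
  open import Function using (_∘_)
  open import Relation.Nullary using (Dec; yes)
  open import Relation.Nullary.Decidable using (_×-dec_; True; False; toWitness; toWitnessFalse)
  open import Relation.Binary.PropositionalEquality

  set : ∀ {n} → Vec ℕ n → ℕ → ℕ → Vec ℕ n
  set []       _       x = []
  set (v ∷ vs) zero    x = x ∷ vs
  set (v ∷ vs) (suc i) x = v ∷ set vs i x

  _!_ : ∀ {n} → Vec ℕ n → ℕ → ℕ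
  v ! i = get 0 v i

  !-set : ∀ {n} (v : Vec ℕ n) {i x} → i < n → set v i x ! i ≡ x
  !-set (_ ∷ v) {zero}  l       = refl
  !-set (_ ∷ v) {suc i} (s≤s l) = !-set v l

  !-set-≢ : ∀ {n} (v : Vec ℕ n) {i j x} → i ≢ j → set v i x ! j ≡ v ! j
  !-set-≢ []      h = refl
  !-set-≢ (_ ∷ v) {zero}  {zero}  h = ⊥-elim (h refl)
  !-set-≢ (_ ∷ v) {zero}  {suc j} h = refl
  !-set-≢ (_ ∷ v) {suc i} {zero}  h = refl
  !-set-≢ (_ ∷ v) {suc i} {suc j} h = !-set-≢ v (h ∘ cong suc)

  set-set : ∀ {n} (v : Vec ℕ n) i x y → set (set v i x) i y ≡ set v i y
  set-set []      i       x y = refl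
  set-set (_ ∷ v) zero    x y = refl
  set-set (a ∷ v) (suc i) x y = cong (a ∷_) (set-set v i x y)

  set-comm : ∀ {n} (v : Vec ℕ n) i j x y → i ≢ j → set (set v i x) j y ≡ set (set v j y) i x
  set-comm []      i       j       x y h = refl
  set-comm (_ ∷ v) zero    zero    x y h = ⊥-elim (h refl)
  set-comm (_ ∷ v) zero    (suc j) x y h = refl
  set-comm (_ ∷ v) (suc i) zero    x y h = refl
  set-comm (a ∷ v) (suc i) (suc j) x y h = cong (a ∷_) (set-comm v i j x y (h ∘ cong suc))

  set-! : ∀ {n} (v : Vec ℕ n) i → set v i (v ! i) ≡ v
  set-! []      i       = refl
  set-! (_ ∷ v) zero    = refl
  set-! (a ∷ v) (suc i) = cong (a ∷_) (set-! v i)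

  upd-! : ∀ {n} (v : Vec ℕ n) r x → r < n → ∀ i → upd (v !_) r x i ≡ set v r x ! i
  upd-! (_ ∷ v) zero    x l       zero    = refl
  upd-! (_ ∷ v) zero    x l       (suc i) = refl
  upd-! (_ ∷ v) (suc r) x (s≤s l) zero    = refl
  upd-! (_ ∷ v) (suc r) x (s≤s l) (suc i) = upd-! v r x l i

  upd-cong : ∀ {R R′ : Regs} r {x x′} → x ≡ x′ → R ≗ R′ → upd R r x ≗ upd R′ r x′
  upd-cong zero    refl h zero    = refl
  upd-cong zero    refl h (suc i) = h (suc i)
  upd-cong (suc r) e    h zero    = h zero
  upd-cong (suc r) e    h (suc i) = upd-cong r e (h ∘ suc) i

  infixr 5 _⨾_
  data Cmd : Set where
    skip  : Cmd
    incr  : ℕ → Cmd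
    _⨾_   : Cmd → Cmd → Cmd
    while : ℕ → Cmd → Cmd
    ifnz  : ℕ → Cmd → Cmd → Cmd

  -- Testing a register for being nonzero decrements it.
  data Exec {n} : Cmd → Vec ℕ n → Vec ℕ n → Set where
    e-skip : ∀ {v} → Exec skip v v
    e-inc  : ∀ {r v} → Exec (incr r) v (set v r (suc (v ! r)))
    e-seq  : ∀ {c d u v w} → Exec c u v → Exec d v w → Exec (c ⨾ d) u w
    e-w0   : ∀ {r c v} → v ! r ≡ 0 → Exec (while r c) v v
    e-ws   : ∀ {r c u v w x} → u ! r ≡ suc x → Exec c (set u r x) v → Exec (while r c) v w → Exec (while r c) u w
    e-if   : ∀ {r c d u v x} → u ! r ≡ suc x → Exec c (set u r x) v → Exec (ifnz r c d) u v
    e-if0  : ∀ {r c d u v} → u ! r ≡ 0 → Exec d u v → Exec (ifnz r c d) u v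

  Below : ℕ → Cmd → Set
  Below n skip         = ⊤
  Below n (incr r)     = r < n
  Below n (c ⨾ d)      = Below n c × Below n d
  Below n (while r c)  = r < n × Below n c
  Below n (ifnz r c d) = r < n × Below n c × Below n d

  size : Cmd → ℕ
  size skip         = 0
  size (incr r)     = 1
  size (c ⨾ d)      = size c + size d
  size (while r c)  = 2 + size c
  size (ifnz r c d) = 2 + size c + size d

  emit : Cmd → ℕ → List Op
  emit skip         o = []
  emit (incr r)     o = inc r (suc o) ∷ []
  emit (c ⨾ d)      o = emit c o ++ emit d (o + size c)
  emit (while r c)  o = dec r (suc o) (o + (2 + size c)) ∷ emit c (suc o) ++ jmp o ∷ []
  emit (ifnz r c d) o = dec r (suc o) (o + (2 + size c)) ∷ emit c (suc o) ++ jmp (o + (2 + size c + size d)) ∷ emit d (o + (2 + size c))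

  length-emit : ∀ c o → length (emit c o) ≡ size c
  length-emit skip         o = refl
  length-emit (incr r)     o = refl
  length-emit (c ⨾ d)      o = trans (length-++ (emit c o)) (cong₂ _+_ (length-emit c o) (length-emit d _))
  length-emit (while r c)  o = cong suc (trans (length-++ (emit c (suc o))) (trans (cong (_+ 1) (length-emit c (suc o))) (ℕₚ.+-comm (size c) 1)))
  length-emit (ifnz r c d) o = cong suc (trans (length-++ (emit c (suc o)))
    (trans (cong₂ (λ a b → a + suc b) (length-emit c (suc o)) (length-emit d _)) (ℕₚ.+-suc (size c) (size d))))

  module Compile (code : ℕ → Op) where
    open Machine code

    Sits : ℕ → List Op → Set
    Sits o []       = ⊤
    Sits o (x ∷ xs) = code o ≡ x × Sits (suc o) xs

    sits-++ : ∀ o xs {ys} → Sits o (xs ++ ys) → Sits o xs × Sits (o + length xs) ys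
    sits-++ o []       {ys} s = tt , subst (λ z → Sits z ys) (sym (ℕₚ.+-identityʳ o)) s
    sits-++ o (x ∷ xs) {ys} (e , s) with p , q ← sits-++ (suc o) xs s = (e , p) , subst (λ z → Sits z ys) (sym (ℕₚ.+-suc o (length xs))) q

    -- Register contents are functions, so runs are compared up to pointwise equality.
    _~_ : Config → Config → Set
    (s , R) ~ (s′ , R′) = s ≡ s′ × R ≗ R′

    ~-refl : ∀ {c} → c ~ c
    ~-refl = refl , λ _ → refl

    ~-trans : ∀ {c d e} → c ~ d → d ~ e → c ~ e
    ~-trans (p , q) (p′ , q′) = trans p p′ , λ i → trans (q i) (q′ i)

    branch-~ : ∀ r s′ s₀ {R R′ x x′} → x ≡ x′ → R ≗ R′ → branch r s′ s₀ R x ~ branch r s′ s₀ R′ x′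
    branch-~ r s′ s₀ {x = zero}  refl h = refl , h
    branch-~ r s′ s₀ {x = suc x} refl h = refl , upd-cong r refl h

    exec-~ : ∀ op {c d} → c ~ d → exec op c ~ exec op d
    exec-~ (inc r s)    (refl , h) = refl , upd-cong r (cong suc (h r)) h
    exec-~ (dec r s s₀) (refl , h) = branch-~ r s s₀ (h r) h
    exec-~ (jmp s)      (refl , h) = refl , h
    exec-~ stop         h          = h
    exec-~ fail         h          = h

    step-~ : ∀ {c d} → c ~ d → step c ~ step d
    step-~ {s , R} (refl , h) = exec-~ (code s) (refl , h)

    steps-~ : ∀ n {c d} → c ~ d → steps n c ~ steps n d
    steps-~ zero    h = h
    steps-~ (suc n) h = step-~ (steps-~ n h)

    steps-+ : ∀ m n c → steps (m + n) c ≡ steps m (steps n c)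
    steps-+ zero    n c = refl
    steps-+ (suc m) n c = cong step (steps-+ m n c)

    Run : Config → Config → Set
    Run c d = ∃ λ n → steps n c ~ d

    run-trans : ∀ {c d e} → Run c d → Run d e → Run c e
    run-trans {c} {d} {e} (n , p) (m , q) = m + n , ~-trans (subst (_~ steps m d) (sym (steps-+ m n c)) (steps-~ m p)) q

    run-~ : ∀ {c d} → c ~ d → Run c d
    run-~ h = 0 , h

    run-step : ∀ {s R op d} → code s ≡ op → exec op (s , R) ~ d → Run (s , R) d
    run-step {s} {R} {op} {d} e h = 1 , subst (λ o → exec o (s , R) ~ d) (sym e) h

    compiled : ∀ {n} {c} {v w : Vec ℕ n} → Below n c → Exec c v w → ∀ o → Sits o (emit c o) → Run (o , v !_) (o + size c , w !_)
    compiled b e-skip o s = run-~ (sym (ℕₚ.+-identityʳ o) , λ _ → refl)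
    compiled {v = v} b (e-inc {r}) o (e , _) = run-step e (sym (ℕₚ.+-comm o 1) , upd-! v r _ b)
    compiled (b , b′) (e-seq {c} {d} {v = v} {w} x y) o s with sits-++ o (emit c o) s
    ... | s₁ , s₂ = run-trans (compiled b x o s₁) (subst (λ z → Run (o + size c , v !_) (z , w !_)) (ℕₚ.+-assoc o (size c) (size d))
                      (compiled b′ y (o + size c) (subst (λ z → Sits (o + z) (emit d (o + size c))) (length-emit c o) s₂)))
    compiled {v = v} b (e-w0 {r} {c} h) o (e , _) = run-step e (branch-~ r (suc o) (o + (2 + size c)) h (λ _ → refl))
    compiled {w = w} (r< , b) (e-ws {r} {c} {u} {v} {x = x} h e₁ e₂) o s@(e , s′) with sits-++ (suc o) (emit c (suc o)) s′
    ... | s₁ , s₂ = run-trans (run-step e (~-trans (branch-~ r (suc o) (o + (2 + size c)) h (λ _ → refl)) (refl , upd-! u r x r<)))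
        (run-trans (compiled b e₁ (suc o) s₁) (run-trans (run-step back ~-refl) (compiled (r< , b) e₂ o s)))
      where
      back : code (suc o + size c) ≡ jmp o
      back = trans (cong (λ z → code (suc o + z)) (sym (length-emit c (suc o)))) (proj₁ s₂)
    compiled (r< , b , b′) (e-if {r} {c} {d} {u} {v} {x} h e₁) o (e , s′) with sits-++ (suc o) (emit c (suc o)) s′
    ... | s₁ , s₂ = run-trans (run-step e (~-trans (branch-~ r (suc o) (o + (2 + size c)) h (λ _ → refl)) (refl , upd-! u r x r<)))
        (run-trans (compiled b e₁ (suc o) s₁) (run-step back ~-refl))
      where
      back : code (suc o + size c) ≡ jmp (o + (2 + size c + size d))
      back = trans (cong (λ z → code (suc o + z)) (sym (length-emit c (suc o)))) (proj₁ s₂)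
    compiled (r< , b , b′) (e-if0 {r} {c} {d} {u} {v} h e₁) o (e , s′) with sits-++ (suc o) (emit c (suc o)) s′
    ... | s₁ , s₂ = run-trans (run-step e (branch-~ r (suc o) (o + (2 + size c)) h (λ _ → refl)))
        (subst (λ z → Run (o + (2 + size c) , u !_) (z , v !_)) (ℕₚ.+-assoc o (2 + size c) (size d))
          (compiled b′ e₁ (o + (2 + size c)) (subst (λ z → Sits z (emit d (o + (2 + size c)))) pos (proj₂ s₂))))
      where
      pos : suc (suc o + length (emit c (suc o))) ≡ o + (2 + size c)
      pos = trans (cong (λ z → suc (suc o + z)) (length-emit c (suc o))) (eq o (size c))
        where eq : ∀ o n → suc (suc o + n) ≡ o + (2 + n)
              eq = solve-∀

  emit-below : ∀ k c o → Below k c → All (RegsBelow k) (emit c o)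
  emit-below k skip         o b = []
  emit-below k (incr r)     o b = b ∷ []
  emit-below k (c ⨾ d)      o (b , b′) = ++⁺ (emit-below k c o b) (emit-below k d _ b′)
  emit-below k (while r c)  o (r< , b) = r< ∷ ++⁺ (emit-below k c _ b) (tt ∷ [])
  emit-below k (ifnz r c d) o (r< , b , b′) = r< ∷ ++⁺ (emit-below k c _ b) (tt ∷ emit-below k d _ b′)

  move : ℕ → ℕ → Cmd
  move a b = while a (incr b)

  cast : ∀ {n c} {u v w : Vec ℕ n} → Exec c u v → v ≡ w → Exec c u w
  cast e refl = e

  exec-move : ∀ {n} a b → a ≢ b → a < n → b < n → (v : Vec ℕ n) → Exec (move a b) v (set (set v b (v ! a + v ! b)) a 0)
  exec-move {n} a b a≢b a< b< v = go (v ! a) v refl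
    where
    go : ∀ m v → v ! a ≡ m → Exec (move a b) v (set (set v b (v ! a + v ! b)) a 0)
    go zero v e = cast (e-w0 e) (sym (trans (cong (λ z → set (set v b (z + v ! b)) a 0) e)
      (trans (cong (λ z → set z a 0) (set-! v b)) (trans (cong (set v a) (sym e)) (set-! v a)))))
    go (suc m) v e = e-ws e e-inc (cast (go m w wa) same)
      where
      u = set v a m
      w = set u b (suc (u ! b))
      wa : w ! a ≡ m
      wa = trans (!-set-≢ u (a≢b ∘ sym)) (!-set v a<)
      wb : w ! b ≡ suc (v ! b)
      wb = trans (!-set u b<) (cong suc (!-set-≢ v a≢b))
      same : set (set w b (w ! a + w ! b)) a 0 ≡ set (set v b (v ! a + v ! b)) a 0
      same = trans (cong (λ z → set (set w b z) a 0) (trans (cong₂ _+_ wa wb) (trans (ℕₚ.+-suc m (v ! b)) (cong (_+ v ! b) (sym e)))))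
        (trans (cong (λ z → set z a 0) (trans (set-set u b _ _) (set-comm v a b m _ a≢b))) (set-set (set v b _) a m 0))

  -- Registers: input, 2X, scratch, parity, continue, tile list, k, ms, E, accumulator, operand, output.
  pattern mem d x t p g f k m e z a o = d ∷ x ∷ t ∷ p ∷ g ∷ f ∷ k ∷ m ∷ e ∷ z ∷ a ∷ o ∷ []

  -- `pair a z` is `2 z + 1` doubled `a` times. `popA` inverts this: it halves until an odd number
  -- appears, counts the even ones in register 10, and leaves the tail. In `halve`, the parity
  -- register toggles, since testing it also clears it.
  double pairZ halve popBody popA copyX : Cmd
  double  = while 9 (incr 2 ⨾ incr 2) ⨾ move 2 9
  pairZ   = double ⨾ incr 9 ⨾ while 10 double
  halve   = while 0 (ifnz 3 (incr 2) (incr 3)) ⨾ move 2 0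
  popBody = halve ⨾ ifnz 3 skip (incr 10 ⨾ incr 4)
  popA    = incr 4 ⨾ while 4 popBody
  copyX   = while 1 (incr 2 ⨾ incr 10) ⨾ move 2 1

  mv : ∀ a b (v : Vec ℕ 12) → {_ : True (ℕₚ._<?_ a 12)} → {_ : True (ℕₚ._<?_ b 12)} → {_ : False (a ℕₚ.≟ b)} →
       Exec (move a b) v (set (set v b (v ! a + v ! b)) a 0)
  mv a b v {p} {q} {r} = exec-move a b (toWitnessFalse r) (toWitness p) (toWitness q) v

  exec-double : ∀ {d x p g f k m e z a o} → Exec double (mem d x 0 p g f k m e z a o) (mem d x 0 p g f k m e (2 * z) a o)
  exec-double {d} {x} {p} {g} {f} {k} {m} {e} {z} {a} {o} =
    e-seq (loop z 0) (cast (mv 2 9 _) (cong (λ w → mem d x 0 p g f k m e w a o) (eq z)))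
    where
    eq : ∀ z → 2 * z + 0 + 0 ≡ 2 * z
    eq = solve-∀
    loop : ∀ z t → Exec (while 9 (incr 2 ⨾ incr 2)) (mem d x t p g f k m e z a o) (mem d x (2 * z + t) p g f k m e 0 a o)
    loop zero    t = e-w0 refl
    loop (suc z) t = e-ws refl (e-seq e-inc e-inc) (cast (loop z (suc (suc t))) (cong (λ w → mem d x w p g f k m e 0 a o) (eq′ z t)))
      where eq′ : ∀ z t → 2 * z + suc (suc t) ≡ 2 * suc z + t
            eq′ = solve-∀

  exec-pairZ : ∀ {d x p g f k m e z a o} → Exec pairZ (mem d x 0 p g f k m e z a o) (mem d x 0 p g f k m e (pair a z) 0 o)
  exec-pairZ {d} {x} {p} {g} {f} {k} {m} {e} {z} {a} {o} = e-seq exec-double (e-seq e-inc (loop a (suc (2 * z))))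
    where
    loop : ∀ a z → Exec (while 10 double) (mem d x 0 p g f k m e z a o) (mem d x 0 p g f k m e (2 ^ a * z) 0 o)
    loop zero    z = cast (e-w0 refl) (cong (λ w → mem d x 0 p g f k m e w 0 o) (sym (ℕₚ.+-identityʳ z)))
    loop (suc a) z = e-ws refl exec-double (cast (loop a (2 * z)) (cong (λ w → mem d x 0 p g f k m e w 0 o) (eq (2 ^ a) z)))
      where eq : ∀ q z → q * (2 * z) ≡ 2 * q * z
            eq = solve-∀

  twice : ℕ → ℕ
  twice zero    = zero
  twice (suc m) = suc (suc (twice m))

  twice≡ : ∀ m → twice m ≡ 2 * m
  twice≡ zero    = refl
  twice≡ (suc m) = trans (cong (suc ∘ suc) (twice≡ m)) (eq m)
    where eq : ∀ m → suc (suc (2 * m)) ≡ 2 * suc m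
          eq = solve-∀

  exec-halve : ∀ {x g f k m e z a o} j → Exec halve (mem (2 * j) x 0 0 g f k m e z a o) (mem j x 0 0 g f k m e z a o)
                                       × Exec halve (mem (suc (2 * j)) x 0 0 g f k m e z a o) (mem j x 0 1 g f k m e z a o)
  exec-halve {x} {g} {f} {k} {m} {e} {z} {a} {o} j =
      e-seq (subst (λ w → Exec loop (mem w x 0 0 g f k m e z a o) (mem 0 x (j + 0) 0 g f k m e z a o)) (twice≡ j) (even j 0)) (cast (mv 2 0 _) (cong (λ w → mem w x 0 0 g f k m e z a o) (eq j)))
    , e-seq (subst (λ w → Exec loop (mem (suc w) x 0 0 g f k m e z a o) (mem 0 x (j + 0) 1 g f k m e z a o)) (twice≡ j) (odd j 0)) (cast (mv 2 0 _) (cong (λ w → mem w x 0 1 g f k m e z a o) (eq j)))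
    where
    eq : ∀ j → j + 0 + 0 ≡ j
    eq = solve-∀
    loop : Cmd
    loop = while 0 (ifnz 3 (incr 2) (incr 3))
    even : ∀ j t → Exec loop (mem (twice j) x t 0 g f k m e z a o) (mem 0 x (j + t) 0 g f k m e z a o)
    even zero    t = e-w0 refl
    even (suc j) t = e-ws refl (e-if0 refl e-inc) (e-ws refl (e-if refl e-inc)
      (cast (even j (suc t)) (cong (λ w → mem 0 x w 0 g f k m e z a o) (ℕₚ.+-suc j t))))
    odd : ∀ j t → Exec loop (mem (suc (twice j)) x t 0 g f k m e z a o) (mem 0 x (j + t) 1 g f k m e z a o)
    odd zero    t = e-ws refl (e-if0 refl e-inc) (e-w0 refl)
    odd (suc j) t = e-ws refl (e-if0 refl e-inc) (e-ws refl (e-if refl e-inc)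
      (cast (odd j (suc t)) (cong (λ w → mem 0 x w 1 g f k m e z a o) (ℕₚ.+-suc j t))))

  exec-popA : ∀ {d x f k m e z a o} n → Exec popA (mem (pair n d) x 0 0 0 f k m e z a o) (mem d x 0 0 0 f k m e z (n + a) o)
  exec-popA {d} {x} {f} {k} {m} {e} {z} {a} {o} n = e-seq e-inc (loop n a)
    where
    loop : ∀ n a → Exec (while 4 popBody) (mem (pair n d) x 0 0 1 f k m e z a o) (mem d x 0 0 0 f k m e z (n + a) o)
    loop zero a = e-ws refl (e-seq (subst (λ w → Exec halve (mem w x 0 0 0 f k m e z a o) (mem d x 0 1 0 f k m e z a o)) (sym (ℕₚ.+-identityʳ (suc (2 * d)))) (proj₂ (exec-halve d)))
        (e-if refl e-skip)) (e-w0 refl)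
    loop (suc n) a = e-ws refl (e-seq (subst (λ w → Exec halve (mem w x 0 0 0 f k m e z a o) (mem (pair n d) x 0 0 0 f k m e z a o)) (sym (ℕₚ.*-assoc 2 (2 ^ n) (suc (2 * d)))) (proj₁ (exec-halve (pair n d))))
        (e-if0 refl (e-seq e-inc e-inc))) (cast (loop n (suc a)) (cong (λ w → mem d x 0 0 0 f k m e z w o) (ℕₚ.+-suc n a)))

  exec-copyX : ∀ {d x p g f k m e z o} → Exec copyX (mem d x 0 p g f k m e z 0 o) (mem d x 0 p g f k m e z x o)
  exec-copyX {d} {x} {p} {g} {f} {k} {m} {e} {z} {o} =
    e-seq (loop x 0 0) (cast (mv 2 1 _) (cong₂ (λ w w′ → mem d w 0 p g f k m e z w′ o) (eq x) (ℕₚ.+-identityʳ x)))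
    where
    eq : ∀ j → j + 0 + 0 ≡ j
    eq = solve-∀
    loop : ∀ x t a → Exec (while 1 (incr 2 ⨾ incr 10)) (mem d x t p g f k m e z a o) (mem d 0 (x + t) p g f k m e z (x + a) o)
    loop zero    t a = e-w0 refl
    loop (suc x) t a = e-ws refl (e-seq e-inc e-inc)
      (cast (loop x (suc t) (suc a)) (cong₂ (λ w w′ → mem d 0 w p g f k m e z w′ o) (ℕₚ.+-suc x t) (ℕₚ.+-suc x a)))

  incrs : ℕ → Cmd
  incrs zero    = skip
  incrs (suc c) = incr 2 ⨾ incrs c

  -- `powerX` starts from 2 because `encℤ (+ X)` is `2 * X`.
  scaleX powerX selfEncode : ℕ → Cmd
  scaleX c = while 1 (incrs c) ⨾ move 2 1
  powerX c = incr 1 ⨾ incr 1 ⨾ (while 0 (incr 2 ⨾ incr 10) ⨾ move 2 0) ⨾ while 10 (scaleX c)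
  addTile addTiles readArgs finish : Cmd
  -- The initial `incr 0` restores what the loop test in `addTiles` has subtracted from the encoded
  -- list.
  addTile = incr 0 ⨾ popA ⨾ move 10 9 ⨾ copyX ⨾ pairZ ⨾ move 9 10 ⨾ move 5 9 ⨾ pairZ ⨾ move 9 5
  addTiles = while 0 addTile
  readArgs = popA ⨾ move 10 6 ⨾ popA ⨾ move 10 7 ⨾ popA ⨾ move 10 8 ⨾ popA ⨾ move 10 5
  finish = move 5 10 ⨾ pairZ ⨾ move 8 10 ⨾ pairZ ⨾ move 7 10 ⨾ pairZ ⨾ move 6 10 ⨾ pairZ ⨾ move 9 11

  selfEncode c = powerX c ⨾ readArgs ⨾ addTiles ⨾ finish

  exec-incrs : ∀ c {d x t p g f k m e z a o} → Exec (incrs c) (mem d x t p g f k m e z a o) (mem d x (c + t) p g f k m e z a o)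
  exec-incrs zero    = e-skip
  exec-incrs (suc c) {d} {x} {t} {p} {g} {f} {k} {m} {e} {z} {a} {o} =
    e-seq e-inc (cast (exec-incrs c) (cong (λ w → mem d x w p g f k m e z a o) (ℕₚ.+-suc c t)))

  exec-scaleX : ∀ c {d x p g f k m e z a o} → Exec (scaleX c) (mem d x 0 p g f k m e z a o) (mem d (c * x) 0 p g f k m e z a o)
  exec-scaleX c {d} {x} {p} {g} {f} {k} {m} {e} {z} {a} {o} =
    e-seq (loop x 0) (cast (mv 2 1 _) (cong (λ w → mem d w 0 p g f k m e z a o) (eq c x)))
    where
    eq : ∀ c x → x * c + 0 + 0 ≡ c * x
    eq = solve-∀
    loop : ∀ x t → Exec (while 1 (incrs c)) (mem d x t p g f k m e z a o) (mem d 0 (x * c + t) p g f k m e z a o)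
    loop zero    t = e-w0 refl
    loop (suc x) t = e-ws refl (exec-incrs c) (cast (loop x (c + t)) (cong (λ w → mem d 0 w p g f k m e z a o) (eq′ x c t)))
      where eq′ : ∀ x c t → x * c + (c + t) ≡ suc x * c + t
            eq′ = solve-∀

  exec-powerX : ∀ c {d f k m e z o} → Exec (powerX c) (mem d 0 0 0 0 f k m e z 0 o) (mem d (2 * c ^ d) 0 0 0 f k m e z 0 o)
  exec-powerX c {d} {f} {k} {m} {e} {z} {o} = e-seq e-inc (e-seq e-inc (e-seq
      (e-seq (copy d 0 0) (cast (mv 2 0 _) (cong₂ (λ w w′ → mem w 2 0 0 0 f k m e z w′ o) (eq d) (ℕₚ.+-identityʳ d))))
      (cast (loop d 2) (cong (λ w → mem d w 0 0 0 f k m e z 0 o) (ℕₚ.*-comm (c ^ d) 2)))))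
    where
    eq : ∀ j → j + 0 + 0 ≡ j
    eq = solve-∀
    copy : ∀ n t a → Exec (while 0 (incr 2 ⨾ incr 10)) (mem n 2 t 0 0 f k m e z a o) (mem 0 2 (n + t) 0 0 f k m e z (n + a) o)
    copy zero    t a = e-w0 refl
    copy (suc n) t a = e-ws refl (e-seq e-inc e-inc)
      (cast (copy n (suc t) (suc a)) (cong₂ (λ w w′ → mem 0 2 w 0 0 f k m e z w′ o) (ℕₚ.+-suc n t) (ℕₚ.+-suc n a)))
    loop : ∀ n x → Exec (while 10 (scaleX c)) (mem d x 0 0 0 f k m e z n o) (mem d (c ^ n * x) 0 0 0 f k m e z 0 o)
    loop zero    x = cast (e-w0 refl) (cong (λ w → mem d w 0 0 0 f k m e z 0 o) (sym (ℕₚ.+-identityʳ x)))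
    loop (suc n) x = e-ws refl (exec-scaleX c) (cast (loop n (c * x)) (cong (λ w → mem d w 0 0 0 f k m e z 0 o) (eq′ (c ^ n) c x)))
      where eq′ : ∀ q c x → q * (c * x) ≡ c * q * x
            eq′ = solve-∀

  private
    plus0 : ∀ n → n + 0 ≡ n
    plus0 = ℕₚ.+-identityʳ

  exec-addTile : ∀ {d x f k m e o} c → Exec addTile (mem (pred (pair c d)) x 0 0 0 f k m e 0 0 o)
                                                            (mem d x 0 0 0 (pair (pair x c) f) k m e 0 0 o)
  exec-addTile {d} {x} {f} {k} {m} {e} {o} c =
    e-seq (cast e-inc (cong (λ w → mem w x 0 0 0 f k m e 0 0 o) (ℕₚ.suc-pred (pair c d) {{nz}})))
    (e-seq (cast (exec-popA c) (cong (λ w → mem d x 0 0 0 f k m e 0 w o) (plus0 c)))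
    (e-seq (cast (mv 10 9 _) (cong (λ w → mem d x 0 0 0 f k m e w 0 o) (plus0 c)))
    (e-seq exec-copyX
    (e-seq exec-pairZ
    (e-seq (cast (mv 9 10 _) (cong (λ w → mem d x 0 0 0 f k m e 0 w o) (plus0 (pair x c))))
    (e-seq (cast (mv 5 9 _) (cong (λ w → mem d x 0 0 0 0 k m e w (pair x c) o) (plus0 f)))
    (e-seq exec-pairZ
           (cast (mv 9 5 _) (cong (λ w → mem d x 0 0 0 w k m e 0 0 o) (plus0 (pair (pair x c) f)))))))))))
    where
    nz : Data.Nat.NonZero (pair c d)
    nz = ℕₚ.m*n≢0 (2 ^ c) (suc (2 * d)) {{ℕₚ.m^n≢0 2 c}}

  addAll : ℕ → ℕ → List ℕ → ℕ
  addAll x = foldl (λ f c → pair (pair x c) f)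

  exec-addTiles : ∀ {x k m e o} cs f → Exec addTiles (mem (encList cs) x 0 0 0 f k m e 0 0 o)
                                                             (mem 0 x 0 0 0 (addAll x f cs) k m e 0 0 o)
  exec-addTiles []       f = e-w0 refl
  exec-addTiles (c ∷ cs) f = e-ws (sym (ℕₚ.suc-pred (pair c (encList cs)) {{nz}})) (exec-addTile c) (exec-addTiles cs _)
    where
    nz : Data.Nat.NonZero (pair c (encList cs))
    nz = ℕₚ.m*n≢0 (2 ^ c) (suc (2 * encList cs)) {{ℕₚ.m^n≢0 2 c}}

  exec-readArgs : ∀ {d x} k m e f → Exec readArgs (mem (pair k (pair m (pair e (pair f d)))) x 0 0 0 0 0 0 0 0 0 0)
                                                        (mem d x 0 0 0 f k m e 0 0 0)
  exec-readArgs {d} {x} k m e f =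
    e-seq (exec-popA k) (e-seq (cast (mv 10 6 _) (cong (λ w → mem (pair m (pair e (pair f d))) x 0 0 0 0 w 0 0 0 0 0) (eq k)))
    (e-seq (exec-popA m) (e-seq (cast (mv 10 7 _) (cong (λ w → mem (pair e (pair f d)) x 0 0 0 0 k w 0 0 0 0) (eq m)))
    (e-seq (exec-popA e) (e-seq (cast (mv 10 8 _) (cong (λ w → mem (pair f d) x 0 0 0 0 k m w 0 0 0) (eq e)))
    (e-seq (exec-popA f) (cast (mv 10 5 _) (cong (λ w → mem d x 0 0 0 w k m e 0 0 0) (eq f)))))))))
    where eq : ∀ k → k + 0 + 0 ≡ k
          eq = solve-∀

  exec-finish : ∀ {d x} k m e f → Exec finish (mem d x 0 0 0 f k m e 0 0 0)
                                                    (mem d x 0 0 0 0 0 0 0 0 0 (encList (k ∷ m ∷ e ∷ f ∷ [])))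
  exec-finish {d} {x} k m e f =
    e-seq (cast (mv 5 10 _) (cong (λ w → mem d x 0 0 0 0 k m e 0 w 0) (plus0 f))) (e-seq exec-pairZ
    (e-seq (cast (mv 8 10 _) (cong (λ w → mem d x 0 0 0 0 k m 0 (pair f 0) w 0) (plus0 e))) (e-seq exec-pairZ
    (e-seq (cast (mv 7 10 _) (cong (λ w → mem d x 0 0 0 0 k 0 0 (pair e (pair f 0)) w 0) (plus0 m))) (e-seq exec-pairZ
    (e-seq (cast (mv 6 10 _) (cong (λ w → mem d x 0 0 0 0 0 0 0 (pair m (pair e (pair f 0))) w 0) (plus0 k))) (e-seq exec-pairZ
           (cast (mv 9 11 _) (cong (λ w → mem d x 0 0 0 0 0 0 0 0 0 w) (plus0 (pair k (pair m (pair e (pair f 0))))))))))))))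

  exec-selfEncode : ∀ c k m e f cs → let d = encList (k ∷ m ∷ e ∷ f ∷ cs) ; x = 2 * c ^ d in
    Exec (selfEncode c) (mem d 0 0 0 0 0 0 0 0 0 0 0) (mem 0 x 0 0 0 0 0 0 0 0 0 (encList (k ∷ m ∷ e ∷ addAll x f cs ∷ [])))
  exec-selfEncode c k m e f cs = e-seq (exec-powerX c) (e-seq (exec-readArgs k m e f) (e-seq (exec-addTiles cs f) (exec-finish k m e _)))

  -- Only `incrs c` has symbolic length and needs an induction; the remaining pieces are closed
  -- commands, decided by evaluation.
  selfEncode-below : ∀ c k → Below (12 + k) (selfEncode c)
  selfEncode-below c k = monotone (selfEncode c) (toBelow c)
    where
    monotone : ∀ c → Below 12 c → Below (12 + k) c
    monotone skip         b            = tt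
    monotone (incr r)     b            = ℕₚ.≤-trans b (ℕₚ.m≤m+n 12 k)
    monotone (c ⨾ d)      (b , b′)     = monotone c b , monotone d b′
    monotone (while r c)  (r< , b)     = ℕₚ.≤-trans r< (ℕₚ.m≤m+n 12 k) , monotone c b
    monotone (ifnz r c d) (r< , b , b′) = ℕₚ.≤-trans r< (ℕₚ.m≤m+n 12 k) , monotone c b , monotone d b′
    below? : ∀ c → Dec (Below 12 c)
    below? skip         = yes tt
    below? (incr r)     = r ℕₚ.<? 12
    below? (c ⨾ d)      = below? c ×-dec below? d
    below? (while r c)  = (r ℕₚ.<? 12) ×-dec below? c
    below? (ifnz r c d) = (r ℕₚ.<? 12) ×-dec (below? c ×-dec below? d)
    incrs-below : ∀ c → Below 12 (incrs c)
    incrs-below zero    = tt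
    incrs-below (suc c) = toWitness {a? = 2 ℕₚ.<? 12} tt , incrs-below c
    toBelow : ∀ c → Below 12 (selfEncode c)
    toBelow c =
      ( toWitness {a? = below? (incr 1)} tt , toWitness {a? = below? (incr 1)} tt
      , toWitness {a? = below? (while 0 (incr 2 ⨾ incr 10) ⨾ move 2 0)} tt
      , toWitness {a? = 10 ℕₚ.<? 12} tt , (toWitness {a? = 1 ℕₚ.<? 12} tt , incrs-below c) , toWitness {a? = below? (move 2 1)} tt)
      , toWitness {a? = below? readArgs} tt , toWitness {a? = below? addTiles} tt , toWitness {a? = below? finish} tt

  -- p occupies the labels from o on and the registers from 11 on; when it halts, control arrives at label o + length p.
  module Embed (p : Program) (o : ℕ) where

    label : ℕ → ℕ
    label j = o + (j ⊓ length p)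

    embedOp : ℕ → Instr → Op
    embedOp pc (incᵢ r)    = inc (11 + r) (label (suc pc))
    embedOp pc (decjz r j) = dec (11 + r) (label (suc pc)) (label j)

    embed : ℕ → Program → List Op
    embed pc []       = []
    embed pc (i ∷ is) = embedOp pc i ∷ embed (suc pc) is

    length-embed : ∀ pc is → length (embed pc is) ≡ length is
    length-embed pc []       = refl
    length-embed pc (i ∷ is) = cong suc (length-embed (suc pc) is)

    module _ (code : ℕ → Op) where
      open Machine code
      open Compile code

      module _ (sits : Sits o (embed 0 p)) where

        sits-fetch : ∀ a pc is → Sits a (embed pc is) → ∀ j {i} → fetch is j ≡ just i → j < length is × code (a + j) ≡ embedOp (pc + j) i
        sits-fetch a pc (i ∷ is) (e , _) zero refl = s≤s z≤n , trans (cong code (ℕₚ.+-identityʳ a)) (trans e (cong (λ z → embedOp z i) (sym (ℕₚ.+-identityʳ pc))))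
        sits-fetch a pc (_ ∷ is) (_ , s) (suc j) {i} h with l , e ← sits-fetch (suc a) (suc pc) is s j h =
          s≤s l , trans (cong code (ℕₚ.+-suc a j)) (trans e (cong (λ z → embedOp z i) (sym (ℕₚ.+-suc pc j))))

        fetch-out : ∀ is j → fetch is j ≡ nothing → length is ≤ j
        fetch-out []       j       h = z≤n
        fetch-out (i ∷ is) (suc j) h = s≤s (fetch-out is j h)

        at : ∀ pc {i} → fetch p pc ≡ just i → code (label pc) ≡ embedOp pc i
        at pc h with l , e ← sits-fetch o 0 p sits pc h = trans (cong (λ z → code (o + z)) (ℕₚ.m≤n⇒m⊓n≡m (ℕₚ.<⇒≤ l))) e

        Agree : Regs → Regs → Set
        Agree R R′ = ∀ r → R′ (11 + r) ≡ R r

        embedded : ∀ n pc R R′ {y} → Agree R R′ → run p n (pc , R) ≡ just y →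
                   ∃ λ R″ → Run (label pc , R′) (o + length p , R″) × R″ 11 ≡ y
        embedded n pc R R′ ag h with fetch p pc in eq
        embedded n pc R R′ ag h | nothing = R′ , run-~ (cong (o +_) (ℕₚ.m≥n⇒m⊓n≡n (fetch-out p pc eq)) , λ _ → refl) , trans (ag 0) (just-injective h)
        embedded zero pc R R′ ag () | just _
        embedded (suc n) pc R R′ ag h | just (incᵢ r)
          with R″ , ru , y ← embedded n (suc pc) (upd R r (suc (R r))) (upd R′ (11 + r) (suc (R′ (11 + r)))) (upd-cong r (cong suc (ag r)) ag) h
          = R″ , run-trans (run-step (at pc eq) ~-refl) ru , y
        embedded (suc n) pc R R′ ag h | just (decjz r j) with R r in eqr
        ... | zero with R″ , ru , y ← embedded n j R R′ ag h
          = R″ , run-trans (run-step (at pc eq) (branch-~ (11 + r) (label (suc pc)) (label j) (trans (ag r) eqr) (λ _ → refl))) ru , y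
        embedded (suc n) pc R R′ ag h | just (decjz r j) | suc v
          with R″ , ru , y ← embedded n (suc pc) (upd R r v) (upd R′ (11 + r) v) (upd-cong r refl ag) h
          = R″ , run-trans (run-step (at pc eq) (branch-~ (11 + r) (label (suc pc)) (label j) (trans (ag r) eqr) (λ _ → refl))) ru , y

  regBound : Program → ℕ
  regBound []               = 0
  regBound (incᵢ r ∷ is)    = suc r + regBound is
  regBound (decjz r j ∷ is) = suc r + regBound is

  embed-below : ∀ p o k pc is → regBound is ≤ k → All (RegsBelow (12 + k)) (Embed.embed p o pc is)
  embed-below p o k pc []               h = []
  embed-below p o k pc (incᵢ r ∷ is)    h = ℕₚ.+-monoʳ-≤ 12 (ℕₚ.≤-trans (ℕₚ.≤-trans (ℕₚ.n≤1+n r) (ℕₚ.m≤m+n (suc r) _)) h)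
    ∷ embed-below p o k (suc pc) is (ℕₚ.≤-trans (ℕₚ.m≤n+m (regBound is) (suc r)) h)
  embed-below p o k pc (decjz r j ∷ is) h = ℕₚ.+-monoʳ-≤ 12 (ℕₚ.≤-trans (ℕₚ.≤-trans (ℕₚ.n≤1+n r) (ℕₚ.m≤m+n (suc r) _)) h)
    ∷ embed-below p o k (suc pc) is (ℕₚ.≤-trans (ℕₚ.m≤n+m (regBound is) (suc r)) h)

-- The diagonal argument against a decider.

open import Defs
open Arithmetic
open LocalRules
open Programs
open Necessity using (module NoSolution)
open Sufficiency using (module HasTiling)
open import Data.Nat using (ℕ; zero; suc; _+_; _*_; _^_; _<_; _≤_; z≤n; s≤s)
import Data.Nat.Properties as ℕₚ
open import Data.Integer using (+_; -_; 1ℤ)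
open import Data.Bool.Properties using (T?)
import Data.Vec
open import Data.Vec using (Vec; []; _∷_)
open import Data.List using (List; []; _∷_; _++_; length; map; foldr; reverse; filter)
open import Data.List.Properties using (++-assoc; reverse-foldl)
open import Data.List.Relation.Unary.All using (All; []; _∷_)
open import Data.List.Relation.Unary.All.Properties using (++⁺)
open import Data.Product using (∃; _×_; _,_; proj₁; proj₂)
open import Data.Unit using (tt)
open import Data.Empty using (⊥)
open import Relation.Nullary using (¬_)
open import Relation.Binary.PropositionalEquality hiding (J)

opAt : List Op → ℕ → Op
opAt []       _       = stop
opAt (x ∷ xs) zero    = x
opAt (x ∷ xs) (suc n) = opAt xs n

opAt-out : ∀ xs s → length xs ≤ s → opAt xs s ≡ stop
opAt-out []       s       l       = refl
opAt-out (x ∷ xs) (suc s) (s≤s l) = opAt-out xs s l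

opAt-below : ∀ {k} xs → All (RegsBelow k) xs → ∀ s → RegsBelow k (opAt xs s)
opAt-below []       []       s       = tt
opAt-below (x ∷ xs) (b ∷ bs) zero    = b
opAt-below (x ∷ xs) (b ∷ bs) (suc s) = opAt-below xs bs s

sits-shift : ∀ code code′ o xs → (∀ i → code′ (o + i) ≡ code i) → ∀ a → Compile.Sits code a xs → Compile.Sits code′ (o + a) xs
sits-shift code code′ o []       h a s       = tt
sits-shift code code′ o (x ∷ xs) h a (e , s) = trans (h a) e , subst (λ z → Compile.Sits code′ z xs) (ℕₚ.+-suc o a) (sits-shift code code′ o xs h (suc a) s)

sits-self : ∀ xs → Compile.Sits (opAt xs) 0 xs
sits-self []       = tt
sits-self (x ∷ xs) = refl , sits-shift (opAt xs) (opAt (x ∷ xs)) 1 xs (λ _ → refl) 0 (sits-self xs)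

module Reduction (k nS : ℕ) (code : ℕ → Op) where

  open Bases k using (β; start-code)
  open Local k nS code using (ωs; B′; clock; bound; pers; sidePers; bounded; clock-bounded; code-of; rowX; W)
  open Sampling.Problem ωs B′ clock bound using (q; wt; perEqn; perEqn′; fixedEqns; origin; N′; module Periodic)
  open Tilings using (Eqn; mkPart; weights; sel)
  open Tilings.System N′ q using (allF; allE; partF; vecs; value; rep)

  J : ℕ → Instance
  J input = Periodic.inst (pers X) (bounded X) clock-bounded
    where X = start-code input

  wX : Vec ℕ q
  wX = wt (λ ω → code-of (rowX ω)) ωs

  rest : List (Eqn q)
  rest = map perEqn′ sidePers ++ fixedEqns

  -- The first equation with its shift replaced by a placeholder: `E` and the unshifted part of the
  -- tile do not see the shift.
  e₀ : Eqn q
  e₀ = perEqn wX origin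

  movers : List (Vec ℕ q)
  movers = filter (λ x → T? (Sampling.nonZero (value wX x))) vecs

  fixedPoints : List (Point (suc (suc q)))
  fixedPoints = partF 0 e₀ (mkPart origin 0 Sampling.isZero) ++ allF 1 rest

  -- The encoding of a tile point `(X , -1 , 0 ∷ 0 ∷ x)` without its first entry; prefixing `2 * X`
  -- completes it.
  moverCode : Vec ℕ q → ℕ
  moverCode x = encList (encℤ (- 1ℤ) ∷ encList (vecToList (0 ∷ 0 ∷ x)) ∷ [])

  kc mc ec fc : ℕ
  kc = suc (suc q)
  mc = encList (vecToList (length (e₀ ∷ rest) ∷ 1 ∷ rep))
  ec = encList (map (λ g → encList (vecToList g)) (allE 0 (e₀ ∷ rest)))
  fc = encList (map encPoint fixedPoints)

  -- Everything in the encoding of J but the parameter X, and the input on which J is finally considered.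
  self : ℕ
  self = encList (kc ∷ mc ∷ ec ∷ fc ∷ reverse (map moverCode movers))

  encode-movers : ∀ X xs R → encList (map encPoint (map (λ x → + X , - 1ℤ , 0 ∷ 0 ∷ x) xs ++ R)) ≡
                  foldr (λ c f → pair (pair (2 * X) c) f) (encList (map encPoint R)) (map moverCode xs)
  encode-movers X []       R = refl
  encode-movers X (x ∷ xs) R = cong (pair (pair (2 * X) (moverCode x))) (encode-movers X xs R)

  -- The tile list is a right fold over `movers`, the machine computes a left fold; `reverse`
  -- reconciles the two.
  encode-J : ∀ input → encInstance (J input) ≡ encList (kc ∷ mc ∷ ec ∷ addAll (2 * β 1 ^ input) fc (reverse (map moverCode movers)) ∷ [])
  encode-J input = cong (λ f → encList (kc ∷ mc ∷ ec ∷ f ∷ [])) tiles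
    where
    X = β 1 ^ input
    ms : List (Point (suc (suc q)))
    ms = map (λ x → + X , - 1ℤ , 0 ∷ 0 ∷ x) movers
    fs = partF 0 e₀ (mkPart origin 0 Sampling.isZero)
    tiles : encList (map encPoint (Instance.F (J input))) ≡ addAll (2 * X) fc (reverse (map moverCode movers))
    tiles = trans (cong (λ l → encList (map encPoint l)) (trans (++-assoc ms (fs ++ []) (allF 1 rest))
              (cong (ms ++_) (++-assoc fs [] (allF 1 rest)))))
            (trans (encode-movers X movers fixedPoints) (sym (reverse-foldl (λ f c → pair (pair (2 * X) c) f) fc (map moverCode movers))))

  failing⇒no-tiling : 0 < k → (∀ s → nS ≤ s → code s ≡ stop) → (∀ s → RegsBelow k (code s)) → ∀ input t →
    code (proj₁ (Machine.steps code t (initial input))) ≡ fail → ¬ TilingProblem (J input)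
  failing⇒no-tiling 0<k outside regs input t e tl = NoSolution.never-fails k nS code 0<k outside regs input
    (Periodic.tiling⇒solution (pers (start-code input)) (bounded (start-code input)) clock-bounded tl) t e

  safe⇒tiling : 0 < k → (∀ s → RegsBelow k (code s)) → ∀ input →
    (∀ t → code (proj₁ (Machine.steps code t (initial input))) ≢ fail) → TilingProblem (J input)
  safe⇒tiling 0<k regs input nf = HasTiling.tiles k nS code 0<k regs input nf

module Decider (p : Program) (c : ℕ) where

  S : Cmd
  S = selfEncode c

  o h : ℕ
  o = size S
  h = o + length p

  open Embed p o

  -- Register 11 is the output register of `p`. Answer 1 passes the first test and is zero at the
  -- second, which leads to `fail`; any other answer leads to `stop`.
  verdict : List Op
  verdict = dec 11 (suc h) (3 + h) ∷ dec 11 (3 + h) (2 + h) ∷ fail ∷ stop ∷ []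

  ops : List Op
  ops = emit S 0 ++ (embed 0 p ++ verdict)

  code : ℕ → Op
  code = opAt ops

  regs : ∀ k → 12 + regBound p ≤ k → ∀ s → RegsBelow k (code s)
  regs k le s = regs-mono (code s) (opAt-below ops (++⁺ (emit-below _ S 0 (selfEncode-below c (regBound p)))
    (++⁺ (embed-below p o (regBound p) 0 p ℕₚ.≤-refl) (11<k ∷ 11<k ∷ tt ∷ tt ∷ []))) s)
    where
    11<k : 11 < 12 + regBound p
    11<k = ℕₚ.m≤m+n 12 (regBound p)
    regs-mono : ∀ op → RegsBelow (12 + regBound p) op → RegsBelow k op
    regs-mono (inc r _)   l = ℕₚ.≤-trans l le
    regs-mono (dec r _ _) l = ℕₚ.≤-trans l le
    regs-mono (jmp _)     l = tt
    regs-mono stop        l = tt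
    regs-mono fail        l = tt

  open Machine code
  open Compile code

  sits : Sits 0 ops
  sits = sits-self ops

  sits-embed : Sits o (embed 0 p) × Sits h verdict
  sits-embed = proj₁ both , subst (λ z → Sits (o + z) verdict) (length-embed 0 p) (proj₂ both)
    where
    both : Sits o (embed 0 p) × Sits (o + length (embed 0 p)) verdict
    both = sits-++ o (embed 0 p) (subst (λ z → Sits z (embed 0 p ++ verdict)) (length-emit S 0) (proj₂ (sits-++ 0 (emit S 0) sits)))

  halted : ∀ op → (∀ c → exec op c ≡ c) → ∀ n c → code (proj₁ c) ≡ op → steps n c ≡ c
  halted op fixed zero    c e = refl
  halted op fixed (suc n) c e = trans (cong step (halted op fixed n c e)) (trans (cong (λ z → exec z c) e) (fixed c))

  -- Both `fail` and `stop` freeze the configuration, so at time `t + t′` the run would be in both.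
  exclusive : ∀ c₀ t t′ → code (proj₁ (steps t c₀)) ≡ fail → code (proj₁ (steps t′ c₀)) ≡ stop → ⊥
  exclusive c₀ t t′ e e′ = clash (trans (sym e) (trans (cong (λ c → code (proj₁ c)) same) e′))
    where
    clash : fail ≡ stop → ⊥
    clash ()
    same : steps t c₀ ≡ steps t′ c₀
    same = trans (sym (halted fail (λ _ → refl) t′ (steps t c₀) e))
      (trans (sym (steps-+ t′ t c₀))
      (trans (cong (λ n → steps n c₀) (ℕₚ.+-comm t′ t))
      (trans (steps-+ t t′ c₀) (halted stop (λ _ → refl) t (steps t′ c₀) e′))))

  module _ (kc mc ec fc : ℕ) (cs : List ℕ) where

    self goal : ℕ
    self = encList (kc ∷ mc ∷ ec ∷ fc ∷ cs)
    goal = encList (kc ∷ mc ∷ ec ∷ addAll (2 * c ^ self) fc cs ∷ [])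

    conf : ℕ → Config
    conf t = steps t (initial self)

    final-mem : Vec ℕ 12
    final-mem = mem 0 (2 * c ^ self) 0 0 0 0 0 0 0 0 0 goal

    prepared : Run (initial self) (o , final-mem !_)
    prepared = run-trans (run-~ (refl , λ { zero → refl ; (suc i) → sym (zeros 11 i) }))
      (compiled {n = 12} (selfEncode-below c 0) (exec-selfEncode c kc mc ec fc cs) 0 (proj₁ (sits-++ 0 (emit S 0) sits)))
      where
      zeros : ∀ n i → get 0 (Data.Vec.replicate n 0) i ≡ 0
      zeros zero    i       = refl
      zeros (suc n) zero    = refl
      zeros (suc n) (suc i) = zeros n i

    decided : ∀ {y} → HaltsWith p goal y → ∃ λ R → Run (initial self) (h , R) × R 11 ≡ y
    decided (n , e) with embedded code (proj₁ sits-embed) n 0 (proj₂ (initial goal)) (final-mem !_) (λ { zero → refl ; (suc r) → refl }) e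
    ... | R , ru , y = R , run-trans prepared (run-trans (run-~ (sym (ℕₚ.+-identityʳ o) , λ _ → refl)) ru) , y

    accepted : HaltsWith p goal 1 → ∃ λ t → code (proj₁ (conf t)) ≡ fail
    accepted hw = go (decided hw)
      where
      v = proj₂ sits-embed
      go : (∃ λ R → Run (initial self) (h , R) × R 11 ≡ 1) → ∃ λ t → code (proj₁ (conf t)) ≡ fail
      go (R , ru , y) = proj₁ path , trans (cong code (proj₁ (proj₂ path))) (proj₁ (proj₂ (proj₂ v)))
        where
        path : Run (initial self) (2 + h , upd R 11 0)
        path = run-trans ru (run-trans (run-step {op = dec 11 (suc h) (3 + h)} (proj₁ v) (branch-~ 11 (suc h) (3 + h) y (λ _ → refl)))
          (run-step {op = dec 11 (3 + h) (2 + h)} (proj₁ (proj₂ v)) (branch-~ 11 (3 + h) (2 + h) (upd-same R 11 0) (λ _ → refl))))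

    rejected : HaltsWith p goal 0 → ∃ λ t → code (proj₁ (conf t)) ≡ stop
    rejected hw = go (decided hw)
      where
      v = proj₂ sits-embed
      go : (∃ λ R → Run (initial self) (h , R) × R 11 ≡ 0) → ∃ λ t → code (proj₁ (conf t)) ≡ stop
      go (R , ru , y) = proj₁ path , trans (cong code (proj₁ (proj₂ path))) (proj₁ (proj₂ (proj₂ (proj₂ v))))
        where
        path : Run (initial self) (3 + h , R)
        path = run-trans ru (run-step {op = dec 11 (suc h) (3 + h)} (proj₁ v) (branch-~ 11 (suc h) (3 + h) y (λ _ → refl)))

theorem1p3 : ¬ AlgorithmicallyDecidable encInstance TilingProblem
theorem1p3 (p , decides) = contradiction′ (12 + regBound p) ℕₚ.≤-refl
  where
  -- Registers 0 to 11 serve the encoder, and `p` starts at 11. A generic `k` keeps `Bases.β k 1`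
  -- from unfolding.
  contradiction′ : ∀ k → 12 + regBound p ≤ k → ⊥
  contradiction′ k le = safe (proj₁ accept) (proj₂ accept)
    where
    c = Bases.β k 1
    open Decider p c using (ops; code; regs; exclusive)
    module R = Reduction k (length ops) code
    module D = Decider p c
    cs = reverse (map R.moverCode R.movers)
    0<k : 0 < k
    0<k = ℕₚ.≤-trans (s≤s z≤n) le
    encoding : encInstance (R.J R.self) ≡ D.goal R.kc R.mc R.ec R.fc cs
    encoding = R.encode-J R.self
    -- A failure would exclude a tiling, so `p` would answer 0 and the same run would stop. Hence
    -- the run is safe and a tiling exists, so `p` answers 1 and the run fails; no case distinction
    -- on tileability is needed.
    safe : ∀ t → code (proj₁ (Machine.steps code t (initial R.self))) ≢ fail
    safe t e = exclusive (initial R.self) t (proj₁ reject) e (proj₂ reject)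
      where
      reject = D.rejected R.kc R.mc R.ec R.fc cs (subst (λ g → HaltsWith p g 0) encoding
        (proj₂ (decides (R.J R.self)) (R.failing⇒no-tiling 0<k (opAt-out ops) (regs k le) R.self t e)))
    accept = D.accepted R.kc R.mc R.ec R.fc cs (subst (λ g → HaltsWith p g 1) encoding
      (proj₁ (decides (R.J R.self)) (R.safe⇒tiling 0<k (regs k le) R.self safe)))
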